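{- Let $\alpha$ be an infinite ordinal. There is an algebra in $\mathsf{RCA}_\alpha$ which is not endo-dimension-complemented, but each algebra in $\mathsf{RCA}_\alpha$ can be embedded into an endo-dimension-complemented algebra. In symbols: $\mathsf{Edc}_\alpha\subset\mathbf{S}\,\mathsf{Edc}_\alpha=\mathsf{RCA}_\alpha$, where $\subset$ denotes proper inclusion.
   Context: A cylindric algebra of dimension $\alpha$ (a $\mathsf{CA}_\alpha$) is an algebra $\langle A,+,-,c_i,d_{ij}: i,j\in\alpha\rangle$ such that $\langle A,+,-\rangle$ is a Boolean algebra and for all distinct $i,j,k\in\alpha$ and all $x,y\in A$: $c_ic_jx=c_jc_ix$, $x\le c_ix=c_ic_ix$, $c_i(x+y)=c_ix+c_iy$, $c_i-c_ix=-c_ix$, $d_{ii}=1$, $d_{ij}=d_{ji}$, $c_j(d_{ij}\cdot d_{jk})=d_{ik}$, $c_id_{ij}=1$, $d_{ij}\cdot c_i(d_{ij}\cdot x)=d_{ij}\cdot x$. For $V\subseteq{}^\alpha U$, the full cylindric set algebra with unit $V$ is $\langle \mathcal P(V),\cup,-,C_i^V,D_{ij}^V : i,j\in\alpha\rangle$, where $C_i^VX=\{s(i/u)\in V : s\in X,\ u\in U\}$ ($s(i/u)$ is $s$ with its value at $i$ changed to $u$) and $D_{ij}^V=\{s\in V : s_i=s_j\}$. $\mathsf{RCA}_\alpha$ is the class of all algebras isomorphic to subalgebras of full cylindric set algebras whose unit is a disjoint union of sets of the form ${}^\alpha U$. For $\mathfrak A\in\mathsf{CA}_\alpha$ and $\Gamma\subseteq\alpha$,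 the $\Gamma$-reduct of $\mathfrak A$ is $\langle A,+,-,c_i,d_{ij}\rangle_{i,j\in\Gamma}$. An algebra $\mathfrak A\in\mathsf{CA}_\alpha$ is endo-dimension-complemented if for each finite $\Gamma\subseteq\alpha$ and each nonzero $x\in A$ there are $\kappa\in\alpha-\Gamma$ and an endomorphism $h$ of the $\Gamma$-reduct of $\mathfrak A$ such that $h(x)\neq0$ and $c_\kappa h(a)=h(a)$ for all $a\in A$. $\mathsf{Edc}_\alpha$ is the class of all endo-dimension-complemented $\mathsf{CA}_\alpha$s, and $\mathbf{S}\,\mathsf K$ is the class of all subalgebras of members of $\mathsf K$. -}

module Defs where

open import Level using (Level; _⊔_) renaming (suc to lsuc)
open import Algebra.Core using (Op₁; Op₂)
open import Algebra.Definitions using (Congruent₁; Congruent₂)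
open import Algebra.Lattice.Structures using (IsBooleanAlgebra)
open import Data.Bool.Base using (if_then_else_)
open import Data.Fin.Base using (Fin)
open import Data.List.Base using (List)
open import Data.List.Membership.Propositional using () renaming (_∈_ to _∈ˡ_; _∉_ to _∉ˡ_)
open import Data.Product.Base using (Σ; ∃; ∃-syntax; _×_; _,_; proj₁; proj₂)
open import Data.Sum.Base using (_⊎_; inj₁; inj₂)
open import Function.Base using (_on_)
open import Function.Bundles using (Func; Surjection; _⇔_; _↔_)
open import Function.Definitions using (Injective; Surjective)
open import Induction.WellFounded using (WellFounded)
open import Relation.Binary.Bundles using (Setoid)
open import Relation.Binary.Core using (Rel)
open import Relation.Binary.Definitions using (DecidableEquality; _Respects_)
open import Relation.Binary.PropositionalEquality.Core using (_≡_; _≢_)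
open import Relation.Binary.Structures using (IsEquivalence; IsStrictTotalOrder)
open import Relation.Nullary.Decidable.Core using (does)
open import Relation.Nullary.Negation.Core using (¬_)
open import Relation.Unary using (Pred; _∈_; _⊆_; _≐_)

private
  variable
    a b e e₁ e₂ p u i : Level

-- The axiom of choice, for sets understood as setoids: every surjection has a
-- section that respects equality (without the last requirement the principle
-- would be provable).
AxiomOfChoice : ∀ ℓ → Set (lsuc ℓ)
AxiomOfChoice ℓ =
  {A B : Setoid ℓ ℓ} (f : Surjection A B) →
  Σ (Func B A) λ g → ∀ y →
    Setoid._≈_ B (Surjection.to f (Func.to g y)) y

record Ordinal ℓ : Set (lsuc ℓ) where
  infix 4 _<_
  field
    Carrier            : Set ℓ
    _<_                : Rel Carrier ℓ
    isStrictTotalOrder : IsStrictTotalOrder _≡_ _<_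
    wellFounded        : WellFounded _<_
  open IsStrictTotalOrder isStrictTotalOrder public using (_≟_)

Infinite : Set a → Set a
Infinite X = ¬ (∃[ n ] (Fin n ↔ X))

-- Algebras of the similarity type of CA's with index set I, with no axioms
-- imposed.  The index set is an arbitrary type so that reducts are again
-- algebras in this sense.
record Algebra (I : Set i) a e : Set (i ⊔ lsuc (a ⊔ e)) where
  infix  4 _≈_ _≤_
  infixl 6 _+_
  infixl 7 _·_
  infix  8 -_
  field
    Carrier       : Set a
    _≈_           : Rel Carrier e
    isEquivalence : IsEquivalence _≈_
    _+_           : Op₂ Carrier
    -_            : Op₁ Carrier
    c             : I → Op₁ Carrier
    d             : I → I → Carrier
    +-cong        : Congruent₂ _≈_ _+_
    -‿cong        : Congruent₁ _≈_ -_
    c-cong        : ∀ j → Congruent₁ _≈_ (c j)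

  _·_ : Op₂ Carrier
  x · y = - (- x + - y)

  _≤_ : Rel Carrier e
  x ≤ y = x + y ≈ y

module _ {I : Set i} where

  record IsCylindricAlgebra (A : Algebra I a e) : Set (i ⊔ a ⊔ e) where
    open Algebra A
    field
      0# 1#            : Carrier
      isBooleanAlgebra : IsBooleanAlgebra _≈_ _+_ _·_ -_ 1# 0#
      c-comm           : ∀ {i j} → i ≢ j → ∀ x → c i (c j x) ≈ c j (c i x)
      c-increasing     : ∀ i x → x ≤ c i x
      c-idem           : ∀ i x → c i x ≈ c i (c i x)
      c-additive       : ∀ i x y → c i (x + y) ≈ c i x + c i y
      c-complement     : ∀ i x → c i (- c i x) ≈ - c i x
      d-refl           : ∀ i → d i i ≈ 1#
      d-sym            : ∀ {i j} → i ≢ j → d i j ≈ d j i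
      d-compose        : ∀ {i j k} → i ≢ j → j ≢ k → i ≢ k →
                         c j (d i j · d j k) ≈ d i k
      c-d              : ∀ {i j} → i ≢ j → c i (d i j) ≈ 1#
      d-c              : ∀ {i j} → i ≢ j → ∀ x →
                         d i j · c i (d i j · x) ≈ d i j · x

  record Homomorphism (A : Algebra I a e₁) (B : Algebra I b e₂) :
                      Set (i ⊔ a ⊔ b ⊔ e₁ ⊔ e₂) where
    private
      module A = Algebra A
      module B = Algebra B
    field
      to     : A.Carrier → B.Carrier
      cong   : ∀ {x y} → x A.≈ y → to x B.≈ to y
      +-homo : ∀ x y → to (x A.+ y) B.≈ to x B.+ to y
      -‿homo : ∀ x → to (A.- x) B.≈ B.- to x
      c-homo : ∀ j x → to (A.c j x) B.≈ B.c j (to x)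
      d-homo : ∀ j k → to (A.d j k) B.≈ B.d j k

  _↪_ : Algebra I a e₁ → Algebra I b e₂ → Set _
  A ↪ B = Σ (Homomorphism A B) λ h →
    Injective (Algebra._≈_ A) (Algebra._≈_ B) (Homomorphism.to h)

  _≅_ : Algebra I a e₁ → Algebra I b e₂ → Set _
  A ≅ B = Σ (Homomorphism A B) λ h →
    Injective (Algebra._≈_ A) (Algebra._≈_ B) (Homomorphism.to h) ×
    Surjective (Algebra._≈_ A) (Algebra._≈_ B) (Homomorphism.to h)

  record Subuniverse (A : Algebra I a e) p : Set (i ⊔ a ⊔ e ⊔ lsuc p) where
    open Algebra A
    field
      P        : Pred Carrier p
      resp     : P Respects _≈_
      +-closed : ∀ {x y} → x ∈ P → y ∈ P → x + y ∈ P
      -‿closed : ∀ {x} → x ∈ P → - x ∈ P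
      c-closed : ∀ j {x} → x ∈ P → c j x ∈ P
      d-closed : ∀ j k → d j k ∈ P

  subalgebra : (A : Algebra I a e) → Subuniverse A p → Algebra I (a ⊔ p) e
  subalgebra A S = record
    { Carrier       = Σ Carrier P
    ; _≈_           = _≈_ on proj₁
    ; isEquivalence = record { refl = refl ; sym = sym ; trans = trans }
    ; _+_           = λ (x , x∈P) (y , y∈P) → x + y , +-closed x∈P y∈P
    ; -_            = λ (x , x∈P) → - x , -‿closed x∈P
    ; c             = λ j (x , x∈P) → c j x , c-closed j x∈P
    ; d             = λ j k → d j k , d-closed j k
    ; +-cong        = λ x≈x′ y≈y′ → +-cong x≈x′ y≈y′
    ; -‿cong        = λ x≈y → -‿cong x≈y
    ; c-cong        = λ j x≈y → c-cong j x≈y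
    }
    where
    open Algebra A
    open IsEquivalence isEquivalence
    open Subuniverse S

  reduct : (A : Algebra I a e) (Γ : Pred I p) → Algebra (∃ Γ) a e
  reduct A Γ = record
    { Carrier       = Carrier
    ; _≈_           = _≈_
    ; isEquivalence = isEquivalence
    ; _+_           = _+_
    ; -_            = -_
    ; c             = λ (j , _) → c j
    ; d             = λ (j , _) (k , _) → d j k
    ; +-cong        = +-cong
    ; -‿cong        = -‿cong
    ; c-cong        = λ (j , _) → c-cong j
    }
    where open Algebra A

module _ {I : Set i} where

  -- Finite subsets Γ of the index set are given by lists of their elements.
  EndoDimensionComplemented : {A : Algebra I a e} →
                              IsCylindricAlgebra A → Set (i ⊔ a ⊔ e)
  EndoDimensionComplemented {A = A} isCA =
    (Γ : List I) (x : Carrier) → ¬ (x ≈ 0#) →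
    Σ I λ κ → κ ∉ˡ Γ ×
    Σ (Homomorphism (reduct A (_∈ˡ Γ)) (reduct A (_∈ˡ Γ))) λ h →
      ¬ (Homomorphism.to h x ≈ 0#) ×
      (∀ y → c κ (Homomorphism.to h y) ≈ Homomorphism.to h y)
    where
    open Algebra A
    open IsCylindricAlgebra isCA

  -- Classes of algebras are taken up to isomorphism, so 𝐒 K consists of the
  -- algebras isomorphic to a subalgebra of a member of K.
  𝐒 : Pred (Algebra I a a) p → Pred (Algebra I a a) (i ⊔ lsuc a ⊔ p)
  𝐒 {a = a} K A =
    Σ (Algebra I a a) λ B → B ∈ K × Σ (Subuniverse B a) λ S → A ≅ subalgebra B S

-- Set algebras with sequences in ᴵU, where the set U is a setoid and sequences
-- are compared pointwise.
module _ {I : Set i} (_≟_ : DecidableEquality I) (U : Setoid u u) where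
  private module U = Setoid U

  Seq : Set (i ⊔ u)
  Seq = I → U.Carrier

  _≋_ : Rel Seq (i ⊔ u)
  s ≋ t = ∀ j → s j U.≈ t j

  _[_≔_] : Seq → I → U.Carrier → Seq
  (s [ j ≔ v ]) k = if does (k ≟ j) then v else s k

  record SeqSet p : Set (i ⊔ u ⊔ lsuc p) where
    field
      P    : Pred Seq p
      resp : P Respects _≋_

  record SubsetOf (V : SeqSet p) : Set (i ⊔ u ⊔ lsuc p) where
    field
      set : SeqSet p
    open SeqSet set public
    field
      P⊆V : P ⊆ SeqSet.P V

  private
    ≋-sym : ∀ {s t} → s ≋ t → t ≋ s
    ≋-sym s≋t j = U.sym (s≋t j)

    ≋-trans : ∀ {r s t} → r ≋ s → s ≋ t → r ≋ t
    ≋-trans r≋s s≋t j = U.trans (r≋s j) (s≋t j)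

  fullSetAlgebra : SeqSet (i ⊔ u) → Algebra I (lsuc (i ⊔ u)) (i ⊔ u)
  fullSetAlgebra V = record
    { Carrier       = SubsetOf V
    ; _≈_           = λ X Y → P X ≐ P Y
    ; isEquivalence = record
      { refl  = (λ x → x) , (λ x → x)
      ; sym   = λ (f , g) → g , f
      ; trans = λ (f , g) (f′ , g′) → (λ x → f′ (f x)) , (λ x → g (g′ x))
      }
    ; _+_           = union
    ; -_            = complement
    ; c             = cyl
    ; d             = diag
    ; +-cong        = λ (f , g) (f′ , g′) →
        (λ { (inj₁ x) → inj₁ (f x) ; (inj₂ y) → inj₂ (f′ y) }) ,
        (λ { (inj₁ x) → inj₁ (g x) ; (inj₂ y) → inj₂ (g′ y) })
    ; -‿cong        = λ (f , g) →
        (λ (v , n) → v , λ x → n (g x)) , (λ (v , n) → v , λ x → n (f x))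
    ; c-cong        = λ j (f , g) →
        (λ (v , s , w , x , q) → v , s , w , f x , q) ,
        (λ (v , s , w , x , q) → v , s , w , g x , q)
    }
    where
    open SubsetOf
    module V = SeqSet V

    union : SubsetOf V → SubsetOf V → SubsetOf V
    union X Y = record
      { set = record
        { P    = λ s → s ∈ P X ⊎ s ∈ P Y
        ; resp = λ { q (inj₁ x) → inj₁ (resp X q x)
                   ; q (inj₂ y) → inj₂ (resp Y q y) }
        }
      ; P⊆V = λ { (inj₁ x) → P⊆V X x ; (inj₂ y) → P⊆V Y y }
      }

    complement : SubsetOf V → SubsetOf V
    complement X = record
      { set = record
        { P    = λ s → s ∈ V.P × ¬ (s ∈ P X)
        ; resp = λ q (v , n) → V.resp q v , λ x → n (resp X (≋-sym q) x)
        }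
      ; P⊆V = proj₁
      }

    cyl : I → SubsetOf V → SubsetOf V
    cyl j X = record
      { set = record
        { P    = λ t → t ∈ V.P ×
                   Σ Seq λ s → Σ U.Carrier λ w → s ∈ P X × t ≋ (s [ j ≔ w ])
        ; resp = λ q (v , s , w , x , t≋) →
                   V.resp q v , s , w , x , ≋-trans (≋-sym q) t≋
        }
      ; P⊆V = proj₁
      }

    diag : I → I → SubsetOf V
    diag j k = record
      { set = record
        { P    = λ s → s ∈ V.P × s j U.≈ s k
        ; resp = λ q (v , s≈) →
                   V.resp q v , U.trans (U.sym (q j)) (U.trans s≈ (q k))
        }
      ; P⊆V = proj₁
      }

  -- V is the union of pairwise disjoint sets ᴵW for subsets W of U; no
  -- generality is lost in taking all the W inside one set U.
  record IsDisjointUnionOfCubes (V : SeqSet p) : Set (i ⊔ lsuc u ⊔ p) where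
    field
      K        : Set u
      W        : K → Pred U.Carrier u
      W-resp   : ∀ k → W k Respects U._≈_
    Cube : K → Pred Seq (i ⊔ u)
    Cube k s = ∀ j → s j ∈ W k
    field
      disjoint : ∀ {k k′} → k ≢ k′ → ∀ s → s ∈ Cube k → ¬ (s ∈ Cube k′)
      union    : ∀ s → s ∈ SeqSet.P V ⇔ (∃[ k ] s ∈ Cube k)

module _ {ℓ} (α : Ordinal ℓ) where
  open Ordinal α

  AlgebraOf : Set (lsuc ℓ)
  AlgebraOf = Algebra Carrier ℓ ℓ

  CA : Pred AlgebraOf ℓ
  CA = IsCylindricAlgebra

  Edc : Pred AlgebraOf ℓ
  Edc A = Σ (A ∈ CA) EndoDimensionComplemented

  RCA : Pred AlgebraOf (lsuc ℓ)
  RCA A =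
    Σ (Setoid ℓ ℓ) λ U →
    Σ (SeqSet _≟_ U ℓ) λ V → IsDisjointUnionOfCubes _≟_ U V ×
    Σ (Subuniverse (fullSetAlgebra _≟_ U V) ℓ) λ S →
      A ≅ subalgebra (fullSetAlgebra _≟_ U V) S

{-# OPTIONS --safe #-}

-- Shifting coordinates along a self-injection of α that fixes Γ and misses some
-- κ ∉ Γ shows that full set algebras over unions of cubes are
-- endo-dimension-complemented.
--
-- Conversely, let x ≠ 0 in an endo-dimension-complemented 𝔄.  Iterating the
-- endomorphisms gives, for each finite Γ and each finite number of constants,
-- an endomorphism of the Γ-reduct whose image is independent of as many spare
-- dimensions κ; reading the constants as spare dimensions and instantiation as
-- substitution, every finite set of Henkin axioms together with x is satisfied
-- by a nonzero element of 𝔄.  Compactness yields a Henkin model in which a(s)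
-- makes sense for arbitrary sequences s of constants, hence a homomorphism into
-- a set algebra with unit a single cube not killing x; the cubes for the various
-- x are taken disjoint.
--
-- For a representable algebra that is not endo-dimension-complemented, let
-- U = α × 2 consist of two-element blocks and Γ have three elements.  On the
-- sequences with s j in the block of j for all j ∉ Γ there is a tournament on U,
-- invariant under flips of blocks, in which s j is the first point of its block.
-- That it is a tournament is a statement about the Γ-reduct, but an element
-- independent of some κ ∉ Γ leaves some block unpinned, so flipping this block
-- would interchange two points of a tournament.

module Submission where

open import Defs
open import Level using (_⊔_; Lift; lift; lower) renaming (suc to lsuc)
open import Algebra.Lattice.Bundles using (BooleanAlgebra)
import Algebra.Lattice.Properties.BooleanAlgebra as BooleanAlgebraProperties
open import Algebra.Lattice.Structures using (IsBooleanAlgebra)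
open import Axiom.ExcludedMiddle using (ExcludedMiddle)
open import Data.Bool.Base using (Bool; true; false; not; _∨_; if_then_else_)
open import Data.Bool.Properties using (⇔→≡; ¬-not; not-¬; not-involutive; ∨-comm; ∨-assoc; ∨-inverseˡ; ∨-inverseʳ)
open import Data.Empty using (⊥; ⊥-elim)
open import Data.Fin.Base using (Fin; zero; suc)
open import Data.Fin.Properties using (injective⇒≤)
open import Data.List.Base using (List; []; _∷_; _++_; map; length; filter; deduplicate; lookup)
open import Data.List.Membership.Propositional using () renaming (_∈_ to _∈ˡ_; _∉_ to _∉ˡ_)
open import Data.List.Membership.Propositional.Properties using (∈-++⁺ˡ; ∈-++⁺ʳ; ∈-++⁻; ∈-map⁺; ∈-filter⁺; ∈-filter⁻; ∈-deduplicate⁺; ∈-deduplicate⁻; ∈-lookup)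
open import Data.List.Properties using (filter-notAll)
open import Data.List.Relation.Unary.All as All using (All)
open import Data.List.Relation.Unary.AllPairs using (_∷_)
open import Data.List.Relation.Unary.Any as Any using (here; there)
open import Data.List.Relation.Unary.Any.Properties using (lookup-index)
open import Data.List.Relation.Unary.Unique.DecPropositional.Properties using (deduplicate-!)
open import Data.List.Relation.Unary.Unique.Propositional using (Unique)
open import Data.List.Relation.Unary.Unique.Propositional.Properties using (filter⁺)
open import Data.Nat.Base using (ℕ; zero; suc; _<_; _≤_; s≤s; s≤s⁻¹)
open import Data.Nat.Properties using (<-cmp; m≤n⇒m<n∨m≡n; ≤-refl; ≤-trans; 1+n≰n)
open import Data.Product.Base using (Σ; ∃-syntax; _×_; _,_; proj₁; proj₂)
open import Data.Sum.Base using (_⊎_; inj₁; inj₂; [_,_]′)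
open import Data.Unit.Base using (⊤; tt)
open import Function.Base using (_∘_; id; case_of_)
open import Function.Bundles using (Func; Surjection; mk⇔; mk↔ₛ′; Equivalence)
open import Induction.WellFounded using (WellFounded; acc; wf⇒asym)
open import Relation.Binary.Bundles using (Setoid)
import Relation.Binary.Construct.Closure.Transitive as Transitive
open import Relation.Binary.Construct.Closure.Transitive using (TransClosure; [_])
open import Relation.Binary.Core using (Rel)
open import Relation.Binary.Definitions using (DecidableEquality; tri<; tri≈; tri>)
import Relation.Binary.Lattice.Bundles as OrderTheory
open import Relation.Binary.PropositionalEquality using (_≡_; _≢_; refl; sym; trans; cong; cong₂; subst; subst₂)
open import Relation.Binary.PropositionalEquality.Properties using () renaming (isEquivalence to ≡-isEquivalence)
open import Relation.Binary.Structures using (IsEquivalence; IsStrictTotalOrder)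
open import Relation.Nullary.Decidable.Core using (Dec; yes; no; does; ¬?)
open import Relation.Nullary.Negation.Core using (¬_; contradiction)
open import Relation.Unary using (Pred; _∈_; _⊂_; _≐_)

-- `Edc` consists of algebras at level `ℓ`, whereas `fullSetAlgebra` lives one level higher. Set
-- algebras are therefore handled through the two-valued copy `𝔹`, with embeddings in both
-- directions.
--
-- Approximations chosen at different stages are unrelated and have no limit. Hence a finite set of
-- literals counts as consistent if, jointly with Henkin axioms, it is satisfiable at cofinally many
-- stages. The Henkin axioms can be discarded one by one because each constant, though it mentions
-- infinitely many others, is a well-founded tree over them.
--
-- For the counterexample, invariance under flips alone is too weak. The shift used in `𝔹-isEdc`
-- carries the set of pinned sequences to a flip-invariant set that is independent of `κ` and still
-- pins every block outside `Γ`, only through shifted coordinates. So an element of `𝔸` may depend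
-- on no more than finitely many coordinates outside the sequences that are pinned up to finitely
-- many exceptions. The latter cannot be re-pinned without `κ`, by counting.

-- Classical logic with two-valued predicates

module Classical {ℓ} (em : ExcludedMiddle ℓ) where

  ⌊_⌋ : Set ℓ → Bool
  ⌊ P ⌋ = does (em {P})

  ⌊⌋-complete : ∀ {P} → P → ⌊ P ⌋ ≡ true
  ⌊⌋-complete {P} p with em {P}
  ... | yes _ = refl
  ... | no ¬p = contradiction p ¬p

  ⌊⌋-sound : ∀ {P} → ⌊ P ⌋ ≡ true → P
  ⌊⌋-sound {P} eq with em {P}
  ⌊⌋-sound _  | yes p = p
  ⌊⌋-sound () | no _

  ⌊⌋-cong : ∀ {P Q} → (P → Q) → (Q → P) → ⌊ P ⌋ ≡ ⌊ Q ⌋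
  ⌊⌋-cong f g = ⇔→≡ (mk⇔ (λ p → ⌊⌋-complete (f (⌊⌋-sound p))) (λ q → ⌊⌋-complete (g (⌊⌋-sound q))))

  byContradiction : ∀ {P : Set ℓ} → ¬ ¬ P → P
  byContradiction {P} ¬¬p with em {P}
  ... | yes p = p
  ... | no ¬p = contradiction ¬p ¬¬p

∨-trueˡ : ∀ {x y} → x ≡ true → x ∨ y ≡ true
∨-trueˡ refl = refl

∨-trueʳ : ∀ {x y} → y ≡ true → x ∨ y ≡ true
∨-trueʳ {true}  refl = refl
∨-trueʳ {false} refl = refl

∨-true⁻ : ∀ {x y} → x ∨ y ≡ true → x ≡ true ⊎ y ≡ true
∨-true⁻ {true}  _ = inj₁ refl
∨-true⁻ {false} q = inj₂ q

not-true : ∀ {x} → ¬ (x ≡ true) → not x ≡ true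
not-true {true}  n = contradiction refl n
not-true {false} _ = refl

not-true⁻ : ∀ {x} → not x ≡ true → ¬ (x ≡ true)
not-true⁻ {true} () _

≡true-stable : ∀ {x} → ¬ ¬ (x ≡ true) → x ≡ true
≡true-stable {true}  _ = refl
≡true-stable {false} n = contradiction (λ ()) n

-- Zorn's lemma and compactness

module Compactness {ℓ} (em : ExcludedMiddle ℓ) (ac : AxiomOfChoice ℓ) where
  open Classical em

  -- Zorn's lemma by the tower construction: Tower is the least family of
  -- sets closed under f and unions, and it turns out to be a chain.
  module Towers (X : Set ℓ) where

    Subset : Set ℓ
    Subset = X → Bool

    infix 4 _⊑_
    _⊑_ : Subset → Subset → Set ℓ
    p ⊑ q = ∀ x → p x ≡ true → q x ≡ true

    -- Families are two-valued like the subsets themselves, so quantifying over them stays at level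
    -- `ℓ` and `Tower` is a small type.
    ⋃ : (Subset → Bool) → Subset
    ⋃ F x = ⌊ (∃[ p ] F p ≡ true × p x ≡ true) ⌋

    -- Coextensive subsets need not be identical as functions, which is why `f-cong` is required
    -- separately.
    module Chain (f : Subset → Subset) (f-ext : ∀ {p} → p ⊑ f p)
                 (f-cong : ∀ {p q} → p ⊑ q → q ⊑ p → f p ⊑ f q) where

      data Tower : Subset → Set ℓ where
        step  : ∀ {p} → Tower p → Tower (f p)
        union : ∀ F → (∀ p → F p ≡ true → Tower p) → Tower (⋃ F)

      Extreme : Subset → Set ℓ
      Extreme p = ∀ {s} → Tower s → s ⊑ p → ¬ (p ⊑ s) → f s ⊑ p

      -- Induction on the tower of the second set. At a successor, either the predecessor is
      -- properly below `p` and extremeness applies, or the two are coextensive and `f` agrees on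
      -- them. A union lies below `p` unless one of its members already contains `f p`.
      extreme-compare : ∀ {p q} → Extreme p → Tower q → q ⊑ p ⊎ f p ⊑ q
      extreme-compare {p} ex (step {q} tq) with extreme-compare ex tq
      ... | inj₂ fp⊑q = inj₂ λ x x∈ → f-ext x (fp⊑q x x∈)
      ... | inj₁ q⊑p with em {p ⊑ q}
      ...   | yes p⊑q = inj₂ (f-cong p⊑q q⊑p)
      ...   | no p⋢q = inj₁ (ex tq q⊑p p⋢q)
      extreme-compare {p} ex (union F F⊆T) with em {∃[ q ] F q ≡ true × f p ⊑ q}
      ... | yes (q , q∈F , fp⊑q) = inj₂ λ x x∈ → ⌊⌋-complete (q , q∈F , fp⊑q x x∈)
      ... | no none = inj₁ λ x x∈ →
        let q , q∈F , x∈q = ⌊⌋-sound x∈ in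
        case extreme-compare ex (F⊆T q q∈F) of λ
          { (inj₁ q⊑p) → q⊑p x x∈q
          ; (inj₂ fp⊑q) → contradiction (q , q∈F , fp⊑q) none }

      extreme : ∀ {p} → Tower p → Extreme p
      extreme (step {r} tr) ts s⊑fr fr⋢s with extreme-compare (extreme tr) ts
      ... | inj₂ fr⊑s = contradiction fr⊑s fr⋢s
      ... | inj₁ s⊑r with em {r ⊑ _}
      ...   | yes r⊑s = f-cong s⊑r r⊑s
      ...   | no r⋢s = λ x x∈ → f-ext x (extreme tr ts s⊑r r⋢s x x∈)
      extreme (union F F⊆T) {s} ts s⊑⋃ ⋃⋢s with em {∃[ r ] F r ≡ true × ¬ (r ⊑ s)}
      ... | no none = ⊥-elim (⋃⋢s λ x x∈ →
        let r , r∈F , x∈r = ⌊⌋-sound x∈ in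
        byContradiction {r ⊑ s} (λ r⋢s → none (r , r∈F , r⋢s)) x x∈r)
      ... | yes (r , r∈F , r⋢s) with extreme-compare (extreme (F⊆T r r∈F)) ts
      ...   | inj₂ fr⊑s = contradiction (λ x x∈ → fr⊑s x (f-ext x x∈)) r⋢s
      ...   | inj₁ s⊑r = λ x x∈ → ⌊⌋-complete (r , r∈F , extreme (F⊆T r r∈F) ts s⊑r r⋢s x x∈)

      chain : ∀ {p q} → Tower p → Tower q → p ⊑ q ⊎ q ⊑ p
      chain tp tq with extreme-compare (extreme tp) tq
      ... | inj₁ q⊑p = inj₂ q⊑p
      ... | inj₂ fp⊑q = inj₁ λ x x∈ → fp⊑q x (f-ext x x∈)

      top : Subset
      top = ⋃ (λ p → ⌊ Tower p ⌋)

      tower-top : Tower top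
      tower-top = union _ λ p → ⌊⌋-sound

      top-closed : f top ⊑ top
      top-closed x x∈ = ⌊⌋-complete (f top , ⌊⌋-complete (step tower-top) , x∈)

    NonEmpty : Subset → Set ℓ
    NonEmpty p = ∃[ x ] p x ≡ true

    nonEmptySubsets : Setoid ℓ ℓ
    nonEmptySubsets = record
      { Carrier = Σ Subset NonEmpty
      ; _≈_ = λ (p , _) (q , _) → ∀ x → p x ≡ q x
      ; isEquivalence = record
        { refl = λ x → refl
        ; sym = λ e x → sym (e x)
        ; trans = λ e e′ x → trans (e x) (e′ x) } }

    pointedSubsets : Setoid ℓ ℓ
    pointedSubsets = record
      { Carrier = Σ Subset NonEmpty
      ; _≈_ = λ (p , x , _) (q , y , _) → (∀ z → p z ≡ q z) × x ≡ y
      ; isEquivalence = record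
        { refl = (λ x → refl) , refl
        ; sym = λ (e , e₁) → (λ x → sym (e x)) , sym e₁
        ; trans = λ (e , e₁) (e′ , e₁′) → (λ x → trans (e x) (e′ x)) , trans e₁ e₁′ } }

    forgetPoint : Surjection pointedSubsets nonEmptySubsets
    forgetPoint = record
      { to = λ p → p
      ; cong = proj₁
      ; surjective = λ p → p , proj₁ }

    choose : Σ Subset NonEmpty → X
    choose p = proj₁ (proj₂ (Func.to (proj₁ (ac forgetPoint)) p))

    -- Equality in `nonEmptySubsets` ignores the given point, so a section that respects equality
    -- must pick the same point for coextensive subsets.
    choose-cong : ∀ p q → (∀ x → proj₁ p x ≡ proj₁ q x) → choose p ≡ choose q
    choose-cong p q e = proj₂ (Func.cong (proj₁ (ac forgetPoint)) {p} {q} e)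

    choose-∈ : ∀ p → proj₁ p (choose p) ≡ true
    choose-∈ p = trans (sym (proj₂ (ac forgetPoint) p (choose p)))
                       (proj₂ (proj₂ (Func.to (proj₁ (ac forgetPoint)) p)))

    module Tukey (Con : List X → Set ℓ) (Con-[] : Con [])
                 (Con-anti : ∀ {l l′} → (∀ {x} → x ∈ˡ l → x ∈ˡ l′) → Con l′ → Con l) where

      _⊢_ : Subset → List X → Set ℓ
      p ⊢ l = ∀ {x} → x ∈ˡ l → p x ≡ true

      Candidate : Subset → X → Set ℓ
      Candidate p x = ¬ (p x ≡ true) × (∀ l → p ⊢ l → Con (x ∷ l))

      candidates : Subset → Subset
      candidates p x = ⌊ Candidate p x ⌋

      candidates-cong : ∀ {p q} → p ⊑ q → q ⊑ p → ∀ x → candidates p x ≡ candidates q x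
      candidates-cong p⊑q q⊑p x = ⌊⌋-cong
        (λ (n , c) → (λ x∈q → n (q⊑p x x∈q)) , λ l l⊆q → c l λ y∈ → q⊑p _ (l⊆q y∈))
        (λ (n , c) → (λ x∈p → n (p⊑q x x∈p)) , λ l l⊆p → c l λ y∈ → p⊑q _ (l⊆p y∈))

      Added : Subset → X → Set ℓ
      Added p x = Σ (NonEmpty (candidates p)) λ ne → x ≡ choose (candidates p , ne)

      -- Only one chosen candidate is added at a time, since two candidates may be jointly
      -- inconsistent.
      extend : Subset → Subset
      extend p x = p x ∨ ⌊ Added p x ⌋

      extend-cong : ∀ {p q} → p ⊑ q → q ⊑ p → extend p ⊑ extend q
      extend-cong {p} {q} p⊑q q⊑p x x∈ with ∨-true⁻ {p x} x∈
      ... | inj₁ x∈p = ∨-trueˡ (p⊑q x x∈p)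
      ... | inj₂ added = ∨-trueʳ {q x} (⌊⌋-complete (
        let (y , y∈) , x≡ = ⌊⌋-sound added
            ne = y , trans (sym (candidates-cong p⊑q q⊑p y)) y∈
        in ne , trans x≡ (choose-cong _ _ (candidates-cong p⊑q q⊑p))))

      open Chain extend (λ x x∈ → ∨-trueˡ x∈) (λ {p} {q} → extend-cong {p} {q})

      Consistent : Subset → Set ℓ
      Consistent p = ∀ l → p ⊢ l → Con l

      old-part : ∀ p x l → (∀ {y} → y ∈ˡ l → p y ≡ true ⊎ y ≡ x) →
                 Σ (List X) λ l′ → p ⊢ l′ × (∀ {y} → y ∈ˡ l → y ∈ˡ x ∷ l′)
      old-part p x [] _ = [] , (λ ()) , λ ()
      old-part p x (y ∷ l) h with old-part p x l (h ∘ there) | h (here refl)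
      ... | l′ , l′⊆p , l⊆ | inj₂ refl = l′ , l′⊆p , λ { (here refl) → here refl ; (there z∈) → l⊆ z∈ }
      ... | l′ , l′⊆p , l⊆ | inj₁ y∈p =
        y ∷ l′ ,
        (λ { (here refl) → y∈p ; (there z∈) → l′⊆p z∈ }) ,
        λ { (here refl) → there (here refl)
          ; (there z∈) → case l⊆ z∈ of λ { (here e) → here e ; (there z∈′) → there (there z∈′) } }

      -- In a chain, the larger of two members takes over what the smaller one covers. The list is
      -- nonempty because `F` may have no member at all.
      union-finite : ∀ F → (∀ p → F p ≡ true → Tower p) → ∀ y l → ⋃ F ⊢ (y ∷ l) →
                     ∃[ p ] F p ≡ true × p ⊢ (y ∷ l)
      union-finite F F⊆T y [] h with ⌊⌋-sound (h (here refl))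
      ... | p , p∈F , y∈p = p , p∈F , λ { (here refl) → y∈p }
      union-finite F F⊆T y (z ∷ l) h
        with ⌊⌋-sound (h (here refl)) | union-finite F F⊆T z l (h ∘ there)
      ... | p , p∈F , y∈p | q , q∈F , l⊆q with chain (F⊆T p p∈F) (F⊆T q q∈F)
      ...   | inj₁ p⊑q = q , q∈F , λ { (here refl) → p⊑q _ y∈p ; (there w∈) → l⊆q w∈ }
      ...   | inj₂ q⊑p = p , p∈F , λ { (here refl) → y∈p ; (there w∈) → q⊑p _ (l⊆q w∈) }

      tower-consistent : ∀ {p} → Tower p → Consistent p
      tower-consistent (step {p} tp) l l⊆ with em {NonEmpty (candidates p)}
      ... | no none = tower-consistent tp l λ {x} x∈ → case ∨-true⁻ {p x} (l⊆ x∈) of λ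
        { (inj₁ x∈p) → x∈p ; (inj₂ added) → contradiction (proj₁ (⌊⌋-sound added)) none }
      ... | yes ne =
        let x₀ = choose (candidates p , ne)
            l′ , l′⊆p , l⊆′ = old-part p x₀ l λ {y} y∈ → case ∨-true⁻ {p y} (l⊆ y∈) of λ
              { (inj₁ y∈p) → inj₁ y∈p
              ; (inj₂ added) → inj₂ (trans (proj₂ (⌊⌋-sound added)) (choose-cong _ _ λ _ → refl)) }
        in Con-anti l⊆′ (proj₂ (⌊⌋-sound (choose-∈ (candidates p , ne))) l′ l′⊆p)
      tower-consistent (union F F⊆T) [] _ = Con-[]
      tower-consistent (union F F⊆T) (y ∷ l) l⊆ =
        let p , p∈F , l⊆p = union-finite F F⊆T y l l⊆
        in tower-consistent (F⊆T p p∈F) (y ∷ l) l⊆p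

      maximal : Σ Subset λ M → Consistent M × (∀ x → ¬ Candidate M x)
      maximal = top , tower-consistent tower-top , λ x cand →
        let ne = x , ⌊⌋-complete cand
            x₀ = choose (candidates top , ne)
        in proj₁ (⌊⌋-sound (choose-∈ (candidates top , ne)))
             (top-closed x₀ (∨-trueʳ {top x₀} (⌊⌋-complete (ne , refl))))

  -- A maximal consistent set of literals decides every atom: if it rejected both literals of an
  -- atom, the finitely many members responsible would together violate the splitting hypothesis.
  compactness : (At : Set ℓ) (Con : List (At × Bool) → Set ℓ) → Con [] →
    (∀ {l l′} → (∀ {x} → x ∈ˡ l → x ∈ˡ l′) → Con l′ → Con l) →
    (∀ {l} φ → Con l → Con ((φ , true) ∷ l) ⊎ Con ((φ , false) ∷ l)) →
    Σ (At → Bool) λ v → ∀ l → (∀ {x} → x ∈ˡ l → v (proj₁ x) ≡ proj₂ x) → Con l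
  compactness At Con Con-[] Con-anti Con-split = v , λ l h → M-con l λ x∈ → v-∈ _ _ (h x∈)
    where
    open Towers (At × Bool)
    open Tukey Con Con-[] Con-anti

    M = proj₁ maximal
    M-con = proj₁ (proj₂ maximal)

    excluded : ∀ x → ¬ (M x ≡ true) → Σ (List (At × Bool)) λ l → M ⊢ l × ¬ Con (x ∷ l)
    excluded x x∉ = byContradiction λ none →
      proj₂ (proj₂ maximal) x (x∉ , λ l l⊆ → byContradiction λ ¬c → none (l , (λ {y} → l⊆ {y}) , ¬c))

    total : ∀ φ → ¬ (M (φ , true) ≡ true) → M (φ , false) ≡ true
    total φ φ∉ = ≡true-stable λ φ∉′ →
      let l₁ , l₁⊆ , ¬c₁ = excluded (φ , true) φ∉
          l₂ , l₂⊆ , ¬c₂ = excluded (φ , false) φ∉′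
          l-con = M-con (l₁ ++ l₂) λ x∈ → case ∈-++⁻ l₁ x∈ of λ
            { (inj₁ x∈₁) → l₁⊆ x∈₁ ; (inj₂ x∈₂) → l₂⊆ x∈₂ }
      in case Con-split φ l-con of λ
        { (inj₁ c) → ¬c₁ (Con-anti (λ { (here e) → here e ; (there x∈) → there (∈-++⁺ˡ x∈) }) c)
        ; (inj₂ c) → ¬c₂ (Con-anti (λ { (here e) → here e ; (there x∈) → there (∈-++⁺ʳ l₁ x∈) }) c) }

    v : At → Bool
    v φ = M (φ , true)

    v-∈ : ∀ φ b → v φ ≡ b → M (φ , b) ≡ true
    v-∈ φ true e = e
    v-∈ φ false e = total φ λ e′ → case trans (sym e) e′ of λ ()

-- Fresh indices and shifts of an infinite set

module InfiniteSets {ℓ} (em : ExcludedMiddle ℓ) {I : Set ℓ} (_≟_ : DecidableEquality I) (infinite : Infinite I) where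
  open Classical em

  lookup-injective : ∀ {xs : List I} → Unique xs → ∀ i j → lookup xs i ≡ lookup xs j → i ≡ j
  lookup-injective (_ ∷ _) zero zero _ = refl
  lookup-injective {x ∷ xs} (x∉ ∷ _) zero (suc j) e = contradiction e (All.lookup x∉ (∈-lookup {xs = xs} j))
  lookup-injective {x ∷ xs} (x∉ ∷ _) (suc i) zero e = contradiction (sym e) (All.lookup x∉ (∈-lookup {xs = xs} i))
  lookup-injective (_ ∷ u) (suc i) (suc j) e = cong suc (lookup-injective u i j e)

  abstract
    -- A list containing every index, freed of repetitions, would be a bijection of some `Fin n`
    -- with `I`.
    exists-fresh : (l : List I) → Σ I λ x → x ∉ˡ l
    exists-fresh l = byContradiction λ none →
      let l′ = deduplicate _≟_ l
          all-∈ : ∀ x → x ∈ˡ l′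
          all-∈ x = ∈-deduplicate⁺ _≟_ (byContradiction λ x∉ → none (x , x∉))
      in infinite (length l′ , mk↔ₛ′ (lookup l′) (λ x → Any.index (all-∈ x))
           (λ x → sym (lookup-index (all-∈ x)))
           λ i → lookup-injective (deduplicate-! _≟_ l) _ i (sym (lookup-index (all-∈ (lookup l′ i)))))

  fresh : List I → I
  fresh l = proj₁ (exists-fresh l)

  fresh-∉ : ∀ l → fresh l ∉ˡ l
  fresh-∉ l = proj₂ (exists-fresh l)

  -- A self-injection of I fixing a finite set Γ pointwise and missing an
  -- index outside Γ: Hilbert's hotel along a sequence avoiding Γ.
  module Shift (Γ : List I) where

    prefix : ℕ → List I
    prefix zero = Γ
    prefix (suc n) = fresh (prefix n) ∷ prefix n

    room : ℕ → I
    room n = fresh (prefix n)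

    Γ⊆prefix : ∀ n {i} → i ∈ˡ Γ → i ∈ˡ prefix n
    Γ⊆prefix zero i∈ = i∈
    Γ⊆prefix (suc n) i∈ = there (Γ⊆prefix n i∈)

    room-∉ : ∀ n → room n ∉ˡ Γ
    room-∉ n r∈ = fresh-∉ (prefix n) (Γ⊆prefix n r∈)

    room-∈ : ∀ {m n} → m < n → room m ∈ˡ prefix n
    room-∈ {m} {suc n} (s≤s m≤n) with m≤n⇒m<n∨m≡n m≤n
    ... | inj₁ m<n = there (room-∈ m<n)
    ... | inj₂ refl = here refl

    room-injective : ∀ {m n} → room m ≡ room n → m ≡ n
    room-injective {m} {n} e with <-cmp m n
    ... | tri< m<n _ _ = contradiction (subst (_∈ˡ prefix n) e (room-∈ m<n)) (fresh-∉ (prefix n))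
    ... | tri≈ _ m≡n _ = m≡n
    ... | tri> _ _ n<m = contradiction (subst (_∈ˡ prefix m) (sym e) (room-∈ n<m)) (fresh-∉ (prefix m))

    shift unshift : I → I
    shift i with em {∃[ n ] room n ≡ i}
    ... | yes (n , _) = room (suc n)
    ... | no _ = i
    unshift i with em {∃[ n ] room n ≡ i}
    -- An arbitrary value: `room zero` is not in the range of `shift`.
    ... | yes (zero , _) = i
    ... | yes (suc n , _) = room n
    ... | no _ = i

    unshift-room : ∀ n → unshift (room (suc n)) ≡ room n
    unshift-room n with em {∃[ m ] room m ≡ room (suc n)}
    ... | yes (m , e) with refl ← room-injective e = refl
    ... | no none = contradiction (suc n , refl) none

    unshift-shift : ∀ i → unshift (shift i) ≡ i
    unshift-shift i with em {∃[ n ] room n ≡ i} in eq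
    ... | yes (n , e) = trans (unshift-room n) e
    ... | no none with em {∃[ n ] room n ≡ i}
    ...   | yes r = contradiction r none
    ...   | no _ = refl

    shift-fixes : ∀ {i} → i ∈ˡ Γ → shift i ≡ i
    shift-fixes {i} i∈ with em {∃[ n ] room n ≡ i}
    ... | yes (n , refl) = contradiction i∈ (room-∉ n)
    ... | no _ = refl

    shift-injective : ∀ {i j} → shift i ≡ shift j → i ≡ j
    shift-injective {i} {j} e = trans (sym (unshift-shift i)) (trans (cong unshift e) (unshift-shift j))

    shift-misses : ∀ i → shift i ≢ room zero
    shift-misses i e with em {∃[ n ] room n ≡ i}
    ... | yes (n , _) = case room-injective {suc n} {zero} e of λ ()
    ... | no none = none (zero , sym e)

-- Spelled so as to agree by computation with the derived meet `_·_` of `𝔹` at each point.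
_∧̂_ : Bool → Bool → Bool
x ∧̂ y = not (not x ∨ not y)

∧̂-true : ∀ {x y} → x ≡ true → y ≡ true → x ∧̂ y ≡ true
∧̂-true refl refl = refl

∧̂-true⁻ : ∀ {x y} → x ∧̂ y ≡ true → x ≡ true × y ≡ true
∧̂-true⁻ {true} {true} _ = refl , refl

⇒-∨≡ : ∀ {x y} → (x ≡ true → y ≡ true) → x ∨ y ≡ y
⇒-∨≡ {true}  f = sym (f refl)
⇒-∨≡ {false} _ = refl

∧̂-comm : ∀ x y → x ∧̂ y ≡ y ∧̂ x
∧̂-comm true  true  = refl
∧̂-comm true  false = refl
∧̂-comm false true  = refl
∧̂-comm false false = refl

∧̂-assoc : ∀ x y z → (x ∧̂ y) ∧̂ z ≡ x ∧̂ (y ∧̂ z)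
∧̂-assoc true  true  true  = refl
∧̂-assoc true  true  false = refl
∧̂-assoc true  false _     = refl
∧̂-assoc false _     _     = refl

∧̂-distribˡ-∨ : ∀ x y z → x ∧̂ (y ∨ z) ≡ (x ∧̂ y) ∨ (x ∧̂ z)
∧̂-distribˡ-∨ false _     _ = refl
∧̂-distribˡ-∨ true  true  _ = refl
∧̂-distribˡ-∨ true  false _ = refl

∨-distribˡ-∧̂ : ∀ x y z → x ∨ (y ∧̂ z) ≡ (x ∨ y) ∧̂ (x ∨ z)
∨-distribˡ-∧̂ true  _ _ = refl
∨-distribˡ-∧̂ false _ _ = refl

-- Algebras of two-valued regions in families of cubes

module Cubes {ℓ} (em : ExcludedMiddle ℓ) {I : Set ℓ} (_≟_ : DecidableEquality I) where
  open Classical em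

  -- Unfolds to the same expression as `_[_≔_]`, but without a setoid, so that its lemmas apply to
  -- both.
  update : {X : Set ℓ} → (I → X) → I → X → I → X
  update s j v k = if does (k ≟ j) then v else s k

  update-same : {X : Set ℓ} (s : I → X) (j : I) {v : X} → update s j v j ≡ v
  update-same s j with j ≟ j
  ... | yes _ = refl
  ... | no j≢j = contradiction refl j≢j

  update-other : {X : Set ℓ} (s : I → X) {j k : I} {v : X} → k ≢ j → update s j v k ≡ s k
  update-other s {j} {k} k≢j with k ≟ j
  ... | yes k≡j = contradiction k≡j k≢j
  ... | no _ = refl

  update-elim : ∀ {p} {X : Set ℓ} (P : I → X → Set p) {s : I → X} {j : I} {v : X} →
                P j v → (∀ k → k ≢ j → P k (s k)) → ∀ k → P k (update s j v k)
  update-elim P {j = j} pv ps k with k ≟ j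
  ... | yes refl = pv
  ... | no k≢j = ps k k≢j

  module _ (S : Setoid ℓ ℓ) where
    private module S = Setoid S

    update-cong : ∀ {s t : I → S.Carrier} {v w} j → (∀ i → s i S.≈ t i) → v S.≈ w →
                  ∀ i → update s j v i S.≈ update t j w i
    update-cong j s≈t v≈w i with i ≟ j
    ... | yes _ = v≈w
    ... | no _ = s≈t i

    update-id : ∀ (s : I → S.Carrier) j → ∀ i → update s j (s j) i S.≈ s i
    update-id s j = update-elim (λ i v → v S.≈ s i) S.refl λ _ _ → S.refl

    update-overwrite : ∀ (s : I → S.Carrier) j v w i → update (update s j v) j w i S.≈ update s j w i
    update-overwrite s j v w i with i ≟ j
    ... | yes _ = S.refl
    ... | no _ = S.refl

    update-swap : ∀ (s : I → S.Carrier) {j k} v w → j ≢ k → ∀ i →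
                  update (update s j v) k w i S.≈ update (update s k w) j v i
    update-swap s {j} {k} v w j≢k i with i ≟ k
    ... | yes refl = S.sym (S.reflexive (update-other (λ _ → w) (j≢k ∘ sym)))
    ... | no _ = S.refl

  -- The product over k of the full set algebras with unit ᴵ(W k).  Its elements
  -- are Bool-valued, which keeps the algebra at the level of I and W.
  module CubeAlgebra (K : Set ℓ) (W : K → Setoid ℓ ℓ) where
    private module W k = Setoid (W k)

    Point : K → Set ℓ
    Point k = I → W.Carrier k

    infix 4 _≗ₚ_
    _≗ₚ_ : ∀ {k} → Point k → Point k → Set ℓ
    _≗ₚ_ {k} s t = ∀ i → W._≈_ k (s i) (t i)

    record Region : Set ℓ where
      field
        at   : ∀ k → Point k → Bool
        resp : ∀ k {s t} → s ≗ₚ t → at k s ≡ true → at k t ≡ true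
    open Region public

    infix 4 _∋_,_
    _∋_,_ : Region → ∀ k → Point k → Set
    X ∋ k , s = at X k s ≡ true

    _≈ᴿ_ : Region → Region → Set ℓ
    X ≈ᴿ Y = ∀ k s → at X k s ≡ at Y k s

    ext : ∀ {X Y} → (∀ k s → X ∋ k , s → Y ∋ k , s) → (∀ k s → Y ∋ k , s → X ∋ k , s) → X ≈ᴿ Y
    ext f g k s = ⇔→≡ (mk⇔ (f k s) (g k s))

    infixl 6 _∪_
    _∪_ : Region → Region → Region
    at (X ∪ Y) k s = at X k s ∨ at Y k s
    resp (X ∪ Y) k {s} s≗t x∈ with ∨-true⁻ {at X k s} x∈
    ... | inj₁ s∈X = ∨-trueˡ (resp X k s≗t s∈X)
    ... | inj₂ s∈Y = ∨-trueʳ (resp Y k s≗t s∈Y)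

    ∁ : Region → Region
    at (∁ X) k s = not (at X k s)
    resp (∁ X) k s≗t s∉ = not-true λ t∈ → not-true⁻ s∉ (resp X k (λ i → W.sym k (s≗t i)) t∈)

    Cyl : I → Region → ∀ k → Point k → Set ℓ
    Cyl j X k s = Σ (W.Carrier k) λ w → X ∋ k , update s j w

    cyl : I → Region → Region
    at (cyl j X) k s = ⌊ Cyl j X k s ⌋
    resp (cyl j X) k s≗t s∈ =
      let w , w∈ = ⌊⌋-sound s∈
      in ⌊⌋-complete (w , resp X k (update-cong (W k) j s≗t (W.refl k)) w∈)

    diag : I → I → Region
    at (diag i j) k s = ⌊ W._≈_ k (s i) (s j) ⌋
    resp (diag i j) k s≗t s∈ =
      ⌊⌋-complete (W.trans k (W.sym k (s≗t i)) (W.trans k (⌊⌋-sound s∈) (s≗t j)))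

    const-region : Bool → Region
    at (const-region b) _ _ = b
    resp (const-region b) _ _ b≡ = b≡

    𝔹 : Algebra I ℓ ℓ
    𝔹 = record
      { Carrier = Region
      ; _≈_ = _≈ᴿ_
      ; isEquivalence = record
        { refl = λ _ _ → refl
        ; sym = λ e k s → sym (e k s)
        ; trans = λ e e′ k s → trans (e k s) (e′ k s) }
      ; _+_ = _∪_
      ; -_ = ∁
      ; c = cyl
      ; d = diag
      ; +-cong = λ e e′ k s → cong₂ _∨_ (e k s) (e′ k s)
      ; -‿cong = λ e k s → cong not (e k s)
      ; c-cong = λ j e k s → ⌊⌋-cong
          (λ (w , w∈) → w , trans (sym (e k _)) w∈)
          (λ (w , w∈) → w , trans (e k _) w∈) }

    private
      module 𝔹 = Algebra 𝔹

    cyl-∋ : ∀ {j X k s} w → X ∋ k , update s j w → cyl j X ∋ k , s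
    cyl-∋ w w∈ = ⌊⌋-complete (w , w∈)

    cyl-∋⁻ : ∀ {j X k s} → cyl j X ∋ k , s → Cyl j X k s
    cyl-∋⁻ = ⌊⌋-sound

    ∋-cyl : ∀ {j} X {k s} → X ∋ k , s → cyl j X ∋ k , s
    ∋-cyl {j} X {k} {s} s∈ =
      cyl-∋ {j} {X} (s j) (resp X k (λ i → W.sym k (update-id (W k) s j i)) s∈)

    cyl-update : ∀ {j} X {k s} w → cyl j X ∋ k , s → cyl j X ∋ k , update s j w
    cyl-update {j} X {k} {s} w s∈ =
      let v , v∈ = cyl-∋⁻ {j} {X} s∈
      in cyl-∋ {j} {X} v (resp X k (λ i → W.sym k (update-overwrite (W k) s j w v i)) v∈)

    cyl-update⁻ : ∀ {j} X {k s} w → cyl j X ∋ k , update s j w → cyl j X ∋ k , s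
    cyl-update⁻ {j} X {k} {s} w s∈ =
      let v , v∈ = cyl-∋⁻ {j} {X} s∈
      in cyl-∋ {j} {X} v (resp X k (update-overwrite (W k) s j w v) v∈)

    cyl-closed : ∀ {j} X {k s} → cyl j (cyl j X) ∋ k , s → cyl j X ∋ k , s
    cyl-closed {j} X s∈ = let w , w∈ = cyl-∋⁻ {j} {cyl j X} s∈ in cyl-update⁻ X w w∈

    cyl-comm : ∀ {i j} → i ≢ j → ∀ X k s → cyl i (cyl j X) ∋ k , s → cyl j (cyl i X) ∋ k , s
    cyl-comm {i} {j} i≢j X k s s∈ =
      let v , v∈ = cyl-∋⁻ {i} {cyl j X} s∈
          w , w∈ = cyl-∋⁻ {j} {X} v∈
      in cyl-∋ {j} {cyl i X} w (cyl-∋ {i} {X} v (resp X k (update-swap (W k) s v w i≢j) w∈))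

    𝔹-isBooleanAlgebra : IsBooleanAlgebra 𝔹._≈_ 𝔹._+_ 𝔹._·_ 𝔹.-_ (const-region true) (const-region false)
    𝔹-isBooleanAlgebra = record
      { isDistributiveLattice = record
        { isLattice = record
          { isEquivalence = 𝔹.isEquivalence
          ; ∨-comm = λ X Y k s → ∨-comm (at X k s) (at Y k s)
          ; ∨-assoc = λ X Y Z k s → ∨-assoc (at X k s) (at Y k s) (at Z k s)
          ; ∨-cong = λ e e′ k s → cong₂ _∨_ (e k s) (e′ k s)
          ; ∧-comm = λ X Y k s → ∧̂-comm (at X k s) (at Y k s)
          ; ∧-assoc = λ X Y Z k s → ∧̂-assoc (at X k s) (at Y k s) (at Z k s)
          ; ∧-cong = λ e e′ k s → cong₂ _∧̂_ (e k s) (e′ k s)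
          ; absorptive = (λ X Y k s → ∨-absorbs-∧̂ (at X k s) (at Y k s))
                       , (λ X Y k s → ∧̂-absorbs-∨ (at X k s) (at Y k s)) }
        ; ∨-distrib-∧ = (λ X Y Z k s → ∨-distribˡ-∧̂ (at X k s) (at Y k s) (at Z k s))
                      , (λ X Y Z k s → trans (∨-comm (at Y k s ∧̂ at Z k s) (at X k s))
                           (trans (∨-distribˡ-∧̂ (at X k s) (at Y k s) (at Z k s))
                             (cong₂ _∧̂_ (∨-comm (at X k s) (at Y k s)) (∨-comm (at X k s) (at Z k s)))))
        ; ∧-distrib-∨ = (λ X Y Z k s → ∧̂-distribˡ-∨ (at X k s) (at Y k s) (at Z k s))
                      , (λ X Y Z k s → trans (∧̂-comm (at Y k s ∨ at Z k s) (at X k s))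
                           (trans (∧̂-distribˡ-∨ (at X k s) (at Y k s) (at Z k s))
                             (cong₂ _∨_ (∧̂-comm (at X k s) (at Y k s)) (∧̂-comm (at X k s) (at Z k s))))) }
      ; ∨-complement = (λ X k s → ∨-inverseˡ (at X k s)) , (λ X k s → ∨-inverseʳ (at X k s))
      ; ∧-complement = (λ X k s → ∧̂-inverseˡ (at X k s)) , (λ X k s → ∧̂-inverseʳ (at X k s))
      ; ¬-cong = λ e k s → cong not (e k s) }
      where
      ∨-absorbs-∧̂ : ∀ x y → x ∨ (x ∧̂ y) ≡ x
      ∨-absorbs-∧̂ true  _ = refl
      ∨-absorbs-∧̂ false _ = refl
      ∧̂-absorbs-∨ : ∀ x y → x ∧̂ (x ∨ y) ≡ x
      ∧̂-absorbs-∨ true  _ = refl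
      ∧̂-absorbs-∨ false _ = refl
      ∧̂-inverseˡ : ∀ x → not x ∧̂ x ≡ false
      ∧̂-inverseˡ true  = refl
      ∧̂-inverseˡ false = refl
      ∧̂-inverseʳ : ∀ x → x ∧̂ not x ≡ false
      ∧̂-inverseʳ true  = refl
      ∧̂-inverseʳ false = refl

    𝔹-isCA : IsCylindricAlgebra 𝔹
    𝔹-isCA = record
      { 0# = const-region false
      ; 1# = const-region true
      ; isBooleanAlgebra = 𝔹-isBooleanAlgebra
      ; c-comm = λ {i} {j} i≢j X → ext {cyl i (cyl j X)} {cyl j (cyl i X)}
          (cyl-comm i≢j X) (cyl-comm (i≢j ∘ sym) X)
      ; c-increasing = λ j X k s → ⇒-∨≡ (∋-cyl X)
      ; c-idem = λ j X → ext {cyl j X} {cyl j (cyl j X)} (λ k s → ∋-cyl (cyl j X)) (λ k s → cyl-closed X)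
      ; c-additive = λ j X Y → ext {cyl j (X ∪ Y)} {cyl j X ∪ cyl j Y}
          (λ k s s∈ → let w , w∈ = cyl-∋⁻ {j} {X ∪ Y} s∈ in
            [ (λ w∈X → ∨-trueˡ (cyl-∋ {j} {X} w w∈X))
            , (λ w∈Y → ∨-trueʳ {at (cyl j X) k s} (cyl-∋ {j} {Y} w w∈Y)) ]′
              (∨-true⁻ {at X k (update s j w)} w∈))
          (λ k s s∈ →
            [ (λ s∈X → let w , w∈ = cyl-∋⁻ {j} {X} s∈X in cyl-∋ {j} {X ∪ Y} w (∨-trueˡ w∈))
            , (λ s∈Y → let w , w∈ = cyl-∋⁻ {j} {Y} s∈Y in
                cyl-∋ {j} {X ∪ Y} w (∨-trueʳ {at X k (update s j w)} w∈)) ]′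
              (∨-true⁻ {at (cyl j X) k s} s∈))
      ; c-complement = λ j X → ext {cyl j (∁ (cyl j X))} {∁ (cyl j X)}
          (λ k s s∈ → let w , w∉ = cyl-∋⁻ {j} {∁ (cyl j X)} s∈ in
            not-true λ s∈X → not-true⁻ w∉ (cyl-update X w s∈X))
          (λ k s → ∋-cyl (∁ (cyl j X)))
      ; d-refl = λ i k s → ⌊⌋-complete (W.refl k)
      ; d-sym = λ _ k s → ⌊⌋-cong (W.sym k) (W.sym k)
      ; d-compose = λ {i} {j} {k} → d-compose i j k
      ; c-d = λ {i} {j} i≢j k s → ⌊⌋-complete (s j , ⌊⌋-complete
          (subst₂ (W._≈_ k) (sym (update-same s i)) (sym (update-other s (i≢j ∘ sym))) (W.refl k)))
      ; d-c = λ {i} {j} i≢j X → ext {diag i j 𝔹.· cyl i (diag i j 𝔹.· X)} {diag i j 𝔹.· X}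
          (λ k s s∈ →
            let s∈d , s∈c = ∧̂-true⁻ {at (diag i j) k s} s∈
                w , w∈ = cyl-∋⁻ {i} {diag i j 𝔹.· X} s∈c
                w∈d , w∈X = ∧̂-true⁻ {at (diag i j) k (update s i w)} w∈
                w≈sj = subst₂ (W._≈_ k) (update-same s i) (update-other s (i≢j ∘ sym)) (⌊⌋-sound w∈d)
            in ∧̂-true s∈d (resp X k
                 (update-elim (λ l v → W._≈_ k v (s l))
                   (W.trans k w≈sj (W.sym k (⌊⌋-sound s∈d))) (λ _ _ → W.refl k)) w∈X))
          (λ k s s∈ → ∧̂-true (proj₁ (∧̂-true⁻ {at (diag i j) k s} s∈)) (∋-cyl (diag i j 𝔹.· X) s∈)) }
      where
      d-compose : ∀ i j l → i ≢ j → j ≢ l → i ≢ l → cyl j (diag i j 𝔹.· diag j l) ≈ᴿ diag i l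
      d-compose i j l i≢j j≢l _ = ext {cyl j (diag i j 𝔹.· diag j l)} {diag i l}
        (λ k s s∈ →
          let w , w∈ = cyl-∋⁻ {j} {diag i j 𝔹.· diag j l} s∈
              w∈₁ , w∈₂ = ∧̂-true⁻ {at (diag i j) k (update s j w)} w∈
          in ⌊⌋-complete (W.trans k
               (subst₂ (W._≈_ k) (update-other s i≢j) (update-same s j) (⌊⌋-sound w∈₁))
               (subst₂ (W._≈_ k) (update-same s j) (update-other s (j≢l ∘ sym)) (⌊⌋-sound w∈₂))))
        (λ k s s∈ → cyl-∋ {j} {diag i j 𝔹.· diag j l} (s i) (∧̂-true
          (⌊⌋-complete (subst₂ (W._≈_ k) (sym (update-other s i≢j)) (sym (update-same s j)) (W.refl k)))
          (⌊⌋-complete (subst₂ (W._≈_ k) (sym (update-same s j)) (sym (update-other s (j≢l ∘ sym))) (⌊⌋-sound s∈)))))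

    module _ (infinite : Infinite I) where
      open InfiniteSets em _≟_ infinite

      𝔹-isEdc : EndoDimensionComplemented 𝔹-isCA
      𝔹-isEdc Γ X X≉0 = room zero , room-∉ zero , h , hX≉0 , h-closed
        where
        open Shift Γ

        pull : Region → Region
        at (pull X) k s = at X k (s ∘ shift)
        resp (pull X) k s≗t = resp X k (λ i → s≗t (shift i))

        -- No index other than `i` is shifted to `i`, because `i` is its own image and `shift` is
        -- injective. So pulling back commutes with cylindrifying `i`.
        update-shift : ∀ {i} → i ∈ˡ Γ → ∀ k (s : Point k) w → update s i w ∘ shift ≗ₚ update (s ∘ shift) i w
        update-shift {i} i∈ k s w = update-elim (λ j v → W._≈_ k (update s i w (shift j)) v)
          (W.reflexive k (trans (cong (update s i w) (shift-fixes i∈)) (update-same s i)))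
          (λ j j≢i → W.reflexive k (update-other s λ e → j≢i (shift-injective (trans e (sym (shift-fixes i∈))))))

        h : Homomorphism (reduct 𝔹 (_∈ˡ Γ)) (reduct 𝔹 (_∈ˡ Γ))
        h = record
          { to = pull
          ; cong = λ e k s → e k (s ∘ shift)
          ; +-homo = λ _ _ _ _ → refl
          ; -‿homo = λ _ _ _ → refl
          ; c-homo = λ (i , i∈) X k s → ⌊⌋-cong
              (λ (w , w∈) → w , resp X k (λ j → W.sym k (update-shift i∈ k s w j)) w∈)
              (λ (w , w∈) → w , resp X k (update-shift i∈ k s w) w∈)
          ; d-homo = λ (i , i∈) (j , j∈) k s →
              cong₂ (λ i j → ⌊ W._≈_ k (s i) (s j) ⌋) (shift-fixes i∈) (shift-fixes j∈) }

        hX≉0 : ¬ (pull X ≈ᴿ const-region false)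
        -- `s ∘ unshift` is pulled back to `s` itself, so it belongs to `pull X` whenever `s`
        -- belongs to `X`.
        hX≉0 hX≈0 = X≉0 λ k s → ¬-not λ s∈ → case trans (sym (hX≈0 k (s ∘ unshift)))
          (resp X k (λ i → W.reflexive k (cong s (sym (unshift-shift i)))) s∈) of λ ()

        h-closed : ∀ Y → cyl (room zero) (pull Y) ≈ᴿ pull Y
        h-closed Y = ext {cyl (room zero) (pull Y)} {pull Y}
          (λ k s s∈ → let w , w∈ = cyl-∋⁻ {room zero} {pull Y} {k} {s} s∈ in
            resp Y k {update s (room zero) w ∘ shift} {s ∘ shift}
              (λ i → W.reflexive k (update-other s (shift-misses i))) w∈)
          (λ k s s∈ → ∋-cyl (pull Y) {k} {s} s∈)

-- Embeddings and subalgebras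

module Embeddings {i} {I : Set i} where

  ↪-trans : ∀ {a b c e₁ e₂ e₃} {A : Algebra I a e₁} {B : Algebra I b e₂} {C : Algebra I c e₃} →
            A ↪ B → B ↪ C → A ↪ C
  ↪-trans {C = C} (g , g-inj) (h , h-inj) = record
    { to = H.to ∘ G.to
    ; cong = H.cong ∘ G.cong
    ; +-homo = λ x y → C.trans (H.cong (G.+-homo x y)) (H.+-homo _ _)
    ; -‿homo = λ x → C.trans (H.cong (G.-‿homo x)) (H.-‿homo _)
    ; c-homo = λ j x → C.trans (H.cong (G.c-homo j x)) (H.c-homo j _)
    ; d-homo = λ j k → C.trans (H.cong (G.d-homo j k)) (H.d-homo j k) } , g-inj ∘ h-inj
    where
    module G = Homomorphism g
    module H = Homomorphism h
    module C = IsEquivalence (Algebra.isEquivalence C)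

  subalgebra-↪ : ∀ {a e p} {A : Algebra I a e} (S : Subuniverse A p) → subalgebra A S ↪ A
  subalgebra-↪ {A = A} S = record
    { to = proj₁
    ; cong = id
    ; +-homo = λ _ _ → E.refl
    ; -‿homo = λ _ → E.refl
    ; c-homo = λ _ _ → E.refl
    ; d-homo = λ _ _ → E.refl } , id
    where module E = IsEquivalence (Algebra.isEquivalence A)

  ≅⇒↪ : ∀ {a b e₁ e₂} {A : Algebra I a e₁} {B : Algebra I b e₂} → A ≅ B → A ↪ B
  ≅⇒↪ (h , h-inj , _) = h , h-inj

  ↪-refl : ∀ {a e} (A : Algebra I a e) → A ↪ A
  ↪-refl A = record
    { to = id
    ; cong = id
    ; +-homo = λ _ _ → E.refl
    ; -‿homo = λ _ → E.refl
    ; c-homo = λ _ _ → E.refl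
    ; d-homo = λ _ _ → E.refl } , id
    where module E = IsEquivalence (Algebra.isEquivalence A)

  module _ {a b e₁ e₂} {A : Algebra I a e₁} {B : Algebra I b e₂} (f : A ↪ B) where
    private
      module H = Homomorphism (proj₁ f)
      module B where
        open Algebra B public
        open IsEquivalence isEquivalence public

    image : Subuniverse B (a ⊔ e₂)
    image = record
      { P = λ y → ∃[ x ] H.to x B.≈ y
      ; resp = λ y≈z (x , hx≈y) → x , B.trans hx≈y y≈z
      ; +-closed = λ (x , hx≈) (y , hy≈) → _ , B.trans (H.+-homo x y) (B.+-cong hx≈ hy≈)
      ; -‿closed = λ (x , hx≈) → _ , B.trans (H.-‿homo x) (B.-‿cong hx≈)
      ; c-closed = λ j (x , hx≈) → _ , B.trans (H.c-homo j x) (B.c-cong j hx≈)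
      ; d-closed = λ j k → _ , H.d-homo j k }

    ≅-image : A ≅ subalgebra B image
    ≅-image = record
      { to = λ x → H.to x , x , B.refl
      ; cong = H.cong
      ; +-homo = H.+-homo
      ; -‿homo = H.-‿homo
      ; c-homo = H.c-homo
      ; d-homo = H.d-homo } , proj₂ f , λ (y , x , hx≈y) → x , λ z≈x → B.trans (H.cong z≈x) hx≈y

-- Passing between full set algebras and algebras of regions

module SetAlgebras {ℓ} (em : ExcludedMiddle ℓ) {I : Set ℓ} (_≟_ : DecidableEquality I) (infinite : Infinite I) where
  open Classical em
  open Cubes em _≟_
  open InfiniteSets em _≟_ infinite
  open Embeddings

  i₀ : I
  i₀ = fresh []

  other : ∀ j → Σ I λ i → i ≢ j
  other j = fresh (j ∷ []) , λ e → fresh-∉ (j ∷ []) (here e)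

  module FromCubes {U : Setoid ℓ ℓ} {V : SeqSet _≟_ U ℓ} (D : IsDisjointUnionOfCubes _≟_ U V) where
    private module U = Setoid U
    open IsDisjointUnionOfCubes D
    open Equivalence

    part : K → Setoid ℓ ℓ
    part k = record
      { Carrier = Σ U.Carrier (W k)
      ; _≈_ = λ (u , _) (v , _) → u U.≈ v
      ; isEquivalence = record { refl = U.refl ; sym = U.sym ; trans = U.trans } }

    open CubeAlgebra K part
    open SubsetOf using () renaming (P to ⟦_⟧; resp to ⟦⟧-resp; P⊆V to ⟦⟧⊆V)

    -- Disjointness concerns whole sequences; the constant sequence at the common value lies in both
    -- cubes.
    same-cube : ∀ {k k′ i s t} → Cube k s → Cube k′ t → s i U.≈ t i → k ≡ k′
    same-cube {k} {k′} {i} {s} s∈ t∈ e = byContradiction λ k≢k′ →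
      disjoint k≢k′ (λ _ → s i) (λ _ → s∈ i) (λ _ → W-resp k′ (U.sym e) (t∈ i))

    embed : SubsetOf _≟_ U V → Region
    at (embed X) k s = ⌊ ⟦ X ⟧ (proj₁ ∘ s) ⌋
    resp (embed X) k s≗t s∈ = ⌊⌋-complete (⟦⟧-resp X s≗t (⌊⌋-sound s∈))

    private
      𝔽 = fullSetAlgebra _≟_ U V
      module 𝔽 = Algebra 𝔽

    -- Changing coordinate `j` inside `V` cannot lead into another cube, because the two sequences
    -- still share a coordinate `i ≢ j`.
    embed-c : ∀ j X → embed (𝔽.c j X) ≈ᴿ cyl j (embed X)
    embed-c j X = ext {embed (𝔽.c j X)} {cyl j (embed X)}
      (λ k s s∈ →
        let _ , t , w , t∈ , s≋ = ⌊⌋-sound s∈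
            k′ , t∈k′ = to (union t) (⟦⟧⊆V X t∈)
            i , i≢j = other j
            k≡k′ = same-cube {s = proj₁ ∘ s} {t = t} (proj₂ ∘ s) t∈k′
                     (U.trans (s≋ i) (U.reflexive (update-other t i≢j)))
            tj∈k = subst (λ k → t j ∈ W k) (sym k≡k′) (t∈k′ j)
        in cyl-∋ {j} {embed X} (t j , tj∈k) (⌊⌋-complete (⟦⟧-resp X
             (λ l → U.sym (update-elim (λ l v → proj₁ v U.≈ t l) {s = s} U.refl
               (λ l l≢j → U.trans (s≋ l) (U.reflexive (update-other t l≢j))) l)) t∈)))
      (λ k s s∈ →
        let w , w∈ = cyl-∋⁻ {j} {embed X} s∈
        in ⌊⌋-complete
          ( from (union (proj₁ ∘ s)) (k , proj₂ ∘ s)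
          , proj₁ ∘ update s j w , proj₁ (s j) , ⌊⌋-sound w∈
          , λ l → U.sym (update-elim (λ l v → v U.≈ proj₁ (s l)) {s = proj₁ ∘ update s j w} U.refl
              (λ l l≢j → U.reflexive (cong proj₁ (update-other s l≢j))) l) ))

    𝔽↪𝔹 : 𝔽 ↪ 𝔹
    𝔽↪𝔹 = record
      { to = embed
      ; cong = λ (f , g) k s → ⌊⌋-cong f g
      ; +-homo = λ X Y → ext {embed (X 𝔽.+ Y)} {embed X ∪ embed Y}
          (λ k s s∈ → [ (λ s∈X → ∨-trueˡ (⌊⌋-complete s∈X))
                      , (λ s∈Y → ∨-trueʳ {at (embed X) k s} (⌊⌋-complete s∈Y)) ]′ (⌊⌋-sound s∈))
          (λ k s s∈ → ⌊⌋-complete ([ inj₁ ∘ ⌊⌋-sound , inj₂ ∘ ⌊⌋-sound ]′ (∨-true⁻ {at (embed X) k s} s∈)))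
      ; -‿homo = λ X → ext {embed (𝔽.- X)} {∁ (embed X)}
          (λ k s s∈ → not-true λ s∈X → proj₂ (⌊⌋-sound s∈) (⌊⌋-sound s∈X))
          (λ k s s∉ → ⌊⌋-complete
            (from (union (proj₁ ∘ s)) (k , proj₂ ∘ s) , λ s∈X → not-true⁻ s∉ (⌊⌋-complete s∈X)))
      ; c-homo = embed-c
      ; d-homo = λ i j k s → ⌊⌋-cong proj₂ λ e → from (union (proj₁ ∘ s)) (k , proj₂ ∘ s) , e
      } , λ {X} {Y} e → inclusion {X} {Y} e , inclusion {Y} {X} λ k s → sym (e k s)
      where
      inclusion : ∀ {X Y} → embed X ≈ᴿ embed Y → ∀ {s} → ⟦ X ⟧ s → ⟦ Y ⟧ s
      inclusion {X} e {s} s∈X =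
        let k , s∈k = to (union s) (⟦⟧⊆V X s∈X)
        in ⌊⌋-sound (trans (sym (e k λ j → s j , s∈k j)) (⌊⌋-complete s∈X))

  module ToCubes {K C : Set ℓ} (E : K → Rel C ℓ) (E-equiv : ∀ k → IsEquivalence (E k)) where
    private module E k = IsEquivalence (E-equiv k)

    part : K → Setoid ℓ ℓ
    part k = record { Carrier = C ; _≈_ = E k ; isEquivalence = E-equiv k }

    open CubeAlgebra K part

    -- The tags from `K` make the cubes disjoint, although all have the carrier `C` and differ only
    -- in their equality.
    U : Setoid ℓ ℓ
    U = record
      { Carrier = K × C
      ; _≈_ = λ (k , u) (l , v) → k ≡ l × E k u v
      ; isEquivalence = record
        { refl = refl , E.refl _
        ; sym = λ { (refl , e) → refl , E.sym _ e }
        ; trans = λ { (refl , e) (refl , e′) → refl , E.trans _ e e′ } } }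

    private
      module U = Setoid U
      Sq = I → U.Carrier

    In : K → Sq → Set ℓ
    In k s = ∀ j → proj₁ (s j) ≡ k

    In-unique : ∀ {k l} {s : Sq} → In k s → In l s → k ≡ l
    In-unique s∈k s∈l = trans (sym (s∈k i₀)) (s∈l i₀)

    In-resp : ∀ {k} {s t : Sq} → (∀ j → s j U.≈ t j) → In k s → In k t
    In-resp s≋t s∈k j = trans (sym (proj₁ (s≋t j))) (s∈k j)

    E-subst : ∀ {k l u v} → k ≡ l → E k u v → E l u v
    E-subst refl e = e

    components : ∀ {k} {s t : Sq} → (∀ j → s j U.≈ t j) → In k s → ∀ j → E k (proj₂ (s j)) (proj₂ (t j))
    components s≋t s∈k j = E-subst (s∈k j) (proj₂ (s≋t j))

    V : SeqSet _≟_ U ℓ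
    V = record
      { P = λ s → ∃[ k ] In k s
      ; resp = λ s≋t (k , s∈k) → k , In-resp s≋t s∈k }

    V-cubes : IsDisjointUnionOfCubes _≟_ U V
    V-cubes = record
      { K = K
      ; W = λ k (l , _) → l ≡ k
      ; W-resp = λ { k (refl , _) e → e }
      ; disjoint = λ k≢l s s∈k s∈l → k≢l (In-unique {s = s} s∈k s∈l)
      ; union = λ s → mk⇔ id id }

    private
      𝔽 = fullSetAlgebra _≟_ U V
      module 𝔽 = Algebra 𝔽

    Member : Region → Sq → Set ℓ
    Member X s = ∃[ k ] In k s × X ∋ k , proj₂ ∘ s

    Member-resp : ∀ X {s t} → (∀ j → s j U.≈ t j) → Member X s → Member X t
    Member-resp X {s} {t} s≋t (k , s∈k , s∈X) = k , In-resp {s = s} {t} s≋t s∈k , resp X k (components {s = s} {t} s≋t s∈k) s∈X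

    spread : Region → SubsetOf _≟_ U V
    spread X = record
      { set = record { P = Member X ; resp = Member-resp X }
      ; P⊆V = λ (k , s∈k , _) → k , s∈k }

    spread-c : ∀ j X → spread (cyl j X) 𝔽.≈ 𝔽.c j (spread X)
    spread-c j X =
      (λ {s} (k , s∈k , s∈) →
        let w , w∈ = cyl-∋⁻ {j} {X} {k} {proj₂ ∘ s} s∈
        in (k , s∈k) , update s j (k , w) , s j ,
           (k , update-elim (λ _ v → proj₁ v ≡ k) {s = s} refl (λ l _ → s∈k l)
              , resp X k (λ l → E.sym k (update-elim (λ l v → E k (proj₂ v) (update (proj₂ ∘ s) j w l)) {s = s}
                            (E.reflexive k (sym (update-same (proj₂ ∘ s) j)))
                            (λ l l≢j → E.reflexive k (sym (update-other (proj₂ ∘ s) l≢j))) l)) w∈)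
           , λ l → U.sym (update-elim (λ l v → v U.≈ s l) {s = update s j (k , w)} U.refl
               (λ l l≢j → U.reflexive (update-other s l≢j)) l)) ,
      λ {s} ((k , s∈k) , t , w , (l , t∈l , t∈) , s≋) →
        let i , i≢j = other j
            s≈t : ∀ {i} → i ≢ j → s i U.≈ t i
            s≈t {i} i≢j = U.trans (s≋ i) (U.reflexive (update-other t i≢j))
            l≡k = trans (sym (t∈l i)) (trans (sym (proj₁ (s≈t i≢j))) (s∈k i))
        in k , s∈k , cyl-∋ {j} {X} {k} {proj₂ ∘ s} (proj₂ (t j))
             (resp X k (λ i → E.sym k (update-elim (λ i v → E k v (proj₂ (t i))) {s = proj₂ ∘ s} (E.refl k)
                 (λ i i≢j → E-subst (s∈k i) (proj₂ (s≈t i≢j))) i))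
               (subst (λ k → X ∋ k , proj₂ ∘ t) l≡k t∈))

    𝔹↪𝔽 : 𝔹 ↪ 𝔽
    𝔹↪𝔽 = record
      { to = spread
      ; cong = λ e → (λ (k , s∈k , s∈X) → k , s∈k , trans (sym (e k _)) s∈X)
                   , (λ (k , s∈k , s∈Y) → k , s∈k , trans (e k _) s∈Y)
      ; +-homo = λ X Y →
          (λ {s} (k , s∈k , s∈) → case ∨-true⁻ {at X k (proj₂ ∘ s)} s∈ of λ
            { (inj₁ s∈X) → inj₁ (k , s∈k , s∈X) ; (inj₂ s∈Y) → inj₂ (k , s∈k , s∈Y) }) ,
          λ { (inj₁ (k , s∈k , s∈X)) → k , s∈k , ∨-trueˡ s∈X
            ; {s} (inj₂ (k , s∈k , s∈Y)) → k , s∈k , ∨-trueʳ {at X k (proj₂ ∘ s)} s∈Y }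
      ; -‿homo = λ X →
          (λ {s} (k , s∈k , s∉) → (k , s∈k) , λ (l , s∈l , s∈) → not-true⁻ s∉
            (subst (λ k → X ∋ k , proj₂ ∘ s) (In-unique {s = s} s∈l s∈k) s∈)) ,
          λ ((k , s∈k) , s∉) → k , s∈k , not-true λ s∈ → s∉ (k , s∈k , s∈)
      ; c-homo = spread-c
      ; d-homo = λ i j →
          (λ {s} (k , s∈k , s∈) → (k , s∈k) , trans (s∈k i) (sym (s∈k j)) ,
            E-subst (sym (s∈k i)) (⌊⌋-sound s∈)) ,
          λ {s} ((k , s∈k) , _ , e) → k , s∈k , ⌊⌋-complete (E-subst (s∈k i) e)
      } , λ {X} {Y} e → ext {X} {Y} (inclusion {X} {Y} (proj₁ e)) (inclusion {Y} {X} (proj₂ e))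
      where
      inclusion : ∀ {X Y} → (∀ {s} → Member X s → Member Y s) → ∀ k s → X ∋ k , s → Y ∋ k , s
      inclusion {X} {Y} f k s s∈ with f {λ j → k , s j} (k , (λ _ → refl) , s∈)
      ... | l , k≡l , s∈Y = subst (λ k → Y ∋ k , s) (sym (k≡l i₀)) s∈Y

-- Arithmetic of cylindric algebras and substitutions

module CylindricArithmetic {i a e} {I : Set i} (_≟_ : DecidableEquality I) {A : Algebra I a e} (isCA : IsCylindricAlgebra A) where
  open Algebra A hiding (_≤_)
  open IsCylindricAlgebra isCA public
  open IsEquivalence isEquivalence public using () renaming (refl to ≈-refl; sym to ≈-sym; trans to ≈-trans; reflexive to ≈-reflexive)

  private
    booleanAlgebra : BooleanAlgebra a e
    booleanAlgebra = record { isBooleanAlgebra = isBooleanAlgebra }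
    module BA = BooleanAlgebraProperties booleanAlgebra
    module B = IsBooleanAlgebra isBooleanAlgebra
    module O = OrderTheory.Lattice BA.∨-∧-orderTheoreticLattice

  open O public using () renaming
    ( _≤_ to _⊑_; refl to ⊑-refl; trans to ⊑-trans; antisym to ⊑-antisym; reflexive to ⊑-reflexive
    ; x≤x∨y to +-upper₁; y≤x∨y to +-upper₂; ∨-least to +-lub
    ; x∧y≤x to ·-lower₁; x∧y≤y to ·-lower₂; ∧-greatest to ·-glb )

  ⊑-reflexive˘ : ∀ {x y} → y ≈ x → x ⊑ y
  ⊑-reflexive˘ y≈x = ⊑-reflexive (≈-sym y≈x)

  0⊑ : ∀ x → 0# ⊑ x
  0⊑ x = ≈-sym (BA.∧-zeroˡ x)

  ⊑1 : ∀ x → x ⊑ 1#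
  ⊑1 x = ≈-sym (BA.∧-identityʳ x)

  ·-mono : ∀ {x y u v} → x ⊑ y → u ⊑ v → x · u ⊑ y · v
  ·-mono x⊑y u⊑v = ·-glb (⊑-trans (·-lower₁ _ _) x⊑y) (⊑-trans (·-lower₂ _ _) u⊑v)

  ·-swap : ∀ {x y} → x · y ⊑ y · x
  ·-swap = ·-glb (·-lower₂ _ _) (·-lower₁ _ _)

  ·-cong : ∀ {x y u v} → x ≈ y → u ≈ v → x · u ≈ y · v
  ·-cong x≈y u≈v = -‿cong (+-cong (-‿cong x≈y) (-‿cong u≈v))

  +-absorb : ∀ {x y} → x ⊑ y → x + y ≈ y
  +-absorb x⊑y = ⊑-antisym (+-lub x⊑y ⊑-refl) (+-upper₂ _ _)

  +-absorb⁻ : ∀ {x y} → x + y ≈ y → x ⊑ y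
  +-absorb⁻ e = ⊑-trans (+-upper₁ _ _) (⊑-reflexive e)

  distrib-⊑ : ∀ {x y z w} → x · y ⊑ w → x · z ⊑ w → x · (y + z) ⊑ w
  distrib-⊑ p q = ⊑-trans (⊑-reflexive (proj₁ B.∧-distrib-∨ _ _ _)) (+-lub p q)

  by-cases : ∀ {x z} y → x · y ⊑ z → x · - y ⊑ z → x ⊑ z
  by-cases {x} y p q =
    ⊑-trans (·-glb ⊑-refl (⊑-trans (⊑1 x) (⊑-reflexive˘ (B.∨-complementʳ y)))) (distrib-⊑ p q)

  contradictory : ∀ {x z} y → x ⊑ y → x ⊑ - y → x ⊑ z
  contradictory y p q =
    ⊑-trans (·-glb p q) (⊑-trans (⊑-reflexive (B.∧-complementʳ y)) (0⊑ _))

  ⊑- : ∀ {x y} → x · y ⊑ 0# → x ⊑ - y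
  ⊑- {x} {y} p = by-cases y (⊑-trans p (0⊑ _)) (·-lower₂ _ _)

  shunt : ∀ {x y z} → x · y ⊑ z → x ⊑ - y + z
  shunt {x} {y} p = by-cases y (⊑-trans p (+-upper₂ _ _)) (⊑-trans (·-lower₂ _ _) (+-upper₁ _ _))

  unshunt : ∀ {x y z} → x ⊑ - y + z → x · y ⊑ z
  unshunt {x} {y} p = ⊑-trans (·-glb (·-lower₂ _ _) (⊑-trans (·-lower₁ _ _) p))
    (distrib-⊑ (contradictory y (·-lower₁ _ _) (·-lower₂ _ _)) (·-lower₂ _ _))

  ≉0-mono : ∀ {x y} → x ⊑ y → ¬ (x ≈ 0#) → ¬ (y ≈ 0#)
  ≉0-mono x⊑y x≉0 y≈0 = x≉0 (⊑-antisym (⊑-trans x⊑y (⊑-reflexive y≈0)) (0⊑ _))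

  c-extensive : ∀ i x → x ⊑ c i x
  c-extensive i x = +-absorb⁻ (c-increasing i x)

  c-mono : ∀ {i x y} → x ⊑ y → c i x ⊑ c i y
  c-mono {i} {x} {y} x⊑y =
    +-absorb⁻ (≈-trans (≈-sym (c-additive i x y)) (c-cong i (+-absorb x⊑y)))

  Closed : I → Carrier → Set e
  Closed i x = c i x ≈ x

  Closed-resp : ∀ {i x y} → x ≈ y → Closed i x → Closed i y
  Closed-resp {i} x≈y x-cl = ≈-trans (c-cong i (≈-sym x≈y)) (≈-trans x-cl x≈y)

  c-Closed : ∀ i x → Closed i (c i x)
  c-Closed i x = ≈-sym (c-idem i x)

  neg-Closed : ∀ {i x} → Closed i x → Closed i (- x)
  neg-Closed {i} {x} cl =
    ≈-trans (c-cong i (-‿cong (≈-sym cl))) (≈-trans (c-complement i x) (-‿cong cl))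

  +-Closed : ∀ {i x y} → Closed i x → Closed i y → Closed i (x + y)
  +-Closed {i} {x} {y} p q = ≈-trans (c-additive i x y) (+-cong p q)

  ·-Closed : ∀ {i x y} → Closed i x → Closed i y → Closed i (x · y)
  ·-Closed p q = neg-Closed (+-Closed (neg-Closed p) (neg-Closed q))

  1-Closed : ∀ i → Closed i 1#
  1-Closed i = ⊑-antisym (⊑1 _) (c-extensive i 1#)

  0-Closed : ∀ i → Closed i 0#
  0-Closed i = Closed-resp BA.¬⊤≈⊥ (neg-Closed (1-Closed i))

  c-least : ∀ {i x y} → Closed i y → x ⊑ y → c i x ⊑ y
  c-least cl x⊑y = ⊑-trans (c-mono x⊑y) (⊑-reflexive cl)

  -- For the second inequality, `x` lies below `- y + c i (x · y)`, which is closed under `c i`, so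
  -- `c i x` lies below it as well.
  c-· : ∀ {i x y} → Closed i y → c i (x · y) ≈ c i x · y
  c-· {i} {x} {y} cl = ⊑-antisym
    (·-glb (c-mono (·-lower₁ _ _)) (c-least cl (·-lower₂ _ _)))
    (unshunt (c-least (+-Closed (neg-Closed cl) (c-Closed i _)) (shunt (c-extensive i _))))

  c-Closed-other : ∀ {i j x} → Closed i x → Closed i (c j x)
  c-Closed-other {i} {j} {x} cl with i ≟ j
  ... | yes refl = c-Closed i x
  ... | no i≢j = ≈-trans (c-comm i≢j x) (c-cong j cl)

  d-Closed : ∀ {i j k} → i ≢ j → i ≢ k → Closed i (d j k)
  d-Closed {i} {j} {k} i≢j i≢k with j ≟ k
  ... | yes refl = Closed-resp (≈-sym (d-refl j)) (1-Closed i)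
  ... | no j≢k = Closed-resp (d-compose (i≢j ∘ sym) i≢k j≢k) (c-Closed i _)

  d-symmetric : ∀ i j → d i j ≈ d j i
  d-symmetric i j with i ≟ j
  ... | yes refl = ≈-refl
  ... | no i≢j = d-sym i≢j

  d-trans : ∀ i j k → d i j · d j k ⊑ d i k
  d-trans i j k with i ≟ j | j ≟ k | i ≟ k
  ... | yes refl | _ | _ = ·-lower₂ _ _
  ... | no _ | yes refl | _ = ·-lower₁ _ _
  ... | no _ | no _ | yes refl = ⊑-trans (⊑1 _) (⊑-reflexive˘ (d-refl i))
  ... | no i≢j | no j≢k | no i≢k = ⊑-trans (c-extensive j _) (⊑-reflexive (d-compose i≢j j≢k i≢k))

  -- The cylindric term for substituting `j` for `i`. For equal indices it amounts to `c i x`,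
  -- whence the hypotheses `i ≢ j` below.
  sub : I → I → Carrier → Carrier
  sub i j x = c i (d i j · x)

  sub-cong : ∀ {i j x y} → x ≈ y → sub i j x ≈ sub i j y
  sub-cong {i} x≈y = c-cong i (·-cong ≈-refl x≈y)

  sub-mono : ∀ {i j x y} → x ⊑ y → sub i j x ⊑ sub i j y
  sub-mono x⊑y = c-mono (·-mono ⊑-refl x⊑y)

  sub-+ : ∀ i j x y → sub i j (x + y) ≈ sub i j x + sub i j y
  sub-+ i j x y = ≈-trans (c-cong i (proj₁ B.∧-distrib-∨ _ _ _)) (c-additive i _ _)

  sub-Closed : ∀ {i j x} → i ≢ j → Closed i x → sub i j x ≈ x
  sub-Closed i≢j cl = ≈-trans (c-· cl) (≈-trans (·-cong (c-d i≢j) ≈-refl) (BA.∧-identityˡ _))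

  -- The instances of `x` and of `- x` are disjoint, and their sum is `c i (d i j)`, that is, `1#`.
  sub-neg : ∀ {i j} → i ≢ j → ∀ x → sub i j (- x) ≈ - sub i j x
  sub-neg {i} {j} i≢j x = ⊑-antisym
    (⊑- (⊑-trans (⊑-reflexive˘ (c-· (c-Closed i _)))
      (⊑-trans (c-mono disjoint) (⊑-reflexive (0-Closed i)))))
    (by-cases (sub i j (- x)) (·-lower₂ _ _)
      (contradictory (c i (d i j))
        (⊑-trans (⊑1 _) (⊑-reflexive˘ (c-d i≢j)))
        (⊑- (⊑-trans (·-mono ⊑-refl (⊑-trans (c-mono (by-cases x
              (⊑-trans (·-glb (·-lower₁ _ _) (·-lower₂ _ _)) (+-upper₁ (d i j · x) _))
              (⊑-trans (·-glb (·-lower₁ _ _) (·-lower₂ _ _)) (+-upper₂ _ (d i j · - x)))))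
              (⊑-reflexive (c-additive i _ _))))
          (distrib-⊑
            (contradictory (sub i j x) (·-lower₂ _ _) (⊑-trans (·-lower₁ _ _) (·-lower₁ _ _)))
            (contradictory (sub i j (- x)) (·-lower₂ _ _) (⊑-trans (·-lower₁ _ _) (·-lower₂ _ _))))))))
    where
    -- d i j · c i (d i j · x) ≤ x confines the two substitution instances to x and - x.
    disjoint : d i j · - x · sub i j x ⊑ 0#
    disjoint = contradictory x
      (⊑-trans (·-glb (⊑-trans (·-lower₁ _ _) (·-lower₁ _ _)) (·-lower₂ _ _))
        (⊑-trans (⊑-reflexive (d-c i≢j x)) (·-lower₂ _ _)))
      (⊑-trans (·-lower₁ _ _) (·-lower₂ _ _))

  sub-preserves-Closed : ∀ {i j k x} → k ≢ j → Closed k x → Closed k (sub i j x)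
  sub-preserves-Closed {i} {j} {k} k≢j cl with k ≟ i
  ... | yes refl = c-Closed k _
  ... | no k≢i = c-Closed-other (·-Closed (d-Closed k≢i k≢j) cl)

  c-sub : ∀ {i j k} → k ≢ i → k ≢ j → ∀ x → c k (sub i j x) ≈ sub i j (c k x)
  c-sub {i} {j} {k} k≢i k≢j x = ≈-trans (c-comm k≢i _) (c-cong i
    (⊑-antisym
      (⊑-trans (c-mono ·-swap) (⊑-trans (⊑-reflexive (c-· (d-Closed k≢i k≢j))) ·-swap))
      (⊑-trans ·-swap (⊑-trans (⊑-reflexive˘ (c-· (d-Closed k≢i k≢j))) (c-mono ·-swap)))))

  sub-·-Closed : ∀ {i j x y} → Closed i y → y · sub i j x ⊑ sub i j (y · x)
  sub-·-Closed cl = ⊑-trans ·-swap (⊑-trans (⊑-reflexive˘ (c-· cl))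
    (c-mono (·-glb (⊑-trans (·-lower₁ _ _) (·-lower₁ _ _))
                   (·-glb (·-lower₂ _ _) (⊑-trans (·-lower₁ _ _) (·-lower₂ _ _))))))

  -- As `j` is a spare dimension of `x`, cylindrifying `d i j · x` along `j` gives `x` back.
  sub-≉0 : ∀ {i j x} → i ≢ j → Closed j x → ¬ (x ≈ 0#) → ¬ (sub i j x ≈ 0#)
  sub-≉0 {i} {j} {x} i≢j cl x≉0 s≈0 = x≉0 (⊑-antisym below-0 (0⊑ x))
    where
    below-0 : x ⊑ 0#
    below-0 = ⊑-trans
      (·-glb (⊑-trans (⊑1 x) (⊑-reflexive˘ (≈-trans (c-cong j (d-symmetric i j)) (c-d (i≢j ∘ sym))))) ⊑-refl)
      (⊑-trans (⊑-reflexive˘ (c-· cl)) (⊑-trans (c-mono (⊑-trans (c-extensive i _) (⊑-reflexive s≈0)))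
        (⊑-reflexive (0-Closed j))))

  rename : I → I → I → I
  rename i j k = if does (k ≟ i) then j else k

  sub-dˡ : ∀ {i j} → i ≢ j → ∀ l → l ≢ i → sub i j (d i l) ≈ d j l
  sub-dˡ {i} {j} i≢j l l≢i with j ≟ l
  ... | yes refl = ≈-trans (c-cong i (⊑-antisym (·-lower₁ _ _) (·-glb ⊑-refl ⊑-refl)))
    (≈-trans (c-d i≢j) (≈-sym (d-refl j)))
  ... | no j≢l = ≈-trans (c-cong i (·-cong (d-sym i≢j) ≈-refl)) (d-compose (i≢j ∘ sym) (l≢i ∘ sym) j≢l)

  sub-d : ∀ {i j} → i ≢ j → ∀ k l → sub i j (d k l) ≈ d (rename i j k) (rename i j l)
  sub-d {i} {j} i≢j k l with k ≟ i | l ≟ i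
  ... | yes refl | yes refl = ≈-trans (sub-cong (d-refl i))
    (≈-trans (sub-Closed i≢j (1-Closed i)) (≈-sym (d-refl j)))
  ... | yes refl | no l≢i = sub-dˡ i≢j l l≢i
  ... | no k≢i | yes refl = ≈-trans (sub-cong (d-symmetric k i)) (≈-trans (sub-dˡ i≢j k k≢i) (d-symmetric j k))
  ... | no k≢i | no l≢i = sub-Closed i≢j (d-Closed (k≢i ∘ sym) (l≢i ∘ sym))

  d-sub : ∀ {i u v} x → i ≢ u → i ≢ v → d u v · sub i u x ⊑ sub i v x
  d-sub {i} {u} {v} x i≢u i≢v = ⊑-trans (sub-·-Closed (d-Closed i≢u i≢v)) (c-mono (·-glb
    (⊑-trans (·-glb (·-lower₁ _ _) (⊑-trans (·-lower₂ _ _) (·-lower₁ _ _))) (d-trans i u v))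
    (⊑-trans (·-lower₂ _ _) (·-lower₂ _ _))))

  -- The simultaneous substitution of σ γ for every γ ∈ Γ.  It is well behaved
  -- when no σ γ lies in Γ, so that the order of the factors does not matter.
  subs : List I → (I → I) → Carrier → Carrier
  subs [] σ x = x
  subs (γ ∷ Γ) σ x = sub γ (σ γ) (subs Γ σ x)

  Off : List I → (I → I) → Set i
  Off Γ σ = ∀ j → σ j ∉ˡ Γ

  module _ {σ : I → I} where

    off-head : ∀ {γ Γ} → Off (γ ∷ Γ) σ → ∀ {j} → γ ≢ σ j
    off-head off {j} γ≡ = off j (here (sym γ≡))

    off-tail : ∀ {γ Γ} → Off (γ ∷ Γ) σ → Off Γ σ
    off-tail off j = off j ∘ there

    subs-cong : ∀ Γ {x y} → x ≈ y → subs Γ σ x ≈ subs Γ σ y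
    subs-cong [] x≈y = x≈y
    subs-cong (γ ∷ Γ) x≈y = sub-cong (subs-cong Γ x≈y)

    subs-+ : ∀ Γ x y → subs Γ σ (x + y) ≈ subs Γ σ x + subs Γ σ y
    subs-+ [] x y = ≈-refl
    subs-+ (γ ∷ Γ) x y = ≈-trans (sub-cong (subs-+ Γ x y)) (sub-+ γ (σ γ) _ _)

    subs-neg : ∀ Γ → Off Γ σ → ∀ x → subs Γ σ (- x) ≈ - subs Γ σ x
    subs-neg [] off x = ≈-refl
    subs-neg (γ ∷ Γ) off x =
      ≈-trans (sub-cong (subs-neg Γ (off-tail off) x)) (sub-neg (off-head off) _)

    subs-Closed : ∀ Γ {k x} → (∀ {j} → j ∈ˡ Γ → k ≢ σ j) → Closed k x → Closed k (subs Γ σ x)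
    subs-Closed [] _ cl = cl
    subs-Closed (γ ∷ Γ) k≢σ cl = sub-preserves-Closed (k≢σ (here refl)) (subs-Closed Γ (k≢σ ∘ there) cl)

    c-subs : ∀ Γ {k} → k ∉ˡ Γ → (∀ j → k ≢ σ j) → ∀ x → c k (subs Γ σ x) ≈ subs Γ σ (c k x)
    c-subs [] _ _ x = ≈-refl
    c-subs (γ ∷ Γ) {k} k∉ k≢σ x =
      ≈-trans (c-sub (λ e → k∉ (here e)) (k≢σ γ) _) (sub-cong (c-subs Γ (k∉ ∘ there) k≢σ x))

    renames : List I → I → I
    renames [] k = k
    renames (γ ∷ Γ) k = rename γ (σ γ) (renames Γ k)

    renames-∉ : ∀ Γ {k} → k ∉ˡ Γ → renames Γ k ≡ k
    renames-∉ [] _ = refl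
    renames-∉ (γ ∷ Γ) {k} k∉ rewrite renames-∉ Γ {k} (k∉ ∘ there) with k ≟ γ
    ... | yes k≡γ = contradiction (here k≡γ) k∉
    ... | no _ = refl

    -- An index that has been renamed lies outside `Γ`, so no other factor touches it again.
    renames-∈ : ∀ Γ {k} → Unique Γ → Off Γ σ → k ∈ˡ Γ → renames Γ k ≡ σ k
    renames-∈ (γ ∷ Γ) (γ∉ ∷ _) off (here refl)
      rewrite renames-∉ Γ {γ} (λ γ∈ → All.lookup γ∉ γ∈ refl) with γ ≟ γ
    ... | yes _ = refl
    ... | no γ≢γ = contradiction refl γ≢γ
    renames-∈ (γ ∷ Γ) {k} (_ ∷ uniq) off (there k∈)
      rewrite renames-∈ Γ uniq (off-tail off) k∈ with σ k ≟ γ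
    ... | yes σk≡γ = contradiction (here σk≡γ) (off k)
    ... | no _ = refl

    subs-renames : ∀ Γ → Off Γ σ → ∀ k l → subs Γ σ (d k l) ≈ d (renames Γ k) (renames Γ l)
    subs-renames [] _ k l = ≈-refl
    subs-renames (γ ∷ Γ) off k l =
      ≈-trans (sub-cong (subs-renames Γ (off-tail off) k l)) (sub-d (off-head off) _ _)

    subs-d : ∀ Γ → Unique Γ → Off Γ σ → ∀ {k l} → k ∈ˡ Γ → l ∈ˡ Γ → subs Γ σ (d k l) ≈ d (σ k) (σ l)
    subs-d Γ uniq off {k} {l} k∈ l∈ = subst₂ (λ k′ l′ → subs Γ σ (d k l) ≈ d k′ l′)
      (renames-∈ Γ uniq off k∈) (renames-∈ Γ uniq off l∈) (subs-renames Γ off k l)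

    -- Each factor uses up one spare dimension, and injectivity of `σ` keeps the others spare.
    subs-≉0 : ∀ Γ → Unique Γ → Off Γ σ → (∀ {j k} → j ∈ˡ Γ → j ≢ k → σ j ≢ σ k) →
              ∀ {x} → (∀ j → Closed (σ j) x) → ¬ (x ≈ 0#) → ¬ (subs Γ σ x ≈ 0#)
    subs-≉0 [] _ _ _ _ x≉0 = x≉0
    subs-≉0 (γ ∷ Γ) (γ∉ ∷ uniq) off inj cl x≉0 = sub-≉0 (off-head off)
      (subs-Closed Γ (λ j∈ → inj (here refl) (All.lookup γ∉ j∈)) (cl γ))
      (subs-≉0 Γ uniq (off-tail off) (inj ∘ there) cl x≉0)

  subs-agree : ∀ Γ {σ τ} → (∀ {j} → j ∈ˡ Γ → σ j ≡ τ j) → ∀ x → subs Γ σ x ≡ subs Γ τ x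
  subs-agree [] _ x = refl
  subs-agree (γ ∷ Γ) agree x = cong₂ (sub γ) (agree (here refl)) (subs-agree Γ (agree ∘ there) x)

  subs-agree-tail : ∀ {i} Γ {σ τ} → All (i ≢_) Γ → (∀ j → j ≢ i → σ j ≡ τ j) → ∀ x → subs Γ σ x ≡ subs Γ τ x
  subs-agree-tail Γ i∉ agree = subs-agree Γ λ j∈ → agree _ λ j≡i → All.lookup i∉ j∈ (sym j≡i)

  -- Introduction of an existential quantifier: behind `c i` the value substituted for `i` no longer
  -- matters, and the other factors agree.
  subs-c : ∀ Γ {i σ τ} → Unique Γ → i ∈ˡ Γ → (∀ j → i ≢ σ j) → (∀ j → i ≢ τ j) →
           (∀ j → j ≢ i → σ j ≡ τ j) → ∀ x → subs Γ σ x ⊑ subs Γ τ (c i x)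
  subs-c (i ∷ Γ) {_} {σ} {τ} (i∉ ∷ _) (here refl) i≢σ i≢τ agree x =
    ⊑-trans (c-mono (·-lower₂ _ _)) (⊑-reflexive˘ (≈-trans (sub-Closed (i≢τ i) (subs-Closed Γ (λ _ → i≢τ _) (c-Closed i x)))
      (subst (λ z → z ≈ c i (subs Γ σ x)) (subs-agree-tail Γ i∉ agree (c i x))
        (≈-sym (c-subs Γ (λ i∈ → All.lookup i∉ i∈ refl) i≢σ x)))))
  subs-c (γ ∷ Γ) {i} {σ} {τ} (γ∉ ∷ uniq) (there i∈) i≢σ i≢τ agree x =
    subst (λ δ → sub γ (σ γ) (subs Γ σ x) ⊑ sub γ δ (subs Γ τ (c i x)))
      (agree γ (All.lookup γ∉ i∈)) (sub-mono (subs-c Γ uniq i∈ i≢σ i≢τ agree x))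

  -- Elimination of an existential quantifier by a fresh name `δ = τ i`. At the factor for `i`, the
  -- element `y` still to be substituted into is independent of `δ`, so `y ≈ c δ (d i δ · y)`, and
  -- exchanging `c i` with `c δ` turns `c i y` into `c δ (sub i δ y)`.
  subs-witness : ∀ Γ {i σ τ} → Unique Γ → i ∈ˡ Γ → (∀ j → i ≢ σ j) → (∀ j → i ≢ τ j) →
                 (∀ j → j ≢ i → σ j ≡ τ j) → τ i ∉ˡ Γ → (∀ j → τ i ≢ σ j) →
                 ∀ {x} → Closed (τ i) x → subs Γ σ (c i x) ⊑ c (τ i) (subs Γ τ x)
  subs-witness (i ∷ Γ) {_} {σ} {τ} (i∉ ∷ _) (here refl) i≢σ i≢τ agree δ∉ δ≢σ {x} cl =
    ⊑-trans (⊑-reflexive (≈-trans (sub-Closed (i≢σ i) (subs-Closed Γ (λ _ → i≢σ _) (c-Closed i x)))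
      (≈-trans (≈-sym (c-subs Γ (λ i∈ → All.lookup i∉ i∈ refl) i≢σ x))
        (≈-reflexive (cong (c i) (subs-agree-tail Γ i∉ agree x))))))
    (⊑-trans (c-mono (·-glb (⊑-trans (⊑1 _) (⊑-reflexive˘ (≈-trans (c-cong (τ i) (d-symmetric i (τ i))) (c-d (i≢τ i ∘ sym))))) ⊑-refl))
      (⊑-trans (c-mono (⊑-reflexive˘ (c-· y-Closed))) (⊑-reflexive (c-comm (i≢τ i) _))))
    where
    y-Closed : Closed (τ i) (subs Γ τ x)
    y-Closed = subst (Closed (τ i)) (subs-agree-tail Γ i∉ agree x) (subs-Closed Γ (λ _ → δ≢σ _) cl)
  subs-witness (γ ∷ Γ) {i} {σ} {τ} (γ∉ ∷ uniq) (there i∈) i≢σ i≢τ agree δ∉ δ≢σ {x} cl =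
    ⊑-trans (sub-mono (subs-witness Γ uniq i∈ i≢σ i≢τ agree (δ∉ ∘ there) δ≢σ cl))
      (⊑-trans (⊑-reflexive˘ (c-sub (λ e → δ∉ (here e)) (δ≢σ γ) _))
        (subst (λ η → c (τ i) (sub γ (σ γ) (subs Γ τ x)) ⊑ c (τ i) (sub γ η (subs Γ τ x)))
          (agree γ (All.lookup γ∉ i∈)) ⊑-refl))

  -- The Henkin axiom `- m + n` cylindrifies to `1#`, so it cannot annihilate an element independent
  -- of `i`.
  eliminate-≉0 : ∀ {i q m n} → Closed i q → m ⊑ c i n → ¬ (q ≈ 0#) → ¬ ((- m + n) · q ≈ 0#)
  eliminate-≉0 {i} {q} {m} {n} q-cl m⊑cn q≉0 z = q≉0 (⊑-antisym
    (⊑-trans (·-glb (⊑-trans (⊑1 q) below) ⊑-refl)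
      (⊑-trans (⊑-reflexive˘ (c-· q-cl)) (⊑-trans (c-mono (⊑-reflexive z)) (⊑-reflexive (0-Closed i)))))
    (0⊑ q))
    where
    below : 1# ⊑ c i (- m + n)
    below = by-cases m
      (⊑-trans (·-lower₂ _ _) (⊑-trans m⊑cn (c-mono (+-upper₂ _ _))))
      (⊑-trans (·-lower₂ _ _) (⊑-trans (c-extensive i _) (c-mono (+-upper₁ _ _))))

  subs-replace : ∀ Γ {i σ τ} → Unique Γ → Off Γ σ → Off Γ τ → (∀ j → j ≢ i → σ j ≡ τ j) →
                 ∀ x → d (σ i) (τ i) · subs Γ σ x ⊑ subs Γ τ x
  subs-replace [] _ _ _ _ x = ·-lower₂ _ _
  subs-replace (γ ∷ Γ) {i} {σ} {τ} (γ∉ ∷ uniq) offσ offτ agree x with γ ≟ i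
  ... | yes refl = subst (λ y → d (σ γ) (τ γ) · sub γ (σ γ) (subs Γ σ x) ⊑ sub γ (τ γ) y)
    (subs-agree-tail Γ γ∉ agree x) (d-sub _ (off-head {σ} offσ) (off-head {τ} offτ))
  ... | no γ≢i = subst (λ δ → d (σ i) (τ i) · sub γ (σ γ) (subs Γ σ x) ⊑ sub γ δ (subs Γ τ x)) (agree γ γ≢i)
    (⊑-trans (sub-·-Closed (d-Closed (off-head {σ} offσ) (off-head {τ} offτ)))
      (sub-mono (subs-replace Γ uniq (off-tail {σ} offσ) (off-tail {τ} offτ) agree x)))

-- Finite approximations and Henkin constants

module Representation {ℓ} (em : ExcludedMiddle ℓ) (ac : AxiomOfChoice ℓ) {I : Set ℓ} (_≟_ : DecidableEquality I) {A : Algebra I ℓ ℓ} (isCA : IsCylindricAlgebra A) (edc : EndoDimensionComplemented isCA) where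
  open Classical em
  open Compactness em ac using (compactness)
  open Cubes em _≟_
  open Algebra A hiding (_≤_)
  open CylindricArithmetic _≟_ isCA

  -- `ε u` is a dimension on which no `g a` depends. Since only finitely many such dimensions are
  -- produced, only the members of `L` are kept apart, each from every other constant; the remaining
  -- ones may share a dimension.
  record Approximation (Γ : List I) (x : Carrier) {C : Set ℓ} (L : List C) : Set ℓ where
    field
      g        : Carrier → Carrier
      g-cong   : ∀ {a b} → a ≈ b → g a ≈ g b
      g-+      : ∀ a b → g (a + b) ≈ g a + g b
      g-neg    : ∀ a → g (- a) ≈ - g a
      g-c      : ∀ {i} → i ∈ˡ Γ → ∀ a → g (c i a) ≈ c i (g a)
      g-d      : ∀ {i j} → i ∈ˡ Γ → j ∈ˡ Γ → g (d i j) ≈ d i j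
      g≉0      : ¬ (g x ≈ 0#)
      ε        : C → I
      ε-off    : ∀ u → ε u ∉ˡ Γ
      ε-closed : ∀ u a → Closed (ε u) (g a)
      ε-inj    : ∀ {u v} → u ∈ˡ L → u ≢ v → ε u ≢ ε v

  abstract
    -- Before the next endomorphism is taken, `κ` joins the finite set. So the later maps commute
    -- with `c κ`, and the composite remains independent of `κ`.
    approximation : ∀ Γ {x} → ¬ (x ≈ 0#) → {C : Set ℓ} (L : List C) → Approximation Γ x L
    approximation Γ {x} x≉0 [] with edc Γ x x≉0
    ... | κ , κ∉Γ , h , hx≉0 , h-closed = record
      { g = H.to
      ; g-cong = H.cong
      ; g-+ = H.+-homo
      ; g-neg = H.-‿homo
      ; g-c = λ i∈ → H.c-homo (_ , i∈)
      ; g-d = λ i∈ j∈ → H.d-homo (_ , i∈) (_ , j∈)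
      ; g≉0 = hx≉0
      ; ε = λ _ → κ
      ; ε-off = λ _ → κ∉Γ
      ; ε-closed = λ _ → h-closed
      ; ε-inj = λ () }
      where module H = Homomorphism h
    approximation Γ {x} x≉0 {C} (w ∷ L) with edc Γ x x≉0
    ... | κ , κ∉Γ , h , hx≉0 , h-closed = record
      { g = G.g ∘ H.to
      ; g-cong = G.g-cong ∘ H.cong
      ; g-+ = λ a b → ≈-trans (G.g-cong (H.+-homo a b)) (G.g-+ _ _)
      ; g-neg = λ a → ≈-trans (G.g-cong (H.-‿homo a)) (G.g-neg _)
      ; g-c = λ i∈ a → ≈-trans (G.g-cong (H.c-homo (_ , i∈) a)) (G.g-c (there i∈) _)
      ; g-d = λ i∈ j∈ → ≈-trans (G.g-cong (H.d-homo (_ , i∈) (_ , j∈))) (G.g-d (there i∈) (there j∈))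
      ; g≉0 = G.g≉0
      ; ε = ε
      ; ε-off = ε-off
      ; ε-closed = ε-closed
      ; ε-inj = ε-inj }
      where
      module H = Homomorphism h
      module G = Approximation (approximation (κ ∷ Γ) hx≉0 L)
      ε : C → I
      ε u with em {u ≡ w}
      ... | yes _ = κ
      ... | no _ = G.ε u
      ε-off : ∀ u → ε u ∉ˡ Γ
      ε-off u with em {u ≡ w}
      ... | yes _ = κ∉Γ
      ... | no _ = G.ε-off u ∘ there
      ε-closed : ∀ u a → Closed (ε u) (G.g (H.to a))
      ε-closed u a with em {u ≡ w}
      ... | yes _ = ≈-trans (≈-sym (G.g-c (here refl) (H.to a))) (G.g-cong (h-closed a))
      ... | no _ = G.ε-closed u (H.to a)
      ε-inj : ∀ {u v} → u ∈ˡ w ∷ L → u ≢ v → ε u ≢ ε v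
      ε-inj {u} {v} u∈ u≢v with em {u ≡ w} | em {v ≡ w}
      ... | yes refl | yes refl = contradiction refl u≢v
      ... | yes refl | no _ = λ e → G.ε-off v (here (sym e))
      ... | no _ | yes refl = λ e → G.ε-off u (here e)
      ε-inj {u} {v} (here refl) u≢v | no u≢w | no _ = contradiction refl u≢w
      ε-inj {u} {v} (there u∈) u≢v | no _ | no _ = G.ε-inj u∈ u≢v

  -- An element of `A` may depend on infinitely many dimensions, so it is instantiated by a whole
  -- sequence of constants, and a witness records the sequence that called for it.
  data Const : Set ℓ where
    var : I → Const
    wit : I → Carrier → (I → Const) → Const

  data Atom : Set ℓ where
    rel : Carrier → (I → Const) → Atom
    eq  : Const → Const → Atom

  data _◁_ : Const → Const → Set ℓ where
    arg : ∀ {i a s} j → s j ◁ wit i a s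

  ◁-wellFounded : WellFounded _◁_
  ◁-wellFounded (var _) = acc λ ()
  ◁-wellFounded (wit i a s) = acc λ { (arg j) → ◁-wellFounded (s j) }

  _◁⁺_ : Const → Const → Set ℓ
  _◁⁺_ = TransClosure _◁_

  ◁⁺-irrefl : ∀ {u} → ¬ (u ◁⁺ u)
  ◁⁺-irrefl u◁u = wf⇒asym (Transitive.wellFounded _◁_ ◁-wellFounded) u◁u u◁u

  maximal-∈ : ∀ u L → Σ Const λ m → m ∈ˡ u ∷ L × (∀ {w} → w ∈ˡ u ∷ L → ¬ (m ◁⁺ w))
  maximal-∈ u [] = u , here refl , λ { (here refl) → ◁⁺-irrefl }
  maximal-∈ u (w ∷ L) with maximal-∈ w L
  ... | m , m∈ , m-max with em {m ◁⁺ u}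
  ...   | yes m◁u = u , here refl , λ
    { (here refl) → ◁⁺-irrefl ; (there w∈) u◁w → m-max w∈ (Transitive.transitive _◁_ m◁u u◁w) }
  ...   | no ¬m◁u = m , there m∈ , λ { (here refl) → ¬m◁u ; (there w∈) → m-max w∈ }

  indices : List Const → List I
  indices [] = []
  indices (var _ ∷ L) = indices L
  indices (wit i _ _ ∷ L) = i ∷ indices L

  ∈-indices : ∀ {L i a s} → wit i a s ∈ˡ L → i ∈ˡ indices L
  ∈-indices {_ ∷ _} (here refl) = here refl
  ∈-indices {var _ ∷ _} (there w∈) = ∈-indices w∈
  ∈-indices {wit _ _ _ ∷ _} (there w∈) = there (∈-indices w∈)

  witness : I → Carrier → (I → Const) → I → Const
  witness i a s = update s i (wit i a s)

  record Model (x : Carrier) : Set ℓ where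
    field
      v : Atom → Bool
    True : Atom → Set
    True φ = v φ ≡ true
    field
      T-base    : True (rel x var)
      T-cong    : ∀ {a b s} → a ≈ b → True (rel a s) → True (rel b s)
      T-agree   : ∀ {a s t} → (∀ j → s j ≡ t j) → True (rel a s) → True (rel a t)
      T-+ˡ      : ∀ {a b s} → True (rel a s) → True (rel (a + b) s)
      T-+ʳ      : ∀ {a b s} → True (rel b s) → True (rel (a + b) s)
      T-+⁻      : ∀ {a b s} → True (rel (a + b) s) → True (rel (- a) s) → True (rel b s)
      T-neg     : ∀ {a s} → ¬ True (rel a s) → True (rel (- a) s)
      T-neg⁻    : ∀ {a s} → True (rel (- a) s) → ¬ True (rel a s)
      T-c       : ∀ {i a s t} → (∀ j → j ≢ i → s j ≡ t j) → True (rel a s) → True (rel (c i a) t)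
      T-wit     : ∀ {i a s} → True (rel (c i a) s) → True (rel a (witness i a s))
      T-d       : ∀ {i j s} → True (eq (s i) (s j)) → True (rel (d i j) s)
      T-d⁻      : ∀ {i j s} → True (rel (d i j) s) → True (eq (s i) (s j))
      T-refl    : ∀ {u} → True (eq u u)
      T-sym     : ∀ {u w} → True (eq u w) → True (eq w u)
      T-trans   : ∀ {u w z} → True (eq u w) → True (eq w z) → True (eq u z)
      T-replace : ∀ {i a s t} → True (eq (s i) (t i)) → (∀ j → j ≢ i → s j ≡ t j) →
                  True (rel a s) → True (rel a t)

  -- Consistency across stages and the Henkin model

  module Construction {x : Carrier} (x≉0 : ¬ (x ≈ 0#)) where

    Stage : Set ℓ
    Stage = List I × List Const

    infix 4 _≼_
    _≼_ : Stage → Stage → Set ℓ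
    (Γ , L) ≼ (Δ , M) = (∀ {i} → i ∈ˡ Γ → i ∈ˡ Δ) × (∀ {u} → u ∈ˡ L → u ∈ˡ M)

    ≼-++ˡ : ∀ {p q r} → (proj₁ p ++ proj₁ q , proj₂ p ++ proj₂ q) ≼ r → p ≼ r
    ≼-++ˡ (f , g) = (f ∘ ∈-++⁺ˡ) , (g ∘ ∈-++⁺ˡ)

    ≼-++ʳ : ∀ {p q r} → (proj₁ p ++ proj₁ q , proj₂ p ++ proj₂ q) ≼ r → q ≼ r
    ≼-++ʳ {p} (f , g) = (f ∘ ∈-++⁺ʳ (proj₁ p)) , (g ∘ ∈-++⁺ʳ (proj₂ p))

    indexSet : Stage → List I
    indexSet (Γ , _) = deduplicate _≟_ Γ

    -- Each stage interprets the atoms in A itself: constants become spare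
    -- dimensions, and instantiating a relation by constants becomes substitution.
    module At (p : Stage) where
      open Approximation (approximation (indexSet p) x≉0 (proj₂ p)) public

      Γ : List I
      Γ = indexSet p

      Γ-unique : Unique Γ
      Γ-unique = deduplicate-! _≟_ (proj₁ p)

      ε-≢ : ∀ {i} → i ∈ˡ Γ → ∀ {u} → i ≢ ε u
      ε-≢ i∈ refl = ε-off _ i∈

      ⟦_⟧ : Atom → Carrier
      ⟦ rel a s ⟧ = subs Γ (ε ∘ s) (g a)
      ⟦ eq u w ⟧ = d (ε u) (ε w)

      ⟦_⟧± : Atom × Bool → Carrier
      ⟦ φ , true ⟧± = ⟦ φ ⟧
      ⟦ φ , false ⟧± = - ⟦ φ ⟧

      henkin : Const → Carrier
      henkin (var _) = 1#
      henkin (wit i a s) = - ⟦ rel (c i a) s ⟧ + ⟦ rel a (witness i a s) ⟧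

    module _ {X : Set ℓ} (f : X → Carrier) where

      ⋀ : List X → Carrier
      ⋀ [] = 1#
      ⋀ (y ∷ l) = f y · ⋀ l

      ⋀-lower : ∀ {l y} → y ∈ˡ l → ⋀ l ⊑ f y
      ⋀-lower (here refl) = ·-lower₁ _ _
      ⋀-lower (there y∈) = ⊑-trans (·-lower₂ _ _) (⋀-lower y∈)

      ⋀-greatest : ∀ l {z} → (∀ {y} → y ∈ˡ l → z ⊑ f y) → z ⊑ ⋀ l
      ⋀-greatest [] _ = ⊑1 _
      ⋀-greatest (y ∷ l) h = ·-glb (h (here refl)) (⋀-greatest l (h ∘ there))

      ⋀-anti : ∀ l {l′} → (∀ {y} → y ∈ˡ l → y ∈ˡ l′) → ⋀ l′ ⊑ ⋀ l
      ⋀-anti l h = ⋀-greatest l (⋀-lower ∘ h)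

      ⋀-Closed : ∀ l {i} → (∀ {y} → y ∈ˡ l → Closed i (f y)) → Closed i (⋀ l)
      ⋀-Closed [] _ = 1-Closed _
      ⋀-Closed (y ∷ l) h = ·-Closed (h (here refl)) (⋀-Closed l (h ∘ there))

    context : Stage → List Const → Carrier
    context q L = At.⟦_⟧ q (rel x var) · ⋀ (At.henkin q) L

    -- The quantifier over `p` is what allows refutations found at different stages to be brought to
    -- a common one, as in `Con-split`.
    Con : List (Atom × Bool) → Set ℓ
    Con l = ∀ p → Σ Stage λ q → p ≼ q × ¬ (context q (proj₂ p) · ⋀ (At.⟦_⟧± q) l ≈ 0#)

    -- The enlarged stage contains the index of each witness of `p`, so that `g` commutes with the
    -- cylindrifications in their Henkin axioms. It also contains `var j` for each of its indices
    -- `j`, so that the instance of `x` at `var` puts a separate spare dimension at each place and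
    -- stays nonzero.
    module Saturated (p : Stage) where
      q : Stage
      q = (proj₁ p ++ indices (proj₂ p)) , (proj₂ p ++ map var (proj₁ p ++ indices (proj₂ p)))
      open At q

      base-≉0 : ¬ (⟦ rel x var ⟧ ≈ 0#)
      base-≉0 = subs-≉0 Γ Γ-unique (λ j → ε-off (var j))
        (λ j∈ j≢k → ε-inj (∈-++⁺ʳ (proj₂ p) (∈-map⁺ var (∈-deduplicate⁻ _≟_ (proj₁ q) j∈))) λ { refl → j≢k refl })
        (λ j → ε-closed (var j) x) g≉0

      rel-Closed : ∀ {m} → m ∈ˡ proj₂ q → ∀ {a s} → (∀ j → m ≢ s j) → Closed (ε m) ⟦ rel a s ⟧
      rel-Closed m∈ m≢s = subs-Closed Γ (λ {j} _ → ε-inj m∈ (m≢s j)) (ε-closed _ _)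

      henkin-Closed : ∀ {m} → m ∈ˡ proj₂ q → ∀ w → m ≢ w → ¬ (m ◁⁺ w) → Closed (ε m) (henkin w)
      henkin-Closed m∈ (var _) _ _ = 1-Closed _
      henkin-Closed {m} m∈ (wit i a s) m≢w ¬m◁w = +-Closed
        (neg-Closed (rel-Closed m∈ m≢s))
        (rel-Closed m∈ (update-elim (λ _ u → m ≢ u) m≢w (λ j _ → m≢s j)))
        where
        m≢s : ∀ j → m ≢ s j
        m≢s j refl = ¬m◁w [ arg j ]

      -- A ◁-maximal constant occurs in its own Henkin axiom only, so that axiom
      -- can be discarded by cylindrifying its dimension away.
      context-≉0 : ∀ n M → length M ≤ n → (∀ {u} → u ∈ˡ M → u ∈ˡ proj₂ p) → ¬ (context q M ≈ 0#)
      context-≉0 _ [] _ _ = ≉0-mono (·-glb ⊑-refl (⊑1 _)) base-≉0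
      context-≉0 (suc n) M@(u ∷ M₀) (s≤s M₀≤n) M⊆ with maximal-∈ u M₀
      ... | m , m∈M , m-max = step m m∈M m-max
        where
        others : Const → List Const
        others m = filter (λ w → ¬? (em {w ≡ m})) M

        others-⊆ : ∀ m {w} → w ∈ˡ others m → w ∈ˡ M × w ≢ m
        others-⊆ m = ∈-filter⁻ (λ w → ¬? (em {w ≡ m})) {xs = M}

        rest : ∀ m → m ∈ˡ M → ¬ (context q (others m) ≈ 0#)
        rest m m∈ = context-≉0 n (others m)
          (≤-trans (s≤s⁻¹ (filter-notAll (λ w → ¬? (em {w ≡ m})) M (Any.map (λ e w≢m → w≢m (sym e)) m∈))) M₀≤n)
          (M⊆ ∘ proj₁ ∘ others-⊆ m)

        reassemble : ∀ m → henkin m · context q (others m) ⊑ context q M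
        reassemble m = ·-glb (⊑-trans (·-lower₂ _ _) (·-lower₁ _ _)) (⋀-greatest henkin M λ {w} w∈ → factor w w∈)
          where
          factor : ∀ w → w ∈ˡ M → henkin m · context q (others m) ⊑ henkin w
          factor w w∈ with em {w ≡ m}
          ... | yes refl = ·-lower₁ _ _
          ... | no w≢m = ⊑-trans (·-lower₂ _ _) (⊑-trans (·-lower₂ _ _)
            (⋀-lower henkin (∈-filter⁺ (λ w → ¬? (em {w ≡ m})) w∈ w≢m)))

        step : ∀ m → m ∈ˡ M → (∀ {w} → w ∈ˡ M → ¬ (m ◁⁺ w)) → ¬ (context q M ≈ 0#)
        step m@(var _) m∈ _ = ≉0-mono (⊑-trans (·-glb (⊑1 _) ⊑-refl) (reassemble m)) (rest m m∈)
        step m@(wit i a s) m∈ m-max = ≉0-mono (reassemble m) (eliminate-≉0 {ε m}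
          -- `x` is instantiated by variables alone, and `m` is maximal, so everything except the
          -- axiom of `m` itself is independent of `ε m`.
          (·-Closed (rel-Closed m∈q λ j ())
            (⋀-Closed henkin (others m) λ {w} w∈ → let w∈M , w≢m = others-⊆ m w∈ in
              henkin-Closed m∈q w (w≢m ∘ sym) (m-max w∈M)))
          (⊑-trans (⊑-reflexive (subs-cong Γ (g-c i∈ a)))
            (subst (λ δ → subs Γ (ε ∘ s) (c i (g a)) ⊑ c δ ⟦ rel a (witness i a s) ⟧)
              (cong ε (update-same s i))
              (subs-witness Γ Γ-unique i∈ (λ _ → ε-≢ i∈) (λ _ → ε-≢ i∈)
                (λ j j≢i → cong ε (sym (update-other s j≢i)))
                (ε-off _)
                (λ j → subst (λ u → ε u ≢ ε (s j)) (sym (update-same s i)) (ε-inj m∈q (m≢s j)))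
                (ε-closed _ a))))
          (rest m m∈))
          where
          m∈q : m ∈ˡ proj₂ q
          m∈q = ∈-++⁺ˡ (M⊆ m∈)
          i∈ : i ∈ˡ Γ
          i∈ = ∈-deduplicate⁺ _≟_ (∈-++⁺ʳ (proj₁ p) (∈-indices (M⊆ m∈)))
          m≢s : ∀ j → m ≢ s j
          m≢s j e = ◁⁺-irrefl {m} [ subst (_◁ m) (sym e) (arg j) ]

      consistent : ¬ (context q (proj₂ p) · 1# ≈ 0#)
      consistent = ≉0-mono (·-glb ⊑-refl (⊑1 _)) (context-≉0 _ (proj₂ p) ≤-refl id)

    Con-[] : Con []
    Con-[] p = Saturated.q p , (∈-++⁺ˡ , ∈-++⁺ˡ) , Saturated.consistent p

    Con-anti : ∀ {l l′} → (∀ {y} → y ∈ˡ l → y ∈ˡ l′) → Con l′ → Con l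
    Con-anti {l} l⊆l′ con p =
      let q , p≼q , ≉0 = con p
      in q , p≼q , ≉0-mono (·-mono ⊑-refl (⋀-anti (At.⟦_⟧± q) l l⊆l′)) ≉0

    Refuted : List (Atom × Bool) → Stage → Set ℓ
    Refuted l p = ∀ q → p ≼ q → context q (proj₂ p) · ⋀ (At.⟦_⟧± q) l ⊑ 0#

    refuted : ∀ {l} → ¬ Con l → Σ Stage (Refuted l)
    refuted ¬con = byContradiction λ none → ¬con λ p → byContradiction λ none′ →
      none (p , λ q p≼q → ⊑-reflexive (byContradiction λ ≉0 → none′ (q , p≼q , ≉0)))

    context-anti : ∀ q {L M} → (∀ {u} → u ∈ˡ L → u ∈ˡ M) → context q M ⊑ context q L
    context-anti q {L} L⊆M = ·-mono ⊑-refl (⋀-anti (At.henkin q) L L⊆M)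

    -- If both extensions failed, each would be refuted from some stage on. At a stage beyond both,
    -- `⟦ φ ⟧` and its complement together exhaust the context, leaving nothing of `l`.
    Con-split : ∀ {l} φ → Con l → Con ((φ , true) ∷ l) ⊎ Con ((φ , false) ∷ l)
    Con-split {l} φ con with em {Con ((φ , true) ∷ l)} | em {Con ((φ , false) ∷ l)}
    ... | yes con⁺ | _ = inj₁ con⁺
    ... | no _ | yes con⁻ = inj₂ con⁻
    ... | no ¬con⁺ | no ¬con⁻ =
      let p⁺ , ref⁺ = refuted {(φ , true) ∷ l} ¬con⁺
          p⁻ , ref⁻ = refuted {(φ , false) ∷ l} ¬con⁻
          q , p≼q , ≉0 = con (proj₁ p⁺ ++ proj₁ p⁻ , proj₂ p⁺ ++ proj₂ p⁻)
          open At q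
      in contradiction (⊑-antisym (by-cases ⟦ φ ⟧
          (⊑-trans (·-glb (⊑-trans (·-lower₁ _ _) (⊑-trans (·-lower₁ _ _) (context-anti q {proj₂ p⁺} ∈-++⁺ˡ)))
                     (·-glb (·-lower₂ _ _) (⊑-trans (·-lower₁ _ _) (·-lower₂ _ _))))
            (ref⁺ q (≼-++ˡ {p⁺} {p⁻} p≼q)))
          (⊑-trans (·-glb (⊑-trans (·-lower₁ _ _) (⊑-trans (·-lower₁ _ _) (context-anti q {proj₂ p⁻} (∈-++⁺ʳ (proj₂ p⁺)))))
                     (·-glb (·-lower₂ _ _) (⊑-trans (·-lower₁ _ _) (·-lower₂ _ _))))
            (ref⁻ q (≼-++ʳ {p⁺} {p⁻} p≼q)))) (0⊑ _)) ≉0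

    abstract
      valuation : Σ (Atom → Bool) λ v → ∀ l → (∀ {y} → y ∈ˡ l → v (proj₁ y) ≡ proj₂ y) → Con l
      valuation = compactness Atom Con Con-[]
        (λ {l} {l′} → Con-anti {l} {l′}) (λ {l} → Con-split {l})

    v : Atom → Bool
    v = proj₁ valuation

    True : Atom → Set
    True φ = v φ ≡ true

    forbids : ∀ l p → Refuted l p → ¬ (∀ {y} → y ∈ˡ l → v (proj₁ y) ≡ proj₂ y)
    forbids l p ref sat =
      let q , p≼q , ≉0 = proj₂ valuation l sat p
      in ≉0 (⊑-antisym (ref q p≼q) (0⊑ _))

    -- Transfers inequalities valid at all stages from `p` on to implications in the model. The
    -- context supplies the Henkin axioms as premises, which is how `T-wit` is obtained.
    entails₁ : ∀ φ ψ p → (∀ q → p ≼ q → context q (proj₂ p) · At.⟦_⟧ q φ ⊑ At.⟦_⟧ q ψ) → True φ → True ψ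
    entails₁ φ ψ p ent Tφ = ≡true-stable λ ¬Tψ → forbids ((φ , true) ∷ (ψ , false) ∷ []) p
      (λ q p≼q → contradictory (At.⟦_⟧ q ψ)
        (⊑-trans (·-mono ⊑-refl (·-lower₁ _ _)) (ent q p≼q))
        (⊑-trans (·-lower₂ _ _) (⊑-trans (·-lower₂ _ _) (·-lower₁ _ _))))
      λ { (here refl) → Tφ ; (there (here refl)) → ¬-not ¬Tψ }

    entails₂ : ∀ φ χ ψ p → (∀ q → p ≼ q → At.⟦_⟧ q φ · At.⟦_⟧ q χ ⊑ At.⟦_⟧ q ψ) → True φ → True χ → True ψ
    entails₂ φ χ ψ p ent Tφ Tχ = ≡true-stable λ ¬Tψ → forbids ((φ , true) ∷ (χ , true) ∷ (ψ , false) ∷ []) p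
      (λ q p≼q → contradictory (At.⟦_⟧ q ψ)
        (⊑-trans (·-lower₂ _ _) (⊑-trans (·-mono ⊑-refl (·-lower₁ _ _)) (ent q p≼q)))
        (⊑-trans (·-lower₂ _ _) (⊑-trans (·-lower₂ _ _) (⊑-trans (·-lower₂ _ _) (·-lower₁ _ _)))))
      λ { (here refl) → Tφ ; (there (here refl)) → Tχ ; (there (there (here refl))) → ¬-not ¬Tψ }

    entails : ∀ φ ψ Γ → (∀ q → (Γ , []) ≼ q → At.⟦_⟧ q φ ⊑ At.⟦_⟧ q ψ) → True φ → True ψ
    entails φ ψ Γ ent = entails₁ φ ψ (Γ , []) λ q p≼q → ⊑-trans (·-lower₂ _ _) (ent q p≼q)

    ∈-indexSet : ∀ {Γ L q i} → (Γ , L) ≼ q → i ∈ˡ Γ → i ∈ˡ indexSet q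
    ∈-indexSet (f , _) i∈ = ∈-deduplicate⁺ _≟_ (f i∈)

    theModel : Model x
    theModel = record
      { v = v
      ; T-base = ≡true-stable λ ¬T → forbids ((rel x var , false) ∷ []) ([] , [])
          (λ q _ → contradictory (At.⟦_⟧ q (rel x var))
            (⊑-trans (·-lower₁ _ _) (·-lower₁ _ _)) (⊑-trans (·-lower₂ _ _) (·-lower₁ _ _)))
          λ { (here refl) → ¬-not ¬T }
      ; T-cong = λ {a} {b} {s} a≈b → entails (rel a s) (rel b s) [] λ q _ → let open At q in
          ⊑-reflexive (subs-cong Γ (g-cong a≈b))
      ; T-agree = λ {a} {s} {t} s≡t → entails (rel a s) (rel a t) [] λ q _ → let open At q in
          ⊑-reflexive (≈-reflexive (subs-agree Γ (λ {j} _ → cong ε (s≡t j)) (g a)))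
      ; T-+ˡ = λ {a} {b} {s} → entails (rel a s) (rel (a + b) s) [] λ q _ → let open At q in
          ⊑-trans (+-upper₁ _ _) (⊑-reflexive˘ (≈-trans (subs-cong Γ (g-+ a b)) (subs-+ Γ _ _)))
      ; T-+ʳ = λ {a} {b} {s} → entails (rel b s) (rel (a + b) s) [] λ q _ → let open At q in
          ⊑-trans (+-upper₂ _ _) (⊑-reflexive˘ (≈-trans (subs-cong Γ (g-+ a b)) (subs-+ Γ _ _)))
      ; T-+⁻ = λ {a} {b} {s} → entails₂ (rel (a + b) s) (rel (- a) s) (rel b s) ([] , []) λ q _ → let open At q in
          ⊑-trans (·-mono (⊑-reflexive (≈-trans (subs-cong Γ (g-+ a b)) (subs-+ Γ _ _))) (⊑-reflexive (⟦neg⟧ q a s)))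
            (⊑-trans ·-swap (distrib-⊑ (contradictory ⟦ rel a s ⟧ (·-lower₂ _ _) (·-lower₁ _ _)) (·-lower₂ _ _)))
      ; T-neg = λ {a} {s} ¬T → ≡true-stable λ ¬T⁻ →
          forbids ((rel a s , false) ∷ (rel (- a) s , false) ∷ []) ([] , [])
            (λ q _ → let open At q in contradictory (- ⟦ rel a s ⟧)
              (⊑-trans (·-lower₂ _ _) (·-lower₁ _ _))
              (⊑-trans (·-lower₂ _ _) (⊑-trans (·-lower₂ _ _) (⊑-trans (·-lower₁ _ _) (⊑-reflexive (-‿cong (⟦neg⟧ q a s)))))))
            λ { (here refl) → ¬-not ¬T ; (there (here refl)) → ¬-not ¬T⁻ }
      ; T-neg⁻ = λ {a} {s} T⁻ T → forbids ((rel a s , true) ∷ (rel (- a) s , true) ∷ []) ([] , [])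
            (λ q _ → let open At q in contradictory ⟦ rel a s ⟧
              (⊑-trans (·-lower₂ _ _) (·-lower₁ _ _))
              (⊑-trans (·-lower₂ _ _) (⊑-trans (·-lower₂ _ _) (⊑-trans (·-lower₁ _ _) (⊑-reflexive (⟦neg⟧ q a s))))))
            λ { (here refl) → T ; (there (here refl)) → T⁻ }
      ; T-c = λ {i} {a} {s} {t} agree → entails (rel a s) (rel (c i a) t) (i ∷ []) λ q p≼q → let open At q in
          let i∈ = ∈-indexSet p≼q (here refl) in
          ⊑-trans (subs-c Γ Γ-unique i∈ (λ _ → ε-≢ i∈) (λ _ → ε-≢ i∈) (λ j j≢i → cong ε (agree j j≢i)) (g a))
            (⊑-reflexive˘ (subs-cong Γ (g-c i∈ a)))
      ; T-wit = λ {i} {a} {s} → entails₁ (rel (c i a) s) (rel a (witness i a s)) ([] , wit i a s ∷ []) λ q _ →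
          unshunt (⊑-trans (·-lower₂ _ _) (·-lower₁ _ _))
      ; T-d = λ {i} {j} {s} → entails (eq (s i) (s j)) (rel (d i j) s) (i ∷ j ∷ []) λ q p≼q →
          ⊑-reflexive˘ (⟦d⟧ q s (∈-indexSet p≼q (here refl)) (∈-indexSet p≼q (there (here refl))))
      ; T-d⁻ = λ {i} {j} {s} → entails (rel (d i j) s) (eq (s i) (s j)) (i ∷ j ∷ []) λ q p≼q →
          ⊑-reflexive (⟦d⟧ q s (∈-indexSet p≼q (here refl)) (∈-indexSet p≼q (there (here refl))))
      ; T-refl = λ {u} → ≡true-stable λ ¬T → forbids ((eq u u , false) ∷ []) ([] , [])
          (λ q _ → let open At q in contradictory (d (ε u) (ε u))
            (⊑-trans (⊑1 _) (⊑-reflexive˘ (d-refl _))) (⊑-trans (·-lower₂ _ _) (·-lower₁ _ _)))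
          λ { (here refl) → ¬-not ¬T }
      ; T-sym = λ {u} {w} → entails (eq u w) (eq w u) [] λ q _ → ⊑-reflexive (d-symmetric _ _)
      ; T-trans = λ {u} {w} {z} → entails₂ (eq u w) (eq w z) (eq u z) ([] , []) λ q _ → d-trans _ _ _
      ; T-replace = λ {i} {a} {s} {t} Te agree Ta →
          entails₂ (eq (s i) (t i)) (rel a s) (rel a t) ([] , []) (λ q _ → let open At q in
            subs-replace Γ Γ-unique (λ j → ε-off (s j)) (λ j → ε-off (t j)) (λ j j≢i → cong ε (agree j j≢i)) (g a))
            Te Ta }
      where
      ⟦neg⟧ : ∀ q a s → At.⟦_⟧ q (rel (- a) s) ≈ - At.⟦_⟧ q (rel a s)
      ⟦neg⟧ q a s = let open At q in
        ≈-trans (subs-cong Γ (g-neg a)) (subs-neg Γ (λ j → ε-off (s j)) (g a))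
      ⟦d⟧ : ∀ q {i j} s → i ∈ˡ indexSet q → j ∈ˡ indexSet q → At.⟦_⟧ q (rel (d i j) s) ≈ d (At.ε q (s i)) (At.ε q (s j))
      ⟦d⟧ q s i∈ j∈ = let open At q in
        ≈-trans (subs-cong Γ (g-d i∈ j∈)) (subs-d Γ Γ-unique (λ j → ε-off (s j)) i∈ j∈)

-- Representation by one cube for each nonzero element

module EdcRepresentable {ℓ} (em : ExcludedMiddle ℓ) (ac : AxiomOfChoice ℓ) {I : Set ℓ} (_≟_ : DecidableEquality I) (infinite : Infinite I) {A : Algebra I ℓ ℓ} (isCA : IsCylindricAlgebra A) (edc : EndoDimensionComplemented isCA) where
  open Classical em
  open Cubes em _≟_
  open Algebra A hiding (_≤_)
  open CylindricArithmetic _≟_ isCA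
  open Representation em ac _≟_ isCA edc
  open SetAlgebras em _≟_ infinite using (module ToCubes)

  NonZero : Set ℓ
  NonZero = Σ Carrier λ x → ¬ (x ≈ 0#)

  abstract
    model : ((x , _) : NonZero) → Model x
    model (x , x≉0) = Construction.theModel x≉0

  module _ (k : NonZero) where
    open Model (model k)

    Equal : Rel Const ℓ
    Equal u w = Lift ℓ (True (eq u w))

    Equal-isEquivalence : IsEquivalence Equal
    Equal-isEquivalence = record
      { refl = lift T-refl
      ; sym = λ (lift e) → lift (T-sym e)
      ; trans = λ (lift e) (lift e′) → lift (T-trans e e′) }

    private
      discrete quotient : Setoid ℓ ℓ
      discrete = record
        { Carrier = Const ; _≈_ = _≡_ ; isEquivalence = record { refl = refl ; sym = sym ; trans = trans } }
      quotient = record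
        { Carrier = Const ; _≈_ = Equal ; isEquivalence = Equal-isEquivalence }

      projection : Surjection discrete quotient
      projection = record
        { to = id
        ; cong = λ { refl → lift T-refl }
        ; surjective = λ u → u , λ { refl → lift T-refl } }

      rep : Const → Const
      rep = Func.to (proj₁ (ac projection))

    -- Relations respect Equal in finitely many coordinates only, so a sequence
    -- of classes is read through representatives; making them depend on the
    -- coordinate j lets var itself be a sequence of representatives.
    coord : I → Const → Const
    coord j u = if ⌊ Equal u (var j) ⌋ then var j else rep u

    coord-Equal : ∀ j u → Equal (coord j u) u
    coord-Equal j u with em {Equal u (var j)}
    ... | yes (lift e) = lift (T-sym e)
    ... | no _ = proj₂ (ac projection) u

    coord-cong : ∀ j {u w} → Equal u w → coord j u ≡ coord j w
    coord-cong j {u} {w} (lift u≈w) with em {Equal u (var j)} | em {Equal w (var j)}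
    ... | yes _ | yes _ = refl
    ... | yes (lift e) | no ¬e = contradiction (lift (T-trans (T-sym u≈w) e)) ¬e
    ... | no ¬e | yes (lift e) = contradiction (lift (T-trans u≈w e)) ¬e
    ... | no _ | no _ = Func.cong (proj₁ (ac projection)) (lift u≈w)

    coord-var : ∀ j → coord j (var j) ≡ var j
    coord-var j with em {Equal (var j) (var j)}
    ... | yes _ = refl
    ... | no ¬e = contradiction (lift T-refl) ¬e

    Holds : Carrier → (I → Const) → Set
    Holds a s = True (rel a (λ j → coord j (s j)))

    Holds-resp : ∀ {a s t} → (∀ j → Equal (s j) (t j)) → Holds a s → Holds a t
    Holds-resp s≈t = T-agree λ j → coord-cong j (s≈t j)

    -- The witness belongs to the sequence `r` of representatives. Passing from it to its own
    -- representative alters one coordinate only, so `T-replace` suffices.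
    Holds-c : ∀ {a i s} → Holds (c i a) s → Σ Const λ w → Holds a (update s i w)
    Holds-c {a} {i} {s} h = u , T-replace {i}
        (subst (λ w → True (eq w (coord i (update s i u i)))) (sym (update-same r i))
          (subst (λ w → True (eq u (coord i w))) (sym (update-same s i)) (T-sym (lower (coord-Equal i u)))))
        (λ j j≢i → trans (update-other r j≢i) (cong (coord j) (sym (update-other s j≢i))))
        (T-wit h)
      where
      r : I → Const
      r j = coord j (s j)
      u : Const
      u = wit i a r

    Holds-c⁻ : ∀ {a i s w} → Holds a (update s i w) → Holds (c i a) s
    Holds-c⁻ {s = s} = T-c λ j j≢i → cong (coord j) (update-other s j≢i)

    Holds-d : ∀ {i j s} → Equal (s i) (s j) → Holds (d i j) s
    Holds-d {i} {j} {s} (lift e) =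
      T-d (T-trans (lower (coord-Equal i (s i))) (T-trans e (T-sym (lower (coord-Equal j (s j))))))

    Holds-d⁻ : ∀ {i j s} → Holds (d i j) s → Equal (s i) (s j)
    Holds-d⁻ {i} {j} {s} h =
      lift (T-trans (T-sym (lower (coord-Equal i (s i)))) (T-trans (T-d⁻ h) (lower (coord-Equal j (s j)))))

  open ToCubes Equal Equal-isEquivalence
  open CubeAlgebra NonZero part

  represent : Carrier → Region
  represent a = record
    { at = λ k s → Model.v (model k) (rel a (λ j → coord k j (s j)))
    ; resp = λ k → Holds-resp k }

  representation : Homomorphism A 𝔹
  representation = record
    { to = represent
    ; cong = λ {a} {b} a≈b → ext {represent a} {represent b}
        (λ k s → Model.T-cong (model k) a≈b) (λ k s → Model.T-cong (model k) (≈-sym a≈b))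
    ; +-homo = λ a b → ext {represent (a + b)} {represent a ∪ represent b}
        (λ k s s∈ → case em {Lift ℓ (represent a ∋ k , s)} of λ
          { (yes (lift s∈a)) → ∨-trueˡ s∈a
          ; (no s∉a) → ∨-trueʳ {at (represent a) k s}
              (Model.T-+⁻ (model k) s∈ (Model.T-neg (model k) (s∉a ∘ lift))) })
        (λ k s s∈ → [ Model.T-+ˡ (model k) , Model.T-+ʳ (model k) ]′ (∨-true⁻ {at (represent a) k s} s∈))
    ; -‿homo = λ a → ext {represent (- a)} {∁ (represent a)}
        (λ k s s∈ → not-true (Model.T-neg⁻ (model k) s∈))
        (λ k s s∈ → Model.T-neg (model k) (not-true⁻ s∈))
    ; c-homo = λ i a → ext {represent (c i a)} {cyl i (represent a)}
        (λ k s s∈ → ⌊⌋-complete (Holds-c k {a} {i} {s} s∈))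
        (λ k s s∈ → Holds-c⁻ k (proj₂ (⌊⌋-sound s∈)))
    ; d-homo = λ i j → ext {represent (d i j)} {diag i j}
        (λ k s s∈ → ⌊⌋-complete (Holds-d⁻ k s∈))
        (λ k s s∈ → Holds-d k (⌊⌋-sound s∈)) }

  -- If `a · - b` were nonzero, then in the cube belonging to it the sequence `var` would satisfy
  -- `a` but not `b`.
  separated : ∀ {a b} → represent a ≈ᴿ represent b → a ⊑ b
  separated {a} {b} e = by-cases b (·-lower₂ _ _) (⊑-trans (⊑-reflexive (byContradiction difference)) (0⊑ b))
    where
    difference : ¬ ¬ (a · - b ≈ 0#)
    difference nz = b∉ (trans (sym (e k var)) a∈)
      where
      k : NonZero
      k = a · - b , nz
      open Model (model k)
      holds : Holds k (a · - b) var
      holds = T-agree (λ j → sym (coord-var k j)) T-base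
      a∈ : Holds k a var
      a∈ = ≡true-stable λ a∉ → T-neg⁻ holds (T-+ˡ (T-neg a∉))
      b∉ : ¬ Holds k b var
      b∉ b∈ = T-neg⁻ holds (T-+ʳ (T-neg λ -b∈ → T-neg⁻ -b∈ b∈))

  A↪𝔽 : A ↪ fullSetAlgebra _≟_ U V
  A↪𝔽 = Embeddings.↪-trans {A = A} {B = 𝔹} {C = fullSetAlgebra _≟_ U V}
    (representation , λ e → ⊑-antisym (separated e) (separated λ k s → sym (e k s))) 𝔹↪𝔽

-- A flip-invariant algebra of tame regions

module Counterexample {ℓ} (em : ExcludedMiddle ℓ) {I : Set ℓ} (_<ᴵ_ : Rel I ℓ) (isSTO : IsStrictTotalOrder _≡_ _<ᴵ_) (infinite : Infinite I) where
  open IsStrictTotalOrder isSTO using (_≟_; compare; irrefl; asym)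
  open Classical em
  open Cubes em _≟_
  open InfiniteSets em _≟_ infinite
  open SetAlgebras em _≟_ infinite using (module ToCubes)

  -- `i₀` and `i₁` hold the points to be compared; `i₂` is the scratch coordinate for interchanging
  -- them by substitutions.
  i₀ i₁ i₂ : I
  i₀ = fresh []
  i₁ = fresh (i₀ ∷ [])
  i₂ = fresh (i₁ ∷ i₀ ∷ [])

  i₁≢i₀ : i₁ ≢ i₀
  i₁≢i₀ e = fresh-∉ (i₀ ∷ []) (here e)

  i₂≢i₀ : i₂ ≢ i₀
  i₂≢i₀ e = fresh-∉ (i₁ ∷ i₀ ∷ []) (there (here e))

  i₂≢i₁ : i₂ ≢ i₁
  i₂≢i₁ e = fresh-∉ (i₁ ∷ i₀ ∷ []) (here e)

  Γ : List I
  Γ = i₀ ∷ i₁ ∷ i₂ ∷ []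

  ≢-i₀ : ∀ {j} → j ∉ˡ Γ → j ≢ i₀
  ≢-i₀ j∉ e = j∉ (here e)

  ≢-i₁ : ∀ {j} → j ∉ˡ Γ → j ≢ i₁
  ≢-i₁ j∉ e = j∉ (there (here e))

  Base : Set ℓ
  Base = I × Bool

  block : Base → I
  block = proj₁

  flip : I → Base → Base
  flip m (i , b) = i , (if does (i ≟ m) then not b else b)

  flip-involutive : ∀ m u → flip m (flip m u) ≡ u
  flip-involutive m (i , b) with i ≟ m
  ... | yes _ = cong (i ,_) (not-involutive b)
  ... | no _ = refl

  flip-fixes : ∀ m u → block u ≢ m → flip m u ≡ u
  flip-fixes m (i , b) i≢m with i ≟ m
  ... | yes i≡m = contradiction i≡m i≢m
  ... | no _ = refl

  flip-swaps : ∀ m b → flip m (m , b) ≡ (m , not b)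
  flip-swaps m b with m ≟ m
  ... | yes _ = refl
  ... | no m≢m = contradiction refl m≢m

  flip-injective : ∀ m {u w} → flip m u ≡ flip m w → u ≡ w
  flip-injective m {u} {w} e =
    trans (sym (flip-involutive m u)) (trans (cong (flip m) e) (flip-involutive m w))

  open ToCubes {K = Lift ℓ ⊤} {C = Base} (λ _ → _≡_) (λ _ → ≡-isEquivalence) public
  open CubeAlgebra (Lift ℓ ⊤) part

  private module 𝔹 = Algebra 𝔹

  Sequence : Set ℓ
  Sequence = I → Base

  infix 4 _∈ʳ_
  _∈ʳ_ : Sequence → Region → Set
  s ∈ʳ X = X ∋ lift tt , s

  ∈ʳ-resp : ∀ X {s t} → (∀ j → s j ≡ t j) → s ∈ʳ X → t ∈ʳ X
  ∈ʳ-resp X = resp X (lift tt)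

  -- Blocks with index in `Γ` are exempt, because `mark` fixes a point in each of them once and for
  -- all.
  Invariant : Region → Set ℓ
  Invariant X = ∀ m → m ∉ˡ Γ → ∀ s → s ∈ʳ X → flip m ∘ s ∈ʳ X

  Invariant⁻ : ∀ X → Invariant X → ∀ m → m ∉ˡ Γ → ∀ s → flip m ∘ s ∈ʳ X → s ∈ʳ X
  Invariant⁻ X inv m m∉ s s∈ = ∈ʳ-resp X (λ j → flip-involutive m (s j)) (inv m m∉ _ s∈)

  Pinned : Sequence → Set ℓ
  Pinned s = ∀ j → j ∉ˡ Γ → block (s j) ≡ j

  -- Finitely many exceptions are allowed so that the notion survives changing one coordinate;
  -- otherwise tameness would not pass to cylindrifications.
  AlmostPinned : Sequence → Set ℓ
  AlmostPinned s = Σ (List I) λ Δ → ∀ j → j ∉ˡ Δ → block (s j) ≡ j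

  AlmostPinned-mod : ∀ {s t} i → (∀ j → j ≢ i → s j ≡ t j) → AlmostPinned s → AlmostPinned t
  AlmostPinned-mod i s≡t (Δ , pin) = i ∷ Δ , λ j j∉ →
    trans (cong block (sym (s≡t j (j∉ ∘ here)))) (pin j (j∉ ∘ there))

  AlmostPinned-update⁻ : ∀ {s} i w → AlmostPinned (update s i w) → AlmostPinned s
  AlmostPinned-update⁻ {s} i w = AlmostPinned-mod i λ j j≢i → update-other s j≢i

  Supports : List I → Region → Set ℓ
  Supports Δ X = ∀ {s t} → ¬ AlmostPinned s → ¬ AlmostPinned t → (∀ {j} → j ∈ˡ Δ → s j ≡ t j) → s ∈ʳ X → t ∈ʳ X

  Tame : Region → Set ℓ
  Tame X = Σ (List I) λ Δ → Supports Δ X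

  Supports-c : ∀ j X Δ → Supports Δ X → Supports Δ (cyl j X)
  Supports-c j X Δ sup {s} {t} ¬s ¬t s≡t s∈ =
    let w , w∈ = cyl-∋⁻ {j} {X} s∈
    in cyl-∋ {j} {X} w (sup (¬s ∘ AlmostPinned-update⁻ j w) (¬t ∘ AlmostPinned-update⁻ j w)
         (λ {i} i∈ → agree i i∈) w∈)
    where
    agree : ∀ {w} i → i ∈ˡ Δ → update s j w i ≡ update t j w i
    agree i i∈ with i ≟ j
    ... | yes _ = refl
    ... | no _ = s≡t i∈

  Invariant-c : ∀ j X → Invariant X → Invariant (cyl j X)
  Invariant-c j X inv m m∉ s s∈ =
    let w , w∈ = cyl-∋⁻ {j} {X} s∈
    in cyl-∋ {j} {X} (flip m w) (∈ʳ-resp X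
         (λ i → flip-update w i) (inv m m∉ _ w∈))
    where
    flip-update : ∀ w i → flip m (update s j w i) ≡ update (flip m ∘ s) j (flip m w) i
    flip-update w i with i ≟ j
    ... | yes _ = refl
    ... | no _ = refl

  tameRegions : Subuniverse 𝔹 ℓ
  tameRegions = record
    { P = λ X → Invariant X × Tame X
    ; resp = λ X≈Y (inv , Δ , sup) →
        (λ m m∉ s s∈ → trans (sym (X≈Y _ _)) (inv m m∉ s (trans (X≈Y _ _) s∈))) ,
        Δ , λ ¬s ¬t s≡t s∈ → trans (sym (X≈Y _ _)) (sup ¬s ¬t s≡t (trans (X≈Y _ _) s∈))
    ; +-closed = λ {X} {Y} (inv , Δ , sup) (inv′ , Δ′ , sup′) →
        (λ m m∉ s s∈ → [ (λ s∈X → ∨-trueˡ (inv m m∉ s s∈X))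
                       , (λ s∈Y → ∨-trueʳ {at X _ (flip m ∘ s)} (inv′ m m∉ s s∈Y)) ]′ (∨-true⁻ {at X _ s} s∈)) ,
        (Δ ++ Δ′) , λ {s} {t} ¬s ¬t s≡t s∈ →
          [ (λ s∈X → ∨-trueˡ (sup ¬s ¬t (s≡t ∘ ∈-++⁺ˡ) s∈X))
          , (λ s∈Y → ∨-trueʳ {at X _ t} (sup′ ¬s ¬t (s≡t ∘ ∈-++⁺ʳ Δ) s∈Y)) ]′ (∨-true⁻ {at X _ s} s∈)
    ; -‿closed = λ {X} (inv , Δ , sup) →
        (λ m m∉ s s∉ → not-true λ s∈ → not-true⁻ s∉ (Invariant⁻ X inv m m∉ s s∈)) ,
        Δ , λ ¬s ¬t s≡t s∉ → not-true λ t∈ → not-true⁻ s∉ (sup ¬t ¬s (sym ∘ s≡t) t∈)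
    ; c-closed = λ j {X} (inv , Δ , sup) → Invariant-c j X inv , Δ , Supports-c j X Δ sup
    ; d-closed = λ i j →
        (λ m _ s s∈ → ⌊⌋-complete (cong (flip m) (⌊⌋-sound s∈))) ,
        i ∷ j ∷ [] , λ ¬s ¬t s≡t s∈ → ⌊⌋-complete
          (trans (sym (s≡t (here refl))) (trans (⌊⌋-sound s∈) (s≡t (there (here refl))))) }

  𝔸 : Algebra I ℓ ℓ
  𝔸 = subalgebra 𝔹 tameRegions

  private module 𝔸 = Algebra 𝔸

  𝔸↪𝔽 : 𝔸 ↪ fullSetAlgebra _≟_ U V
  𝔸↪𝔽 = Embeddings.↪-trans {A = 𝔸} {B = 𝔹} {C = fullSetAlgebra _≟_ U V}
    (Embeddings.subalgebra-↪ {A = 𝔹} tameRegions) 𝔹↪𝔽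

  -- The tournament and its description in the reduct

  mark : Sequence → I → Base
  mark s i with em {i ∈ˡ Γ}
  ... | yes _ = i , true
  ... | no _ = s i

  mark-block : ∀ {s} → Pinned s → ∀ i → block (mark s i) ≡ i
  mark-block pin i with em {i ∈ˡ Γ}
  ... | yes _ = refl
  ... | no i∉ = pin i i∉

  mark-flip : ∀ m → m ∉ˡ Γ → ∀ s i → mark (flip m ∘ s) i ≡ flip m (mark s i)
  mark-flip m m∉ s i with em {i ∈ˡ Γ}
  ... | yes i∈ = sym (flip-fixes m (i , true) λ { refl → m∉ i∈ })
  ... | no _ = refl

  mark-agree : ∀ {s t} → (∀ j → j ∉ˡ Γ → s j ≡ t j) → ∀ i → mark s i ≡ mark t i
  mark-agree s≡t i with em {i ∈ˡ Γ}
  ... | yes _ = refl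
  ... | no i∉ = s≡t i i∉

  -- Ties inside the block of i are broken by s i, so an element invariant under
  -- flips can define this tournament only if it pins every block.
  Less : Sequence → Base → Base → Set ℓ
  Less s u w = block u <ᴵ block w ⊎ (block u ≡ block w × u ≢ w × u ≡ mark s (block u))

  Less-asym : ∀ {s u w} → Less s u w → ¬ Less s w u
  Less-asym (inj₁ u<w) (inj₁ w<u) = asym u<w w<u
  Less-asym (inj₁ u<w) (inj₂ (e , _)) = irrefl (sym e) u<w
  Less-asym (inj₂ (e , _)) (inj₁ w<u) = irrefl (sym e) w<u
  Less-asym {s} (inj₂ (e , u≢w , u≡)) (inj₂ (_ , _ , w≡)) =
    u≢w (trans u≡ (trans (cong (mark s) e) (sym w≡)))

  same-block : ∀ {u w z : Base} → block u ≡ block w → block z ≡ block u → u ≢ w → u ≡ z ⊎ w ≡ z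
  same-block {_ , true}  {_ , true}  refl refl u≢w = contradiction refl u≢w
  same-block {_ , false} {_ , false} refl refl u≢w = contradiction refl u≢w
  same-block {_ , true}  {_ , false} {_ , true}  refl refl _ = inj₁ refl
  same-block {_ , true}  {_ , false} {_ , false} refl refl _ = inj₂ refl
  same-block {_ , false} {_ , true}  {_ , true}  refl refl _ = inj₂ refl
  same-block {_ , false} {_ , true}  {_ , false} refl refl _ = inj₁ refl

  Less-total : ∀ {s} → Pinned s → ∀ u w → u ≢ w → Less s u w ⊎ Less s w u
  Less-total {s} pin u w u≢w with compare (block u) (block w)
  ... | tri< u<w _ _ = inj₁ (inj₁ u<w)
  ... | tri> _ _ w<u = inj₂ (inj₁ w<u)
  ... | tri≈ _ e _ with same-block {u} {w} e (mark-block pin (block u)) u≢w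
  ...   | inj₁ u≡ = inj₁ (inj₂ (e , u≢w , u≡))
  ...   | inj₂ w≡ = inj₂ (inj₂ (sym e , u≢w ∘ sym , trans w≡ (cong (mark s) e)))

  Less-agree : ∀ {s t u w} → (∀ j → j ∉ˡ Γ → s j ≡ t j) → Less s u w → Less t u w
  Less-agree s≡t (inj₁ u<w) = inj₁ u<w
  Less-agree s≡t (inj₂ (e , u≢w , u≡)) = inj₂ (e , u≢w , trans u≡ (mark-agree s≡t _))

  Less-flip : ∀ m → m ∉ˡ Γ → ∀ {s u w} → Less s u w → Less (flip m ∘ s) (flip m u) (flip m w)
  Less-flip m m∉ (inj₁ u<w) = inj₁ u<w
  Less-flip m m∉ {s} {u} (inj₂ (e , u≢w , u≡)) =
    inj₂ (e , u≢w ∘ flip-injective m , trans (cong (flip m) u≡) (sym (mark-flip m m∉ s (block u))))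

  Pinned-agree : ∀ {s t} → (∀ j → j ∉ˡ Γ → s j ≡ t j) → Pinned s → Pinned t
  Pinned-agree s≡t pin j j∉ = trans (cong block (sym (s≡t j j∉))) (pin j j∉)

  pinned : Region
  pinned = record
    { at = λ _ s → ⌊ Pinned s ⌋
    ; resp = λ _ s≡t s∈ → ⌊⌋-complete (Pinned-agree (λ j _ → s≡t j) (⌊⌋-sound s∈)) }

  ordered : Region
  ordered = record
    { at = λ _ s → ⌊ Pinned s × Less s (s i₀) (s i₁) ⌋
    ; resp = λ { _ {s} {t} s≡t s∈ → let pin , less = ⌊⌋-sound s∈ in ⌊⌋-complete
        ( Pinned-agree (λ j _ → s≡t j) pin
        , subst₂ (Less t) (s≡t i₀) (s≡t i₁) (Less-agree (λ j _ → s≡t j) less) ) } }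

  Supports-pinned : ∀ X → (∀ {s} → s ∈ʳ X → Pinned s) → Supports [] X
  Supports-pinned X pin ¬s _ _ s∈ = contradiction (Γ , pin s∈) ¬s

  -- All members of both regions are pinned, so off the almost pinned sequences both are empty and
  -- the empty support serves.
  e x : 𝔸.Carrier
  e = pinned , (λ m m∉ s s∈ → ⌊⌋-complete {P = Pinned (flip m ∘ s)} (⌊⌋-sound s∈)) , [] ,
    λ {s} {t} → Supports-pinned pinned ⌊⌋-sound {s} {t}
  x = ordered ,
    (λ m m∉ s s∈ → let pin , less = ⌊⌋-sound s∈ in ⌊⌋-complete (pin , Less-flip m m∉ less)) , [] ,
    λ {s} {t} → Supports-pinned ordered (proj₁ ∘ ⌊⌋-sound) {s} {t}

  subst-𝔸 : I → I → 𝔸.Carrier → 𝔸.Carrier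
  subst-𝔸 i j X = 𝔸.c i (𝔸.d i j 𝔸.· X)

  -- Interchanges i₀ and i₁ only on elements independent of i₂.
  transpose : 𝔸.Carrier → 𝔸.Carrier
  transpose X = subst-𝔸 i₂ i₀ (subst-𝔸 i₀ i₁ (subst-𝔸 i₁ i₂ X))

  subst-∈ : ∀ {i j} → i ≢ j → ∀ X s → update s i (s j) ∈ʳ proj₁ X → s ∈ʳ proj₁ (subst-𝔸 i j X)
  subst-∈ {i} {j} i≢j X s s∈ = cyl-∋ {i} {diag i j 𝔹.· proj₁ X} (s j) (∧̂-true
    (⌊⌋-complete (trans (update-same s i) (sym (update-other s (i≢j ∘ sym))))) s∈)

  subst-∈⁻ : ∀ {i j} → i ≢ j → ∀ X s → s ∈ʳ proj₁ (subst-𝔸 i j X) → update s i (s j) ∈ʳ proj₁ X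
  subst-∈⁻ {i} {j} i≢j X s s∈ =
    let w , w∈ = cyl-∋⁻ {i} {diag i j 𝔹.· proj₁ X} s∈
        w∈d , w∈X = ∧̂-true⁻ {at (diag i j) _ (update s i w)} w∈
        w≡ = trans (sym (update-same s i)) (trans (⌊⌋-sound w∈d) (update-other s (i≢j ∘ sym)))
    in subst (λ v → update s i v ∈ʳ proj₁ X) w≡ w∈X

  swapped : Sequence → Sequence
  swapped s = update (update s i₀ (s i₁)) i₁ (s i₀)

  transposed : Sequence → Sequence
  transposed s = let s′ = update s i₂ (s i₀) ; s″ = update s′ i₀ (s′ i₁) in update s″ i₁ (s″ i₂)

  transposed-swapped : ∀ s j → j ≢ i₂ → transposed s j ≡ swapped s j
  transposed-swapped s j j≢i₂ with j ≟ i₁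
  ... | yes _ = trans (update-other (update s i₂ (s i₀)) i₂≢i₀) (update-same s i₂)
  ... | no _ with j ≟ i₀
  ...   | yes _ = update-other s (i₂≢i₁ ∘ sym)
  ...   | no _ = update-other s j≢i₂

  transpose-∈ : ∀ X {s} → transposed s ∈ʳ proj₁ X → s ∈ʳ proj₁ (transpose X)
  transpose-∈ X s∈ = subst-∈ i₂≢i₀ (subst-𝔸 i₀ i₁ (subst-𝔸 i₁ i₂ X)) _
    (subst-∈ (i₁≢i₀ ∘ sym) (subst-𝔸 i₁ i₂ X) _ (subst-∈ (i₂≢i₁ ∘ sym) X _ s∈))

  transpose-∈⁻ : ∀ X {s} → s ∈ʳ proj₁ (transpose X) → transposed s ∈ʳ proj₁ X
  transpose-∈⁻ X s∈ = subst-∈⁻ (i₂≢i₁ ∘ sym) X _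
    (subst-∈⁻ (i₁≢i₀ ∘ sym) (subst-𝔸 i₁ i₂ X) _
      (subst-∈⁻ i₂≢i₀ (subst-𝔸 i₀ i₁ (subst-𝔸 i₁ i₂ X)) _ s∈))

  transposed-off : ∀ s j → j ∉ˡ Γ → s j ≡ transposed s j
  transposed-off s j j∉ = sym (trans (transposed-swapped s j (λ { refl → j∉ (there (there (here refl))) }))
    (trans (update-other (update s i₀ (s i₁)) (≢-i₁ j∉)) (update-other s (≢-i₀ j∉))))

  transposed-i₀ : ∀ s → transposed s i₀ ≡ s i₁
  transposed-i₀ s = trans (transposed-swapped s i₀ (i₂≢i₀ ∘ sym))
    (trans (update-other (update s i₀ (s i₁)) (i₁≢i₀ ∘ sym)) (update-same s i₀))

  transposed-i₁ : ∀ s → transposed s i₁ ≡ s i₀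
  transposed-i₁ s = trans (transposed-swapped s i₁ (i₂≢i₁ ∘ sym)) (update-same (update s i₀ (s i₁)) i₁)

  -- Totality of the tournament, written with operations of the `Γ`-reduct so that `h` preserves it.
  e≤bound : e 𝔸.+ (x 𝔸.+ transpose x 𝔸.+ 𝔸.d i₀ i₁) 𝔸.≈ x 𝔸.+ transpose x 𝔸.+ 𝔸.d i₀ i₁
  e≤bound _ s = ⇒-∨≡ λ s∈ → let pin = ⌊⌋-sound s∈ in case em {s i₀ ≡ s i₁} of λ
    { (yes s₀≡s₁) → ∨-trueʳ {at (proj₁ (x 𝔸.+ transpose x)) _ s} (⌊⌋-complete s₀≡s₁)
    ; (no s₀≢s₁) → ∨-trueˡ (case Less-total pin (s i₀) (s i₁) s₀≢s₁ of λ
        { (inj₁ less) → ∨-trueˡ (⌊⌋-complete (pin , less))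
        ; (inj₂ less) → ∨-trueʳ {at ordered _ s} (transpose-∈ x (⌊⌋-complete
            ( Pinned-agree (transposed-off s) pin
            , subst₂ (Less (transposed s)) (sym (transposed-i₀ s)) (sym (transposed-i₁ s))
                (Less-agree (transposed-off s) less)))) }) }

  -- Asymmetry, for the same purpose. Zero is not an operation of the signature, so it appears as
  -- `x · - x`, whose image under `h` is again of this form.
  x-asym : x 𝔸.· transpose x 𝔸.≈ x 𝔸.· (𝔸.- x)
  x-asym = ext {proj₁ (x 𝔸.· transpose x)} {proj₁ (x 𝔸.· (𝔸.- x))}
    (λ _ s s∈ →
      let s∈x , s∈tx = ∧̂-true⁻ {at ordered _ s} s∈
          pin , less = ⌊⌋-sound s∈x
          _ , less′ = ⌊⌋-sound (transpose-∈⁻ x s∈tx)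
      in ⊥-elim (Less-asym less (Less-agree (λ j j∉ → sym (transposed-off s j j∉))
           (subst₂ (Less (transposed s)) (transposed-i₀ s) (transposed-i₁ s) less′))))
    (λ _ s s∈ → let s∈x , s∉x = ∧̂-true⁻ {at ordered _ s} s∈ in contradiction s∈x (not-true⁻ s∉x))

  e-c : ∀ i → i ∈ˡ Γ → 𝔸.c i e 𝔸.≈ e
  e-c i i∈ = ext {cyl i pinned} {pinned}
    (λ _ s s∈ → let w , w∈ = cyl-∋⁻ {i} {pinned} s∈ in ⌊⌋-complete
      (Pinned-agree (λ j j∉ → update-other s λ { refl → j∉ i∈ }) (⌊⌋-sound w∈)))
    (λ _ s → ∋-cyl pinned)

  x-c₂ : 𝔸.c i₂ x 𝔸.≈ x
  x-c₂ = ext {cyl i₂ ordered} {ordered}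
    (λ _ s s∈ →
      let w , w∈ = cyl-∋⁻ {i₂} {ordered} s∈
          pin , less = ⌊⌋-sound w∈
          agree : ∀ j → j ∉ˡ Γ → update s i₂ w j ≡ s j
          agree j j∉ = update-other s λ { refl → j∉ (there (there (here refl))) }
      in ⌊⌋-complete
        ( Pinned-agree agree pin
        , subst₂ (Less s) (update-other s (i₂≢i₀ ∘ sym)) (update-other s (i₂≢i₁ ∘ sym)) (Less-agree agree less)))
    (λ _ s → ∋-cyl ordered)

  -- Unpinned blocks and indistinguishable pairs

  Independent : I → Region → Set ℓ
  Independent i X = ∀ s w → s ∈ʳ X → update s i w ∈ʳ X

  c-Independent : ∀ {i} X → cyl i X ≈ᴿ X → Independent i X
  c-Independent {i} X cX≈X s w s∈ =
    trans (sym (cX≈X _ _)) (cyl-update {i} X w (∋-cyl {i} X s∈))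

  Independent-agree : ∀ {i j} X → Independent i X → Independent j X → ∀ {s t} →
                      (∀ k → k ≢ i → k ≢ j → s k ≡ t k) → s ∈ʳ X → t ∈ʳ X
  Independent-agree {i} {j} X ind-i ind-j {s} {t} s≡t s∈ =
    ∈ʳ-resp X agree (ind-j (update s i (t i)) (t j) (ind-i s (t i) s∈))
    where
    agree : ∀ k → update (update s i (t i)) j (t j) k ≡ t k
    agree k with k ≟ j
    ... | yes refl = refl
    ... | no k≢j with k ≟ i
    ...   | yes refl = refl
    ...   | no k≢i = s≡t k k≢i k≢j

  -- `β` makes `φ` injective; with `κ` as an additional value, `D` would receive an injection from a
  -- set with one more element.
  no-injection-missing : ∀ {D κ} → Unique D → κ ∈ˡ D → (φ : ∀ {m} → m ∈ˡ D → I) → (∀ {m} (m∈ : m ∈ˡ D) → φ m∈ ∈ˡ D) →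
                         (∀ {m} (m∈ : m ∈ˡ D) → φ m∈ ≢ κ) → (β : I → I) → (∀ {m} (m∈ : m ∈ˡ D) → β (φ m∈) ≡ m) → ⊥
  no-injection-missing {D} {κ} D-unique κ∈D φ φ∈D φ≢κ β βφ = 1+n≰n (injective⇒≤ {f = g} g-injective)
    where
    member : ∀ i → lookup D i ∈ˡ D
    member i = ∈-lookup {xs = D} i

    g : Fin (suc (length D)) → Fin (length D)
    g zero = Any.index κ∈D
    g (suc i) = Any.index (φ∈D (member i))

    lookup-φ : ∀ i → φ (member i) ≡ lookup D (g (suc i))
    lookup-φ i = lookup-index (φ∈D (member i))

    missed : ∀ i → g zero ≢ g (suc i)
    missed i e = φ≢κ (member i) (trans (lookup-φ i) (trans (cong (lookup D) (sym e)) (sym (lookup-index κ∈D))))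

    g-injective : ∀ {i j} → g i ≡ g j → i ≡ j
    g-injective {zero} {zero} _ = refl
    g-injective {zero} {suc j} e = contradiction e (missed j)
    g-injective {suc i} {zero} e = contradiction (sym e) (missed i)
    g-injective {suc i} {suc j} e = cong suc (lookup-injective D-unique i j
      (trans (sym (βφ (member i))) (trans (cong β (trans (lookup-φ i) (trans (cong (lookup D) e) (sym (lookup-φ j))))) (βφ (member j)))))

  Unpinned : I → I → Sequence → Set ℓ
  Unpinned κ m s = m ∉ˡ Γ × (∀ j → j ∉ˡ Γ → j ≢ κ → block (s j) ≢ m)

  -- Otherwise each block outside `Γ` is met at an index outside `Γ` other than `κ`. For a block in
  -- the finite set `D` that index is again in `D`, because `s` is pinned outside `Δ`. This would
  -- inject `D` into itself while missing `κ`.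
  unpinned : ∀ κ → κ ∉ˡ Γ → ∀ s → AlmostPinned s → Σ I λ m → Unpinned κ m s
  unpinned κ κ∉ s (Δ , pin) = byContradiction λ none →
    let pin-of : ∀ m → m ∉ˡ Γ → Σ I λ j → j ∉ˡ Γ × j ≢ κ × block (s j) ≡ m
        pin-of m m∉ = byContradiction λ none′ → none (m , m∉ , λ j j∉ j≢κ e → none′ (j , j∉ , j≢κ , e))
    in no-injection-missing {D} {κ} D-unique κ∈D
         (λ {m} m∈ → proj₁ (pin-of m (D-∉ m∈)))
         (λ {m} m∈ → let j , j∉ , _ , e = pin-of m (D-∉ m∈) in closed j m j∉ m∈ e)
         (λ {m} m∈ → proj₁ (proj₂ (proj₂ (pin-of m (D-∉ m∈)))))
         (block ∘ s)
         (λ {m} m∈ → proj₂ (proj₂ (proj₂ (pin-of m (D-∉ m∈)))))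
    where
    outside? : (j : I) → Dec (j ∉ˡ Γ)
    outside? j = em

    D : List I
    D = filter outside? (deduplicate _≟_ (κ ∷ Δ))

    D-unique : Unique D
    D-unique = filter⁺ outside? (deduplicate-! _≟_ (κ ∷ Δ))

    ∈D : ∀ {j} → j ∉ˡ Γ → j ∈ˡ κ ∷ Δ → j ∈ˡ D
    ∈D j∉ j∈ = ∈-filter⁺ outside? (∈-deduplicate⁺ _≟_ j∈) j∉

    κ∈D : κ ∈ˡ D
    κ∈D = ∈D κ∉ (here refl)

    D-∉ : ∀ {m} → m ∈ˡ D → m ∉ˡ Γ
    D-∉ m∈ = proj₂ (∈-filter⁻ outside? {xs = deduplicate _≟_ (κ ∷ Δ)} m∈)

    closed : ∀ j m → j ∉ˡ Γ → m ∈ˡ D → block (s j) ≡ m → j ∈ˡ D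
    closed j m j∉ m∈ e with em {j ∈ˡ Δ}
    ... | yes j∈Δ = ∈D j∉ (there j∈Δ)
    ... | no j∉Δ = subst (_∈ˡ D) (trans (sym e) (pin j j∉Δ)) m∈

  pair : Sequence → I → Bool → Sequence
  pair s m b = update (update s i₀ (m , b)) i₁ (m , not b)

  pair-off : ∀ s m b {j} → j ≢ i₀ → j ≢ i₁ → pair s m b j ≡ s j
  pair-off s m b j≢i₀ j≢i₁ = trans (update-other (update s i₀ (m , b)) j≢i₁) (update-other s j≢i₀)

  pair-i₀ : ∀ s m b → pair s m b i₀ ≡ (m , b)
  pair-i₀ s m b = trans (update-other (update s i₀ (m , b)) (i₁≢i₀ ∘ sym)) (update-same s i₀)

  pair-i₁ : ∀ s m b → pair s m b i₁ ≡ (m , not b)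
  pair-i₁ s m b = update-same (update s i₀ (m , b)) i₁

  flip-pair : ∀ s m b j → (j ≢ i₀ → j ≢ i₁ → block (s j) ≢ m) → flip m (pair s m b j) ≡ pair s m (not b) j
  flip-pair s m b j off = by-index (j ≟ i₁) (j ≟ i₀)
    where
    by-index : Dec (j ≡ i₁) → Dec (j ≡ i₀) → flip m (pair s m b j) ≡ pair s m (not b) j
    by-index (yes refl) _ = trans (cong (flip m) (pair-i₁ s m b)) (trans (flip-swaps m (not b)) (sym (pair-i₁ s m (not b))))
    by-index (no _) (yes refl) = trans (cong (flip m) (pair-i₀ s m b)) (trans (flip-swaps m b) (sym (pair-i₀ s m (not b))))
    by-index (no j≢i₁) (no j≢i₀) = trans (cong (flip m) (pair-off s m b j≢i₀ j≢i₁))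
      (trans (flip-fixes m (s j) (off j≢i₀ j≢i₁)) (sym (pair-off s m (not b) j≢i₀ j≢i₁)))

  pair-swapped : ∀ s m b j → swapped (pair s m b) j ≡ pair s m (not b) j
  pair-swapped s m b j = by-index (j ≟ i₁) (j ≟ i₀)
    where
    p : Sequence
    p = pair s m b
    by-index : Dec (j ≡ i₁) → Dec (j ≡ i₀) → swapped p j ≡ pair s m (not b) j
    by-index (yes refl) _ = trans (update-same (update p i₀ (p i₁)) i₁) (trans (pair-i₀ s m b)
      (trans (cong (m ,_) (sym (not-involutive b))) (sym (pair-i₁ s m (not b)))))
    by-index (no j≢i₁) (yes refl) = trans (update-other (update p i₀ (p i₁)) j≢i₁)
      (trans (update-same p i₀) (trans (pair-i₁ s m b) (sym (pair-i₀ s m (not b)))))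
    by-index (no j≢i₁) (no j≢i₀) = trans (update-other (update p i₀ (p i₁)) j≢i₁)
      (trans (update-other p j≢i₀) (trans (pair-off s m b j≢i₀ j≢i₁) (sym (pair-off s m (not b) j≢i₀ j≢i₁))))

  -- If s is almost pinned, the pigeonhole principle gives a block met by no s j
  -- with j ∉ Γ and j ≢ κ; otherwise almost every block is irrelevant to Z.
  -- Flipping such a block interchanges the two pairs.
  indistinguishable : ∀ (Z : 𝔸.Carrier) κ → κ ∉ˡ Γ → Independent i₂ (proj₁ Z) → Independent κ (proj₁ Z) → ∀ s →
    Σ I λ m → ∀ b → pair s m b ∈ʳ proj₁ Z → pair s m (not b) ∈ʳ proj₁ Z
  indistinguishable (Z , inv , Δ , sup) κ κ∉ ind₂ ind-κ s with em {AlmostPinned s}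
  ... | yes s-pinned =
    let m , m∉ , off = unpinned κ κ∉ s s-pinned
    -- The flip may still move the entries at `i₂` and `κ`, but `Z` is independent of both.
    in m , λ b p∈ → Independent-agree Z ind₂ ind-κ
         (λ j j≢i₂ j≢κ → flip-pair s m b j λ j≢i₀ j≢i₁ → off j
           (λ { (here e) → j≢i₀ e ; (there (here e)) → j≢i₁ e ; (there (there (here e))) → j≢i₂ e }) j≢κ)
         (inv m m∉ _ p∈)
  ... | no ¬s-pinned =
    let used = Γ ++ map (block ∘ s) Δ
        m = fresh used
        m∉ = fresh-∉ used
    in m , λ b p∈ → sup
         (λ flip-pinned → ¬s-pinned (unpair m b flip-pinned))
         (λ pair-pinned → ¬s-pinned (unpair m (not b) pair-pinned))
         (λ {j} j∈ → flip-pair s m b j λ _ _ e → m∉ (∈-++⁺ʳ Γ (subst (_∈ˡ map (block ∘ s) Δ) e (∈-map⁺ (block ∘ s) j∈))))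
         (inv m (m∉ ∘ ∈-++⁺ˡ) _ p∈)
    where
    unpair : ∀ m b → AlmostPinned (pair s m b) → AlmostPinned s
    unpair m b = AlmostPinned-update⁻ i₀ (m , b) ∘ AlmostPinned-update⁻ i₁ (m , not b)

  -- Endomorphisms with image independent of `κ` annihilate `e`

  module Collapse (κ : I) (κ∉ : κ ∉ˡ Γ) (h : Homomorphism (reduct 𝔸 (_∈ˡ Γ)) (reduct 𝔸 (_∈ˡ Γ))) (closed : ∀ X → 𝔸.c κ (Homomorphism.to h X) 𝔸.≈ Homomorphism.to h X) where
    private module H = Homomorphism h

    Y Z : Region
    Y = proj₁ (H.to e)
    Z = proj₁ (H.to x)

    κ-independent : ∀ X → Independent κ (proj₁ (H.to X))
    κ-independent X = c-Independent (proj₁ (H.to X)) (closed X)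

    Γ-independent : ∀ {i} → i ∈ˡ Γ → ∀ X → 𝔸.c i X 𝔸.≈ X → Independent i (proj₁ (H.to X))
    Γ-independent {i} i∈ X cX≈X = c-Independent (proj₁ (H.to X)) λ k s →
      trans (sym (H.c-homo (i , i∈) X k s)) (H.cong {𝔸.c i X} {X} cX≈X k s)

    ·-homo : ∀ X X′ → H.to (X 𝔸.· X′) 𝔸.≈ H.to X 𝔸.· H.to X′
    ·-homo X X′ k s = trans (H.-‿homo ((𝔸.- X) 𝔸.+ (𝔸.- X′)) k s) (cong not
      (trans (H.+-homo (𝔸.- X) (𝔸.- X′) k s) (cong₂ _∨_ (H.-‿homo X k s) (H.-‿homo X′ k s))))

    subst-homo : ∀ {i j} → i ∈ˡ Γ → j ∈ˡ Γ → ∀ X X′ → H.to X 𝔸.≈ X′ → H.to (subst-𝔸 i j X) 𝔸.≈ subst-𝔸 i j X′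
    subst-homo {i} {j} i∈ j∈ X X′ hX≈X′ k s = trans (H.c-homo (i , i∈) (𝔸.d i j 𝔸.· X) k s)
      (𝔸.c-cong i {H.to (𝔸.d i j 𝔸.· X)} {𝔸.d i j 𝔸.· X′} (λ k s → trans (·-homo (𝔸.d i j) X k s)
        (cong₂ _∧̂_ (H.d-homo (i , i∈) (j , j∈) k s) (hX≈X′ k s))) k s)

    transpose-homo : H.to (transpose x) 𝔸.≈ transpose (H.to x)
    transpose-homo = subst-homo ∈₂ ∈₀ (subst-𝔸 i₀ i₁ (subst-𝔸 i₁ i₂ x)) (subst-𝔸 i₀ i₁ (subst-𝔸 i₁ i₂ (H.to x)))
      (subst-homo ∈₀ ∈₁ (subst-𝔸 i₁ i₂ x) (subst-𝔸 i₁ i₂ (H.to x))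
        (subst-homo ∈₁ ∈₂ x (H.to x) λ _ _ → refl))
      where
      ∈₀ = here refl
      ∈₁ = there (here refl)
      ∈₂ = there (there (here refl))

    T : Region
    T = proj₁ (transpose (H.to x))

    H-join : ∀ X₁ X₂ X₃ {s} → e 𝔸.+ (X₁ 𝔸.+ X₂ 𝔸.+ X₃) 𝔸.≈ X₁ 𝔸.+ X₂ 𝔸.+ X₃ → s ∈ʳ Y →
             (s ∈ʳ proj₁ (H.to X₁) ⊎ s ∈ʳ proj₁ (H.to X₂)) ⊎ s ∈ʳ proj₁ (H.to X₃)
    H-join X₁ X₂ X₃ {s} e≤ s∈Y =
      [ (λ s∈₁₂ → inj₁ (∨-true⁻ (trans (sym (H.+-homo X₁ X₂ _ s)) s∈₁₂))) , inj₂ ]′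
        (∨-true⁻ (trans (sym (H.+-homo (X₁ 𝔸.+ X₂) X₃ _ s)) s∈hX))
      where
      s∈hX : s ∈ʳ proj₁ (H.to (X₁ 𝔸.+ X₂ 𝔸.+ X₃))
      s∈hX = trans (sym (H.cong {e 𝔸.+ (X₁ 𝔸.+ X₂ 𝔸.+ X₃)} {X₁ 𝔸.+ X₂ 𝔸.+ X₃} e≤ _ s))
        (trans (H.+-homo e (X₁ 𝔸.+ X₂ 𝔸.+ X₃) _ s) (∨-trueˡ s∈Y))

    H-disjoint : ∀ X X′ {s} → X 𝔸.· X′ 𝔸.≈ X 𝔸.· (𝔸.- X) → s ∈ʳ proj₁ (H.to X) → ¬ (s ∈ʳ proj₁ (H.to X′))
    H-disjoint X X′ {s} disj s∈X s∈X′ =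
      let s∈· = trans (sym (H.cong {X 𝔸.· X′} {X 𝔸.· (𝔸.- X)} disj _ s))
            (trans (·-homo X X′ _ s) (∧̂-true s∈X s∈X′))
          _ , s∉ = ∧̂-true⁻ {at (proj₁ (H.to X)) _ s} (trans (sym (·-homo X (𝔸.- X) _ s)) s∈·)
      in not-true⁻ (trans (sym (H.-‿homo X _ s)) s∉) s∈X

    below-bound : ∀ {s} → s ∈ʳ Y → s i₀ ≢ s i₁ → s ∈ʳ Z ⊎ s ∈ʳ T
    below-bound {s} s∈Y s₀≢s₁ =
      [ [ inj₁ , (λ s∈hT → inj₂ (trans (sym (transpose-homo _ s)) s∈hT)) ]′
      , (λ s∈d → contradiction
          (⌊⌋-sound (trans (sym (H.d-homo (i₀ , here refl) (i₁ , there (here refl)) _ s)) s∈d)) s₀≢s₁) ]′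
        (H-join x (transpose x) (𝔸.d i₀ i₁) {s} e≤bound s∈Y)

    disjoint : ∀ {s} → s ∈ʳ Z → ¬ (s ∈ʳ T)
    disjoint {s} s∈Z s∈T = H-disjoint x (transpose x) {s} x-asym s∈Z (trans (transpose-homo _ s) s∈T)

    Z-independent₂ : Independent i₂ Z
    Z-independent₂ = Γ-independent (there (there (here refl))) x x-c₂

    T⇒swapped : ∀ {s} → s ∈ʳ T → swapped s ∈ʳ Z
    T⇒swapped {s} s∈T = Independent-agree Z Z-independent₂ Z-independent₂
      (λ j j≢i₂ _ → transposed-swapped s j j≢i₂) (transpose-∈⁻ (H.to x) s∈T)

    swapped⇒T : ∀ {s} → swapped s ∈ʳ Z → s ∈ʳ T
    swapped⇒T {s} s∈ = transpose-∈ (H.to x) (Independent-agree Z Z-independent₂ Z-independent₂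
      (λ j j≢i₂ _ → sym (transposed-swapped s j j≢i₂)) s∈)

    -- The image of `e` is independent of `i₀` and `i₁`, so it contains both pairs built on the
    -- block `m`. Each pair lies in `Z` or has its swap in `Z`. As the pairs are swaps of each other
    -- and `Z` cannot tell them apart, both lie in `Z`, against asymmetry.
    empty : ∀ s → ¬ (s ∈ʳ Y)
    empty s s∈Y = disjoint (pair∈Z true) (swapped⇒T
      (∈ʳ-resp Z (λ j → sym (pair-swapped s m true j)) (pair∈Z false)))
      where
      indist : Σ I λ m → ∀ b → pair s m b ∈ʳ Z → pair s m (not b) ∈ʳ Z
      indist = indistinguishable (H.to x) κ κ∉ Z-independent₂ (κ-independent x) s

      m : I
      m = proj₁ indist

      pair∈Y : ∀ b → pair s m b ∈ʳ Y
      pair∈Y b = Γ-independent (there (here refl)) e (e-c i₁ (there (here refl))) _ _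
        (Γ-independent (here refl) e (e-c i₀ (here refl)) _ _ s∈Y)

      pair∈Z : ∀ b → pair s m b ∈ʳ Z
      pair∈Z b = [ id
                 , (λ p∈T → subst (λ b → pair s m b ∈ʳ Z) (not-involutive b)
                     (proj₂ indist (not b) (∈ʳ-resp Z (pair-swapped s m b) (T⇒swapped p∈T)))) ]′
        (below-bound (pair∈Y b) λ e → not-¬ refl (cong proj₂ (trans (sym (pair-i₀ s m b)) (trans e (pair-i₁ s m b)))))

  ¬edc : (isCA : IsCylindricAlgebra 𝔸) → ¬ EndoDimensionComplemented isCA
  ¬edc isCA edc =
    let κ , κ∉ , h , he≉0 , closed = edc Γ e e≉0
    in he≉0 λ k s → trans (¬-not (Collapse.empty κ κ∉ h closed s)) (sym (¬-not (zero-∉ s)))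
    where
    open IsCylindricAlgebra isCA

    -- `isCA` brings a `0#` of its own, which the complement law identifies with the empty region.
    zero-∉ : ∀ s → ¬ (s ∈ʳ proj₁ 0#)
    zero-∉ s s∈ =
      let s∈e , s∉e = ∧̂-true⁻ {at pinned _ s} (trans (IsBooleanAlgebra.∧-complementʳ isBooleanAlgebra e _ s) s∈)
      in not-true⁻ s∉e s∈e

    e≉0 : ¬ (e 𝔸.≈ 0#)
    e≉0 e≈0 = zero-∉ s (trans (sym (e≈0 _ s)) (⌊⌋-complete {P = Pinned s} λ _ _ → refl))
      where
      s : Sequence
      s j = j , true

-- Comparison of the classes

lowerExcludedMiddle : ∀ {ℓ} → ExcludedMiddle (lsuc ℓ) → ExcludedMiddle ℓ
lowerExcludedMiddle {ℓ} em {P} with em {Lift (lsuc ℓ) P}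
... | yes (lift p) = yes p
... | no ¬p = no (¬p ∘ lift)

module Classes {ℓ} (em : ExcludedMiddle ℓ) (ac : AxiomOfChoice ℓ) (α : Ordinal ℓ) (infinite : Infinite (Ordinal.Carrier α)) where
  open Ordinal α using (Carrier; _≟_; isStrictTotalOrder)
  open Embeddings {I = Carrier}
  open SetAlgebras em _≟_ infinite
  open Cubes em _≟_

  ↪⇒RCA : ∀ {A : AlgebraOf α} U V → IsDisjointUnionOfCubes _≟_ U V → A ↪ fullSetAlgebra _≟_ U V → A ∈ RCA α
  ↪⇒RCA {A} U V cubes h = U , V , cubes ,
    image {A = A} {B = fullSetAlgebra _≟_ U V} h , ≅-image {A = A} {B = fullSetAlgebra _≟_ U V} h

  ↪⇒𝐒 : ∀ {p} {K : Pred (AlgebraOf α) p} {A B : AlgebraOf α} → B ∈ K → A ↪ B → A ∈ 𝐒 K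
  ↪⇒𝐒 {A = A} {B} B∈K h = B , B∈K , image {A = A} {B = B} h , ≅-image {A = A} {B = B} h

  𝐒⇒↪ : ∀ {p} {K : Pred (AlgebraOf α) p} {A : AlgebraOf α} → A ∈ 𝐒 K → Σ (AlgebraOf α) λ B → B ∈ K × A ↪ B
  𝐒⇒↪ {A = A} (B , B∈K , S , A≅S) = B , B∈K ,
    ↪-trans {A = A} {B = subalgebra B S} {C = B} (≅⇒↪ {A = A} {B = subalgebra B S} A≅S) (subalgebra-↪ {A = B} S)

  Edc⊆𝐒Edc : ∀ {A} → A ∈ Edc α → A ∈ 𝐒 (Edc α)
  Edc⊆𝐒Edc {A} A∈Edc = ↪⇒𝐒 {K = Edc α} {A} {A} A∈Edc (↪-refl A)

  𝐒Edc⊆RCA : ∀ {A} → A ∈ 𝐒 (Edc α) → A ∈ RCA α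
  𝐒Edc⊆RCA {A} A∈𝐒 =
    let B , (isCA , edc) , A↪B = 𝐒⇒↪ {K = Edc α} {A} A∈𝐒
        open EdcRepresentable em ac _≟_ infinite isCA edc using (Equal; Equal-isEquivalence; A↪𝔽)
        open ToCubes Equal Equal-isEquivalence using (U; V; V-cubes)
    in ↪⇒RCA {A} U V V-cubes (↪-trans {A = A} {B = B} {C = fullSetAlgebra _≟_ U V} A↪B A↪𝔽)

  RCA⇒↪Edc : ∀ A → A ∈ RCA α → Σ (AlgebraOf α) λ B → B ∈ Edc α × (A ↪ B)
  RCA⇒↪Edc A (U , V , cubes , S , A≅S) = 𝔹 , (𝔹-isCA , 𝔹-isEdc infinite) ,
    ↪-trans {A = A} {B = 𝔽} {C = 𝔹}
      (↪-trans {A = A} {B = subalgebra 𝔽 S} {C = 𝔽} (≅⇒↪ {A = A} {B = subalgebra 𝔽 S} A≅S) (subalgebra-↪ {A = 𝔽} S))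
      𝔽↪𝔹
    where
    𝔽 = fullSetAlgebra _≟_ U V
    open FromCubes cubes
    open CubeAlgebra (IsDisjointUnionOfCubes.K cubes) part

  RCA⊆𝐒Edc : ∀ {A} → A ∈ RCA α → A ∈ 𝐒 (Edc α)
  RCA⊆𝐒Edc {A} A∈RCA =
    let B , B∈Edc , h = RCA⇒↪Edc A A∈RCA in ↪⇒𝐒 {K = Edc α} {A} {B} B∈Edc h

  non-Edc : Σ (AlgebraOf α) λ A → A ∈ RCA α × ¬ (A ∈ Edc α)
  non-Edc = 𝔸 , ↪⇒RCA {𝔸} U V V-cubes 𝔸↪𝔽 , λ (isCA , edc) → ¬edc isCA edc
    where open Counterexample em (Ordinal._<_ α) isStrictTotalOrder infinite

theorem4p2 : ∀ {ℓ} → ExcludedMiddle (lsuc ℓ) → AxiomOfChoice ℓ →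
    (α : Ordinal ℓ) → Infinite (Ordinal.Carrier α) →
    (Σ (AlgebraOf α) λ A → A ∈ RCA α × ¬ (A ∈ Edc α)) ×
    ((A : AlgebraOf α) → A ∈ RCA α → Σ (AlgebraOf α) λ B → B ∈ Edc α × (A ↪ B)) ×
    Edc α ⊂ 𝐒 (Edc α) ×
    𝐒 (Edc α) ≐ RCA α
theorem4p2 em ac α infinite =
  non-Edc ,
  RCA⇒↪Edc ,
  ((λ {A} → Edc⊆𝐒Edc {A}) ,
    λ 𝐒Edc⊆Edc → let A , A∈RCA , A∉Edc = non-Edc in A∉Edc (𝐒Edc⊆Edc (RCA⊆𝐒Edc {A} A∈RCA))) ,
  (λ {A} → 𝐒Edc⊆RCA {A}) , (λ {A} → RCA⊆𝐒Edc {A})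
  where open Classes (lowerExcludedMiddle em) ac α infinite
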